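{- Let $m$ be an odd positive integer and let $2^s\geq 4$. Suppose the symmetric vector $(a_0,a_1,\ldots,a_{2^s-1})\in\mathbb{F}_2^{2^s}$ satisfies $a_0=1$, $a_{2^{s-1}}=0$ and $\sum_{0\leq i\leq 2^{s-1}-1,\ i\text{ odd}}a_i=1$, and the symmetric vector $(b_0,b_1,\ldots,b_{m-1})\in\mathbb{F}_2^m$ satisfies $\gcd\left(\sum_{0\leq i\leq m-1}b_ix^i,\ x^m-1\right)=1$ in $\mathbb{F}_2[x]$. Then there exists a normal element of $\mathbb{F}_{2^{2^sm}}$ over $\mathbb{F}_2$ with corresponding vector $(c_0,c_1,\ldots,c_{2^sm-1})\in\mathbb{F}_2^{2^sm}$ such that $c_k=a_{k\ (\mathrm{mod}\ 2^s)}\,b_{k\ (\mathrm{mod}\ m)}$ for $0\leq k\leq 2^sm-1$.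
   Context: For a positive integer $N$, an element $\alpha\in\mathbb{F}_{2^N}$ is a normal element of $\mathbb{F}_{2^N}$ over $\mathbb{F}_2$ if $\{\alpha,\alpha^2,\alpha^{2^2},\ldots,\alpha^{2^{N-1}}\}$ is a basis of $\mathbb{F}_{2^N}$ over $\mathbb{F}_2$. The trace function is $\mathrm{Tr}_{2^N|2}(x)=\sum_{i=0}^{N-1}x^{2^i}$. The corresponding vector of $\alpha\in\mathbb{F}_{2^N}$ is $(c_0,\ldots,c_{N-1})\in\mathbb{F}_2^N$ with $c_i=\mathrm{Tr}_{2^N|2}(\alpha\cdot\alpha^{2^i})$ for $0\leq i\leq N-1$. A vector $(a_0,\ldots,a_{N-1})$ is symmetric if $a_i=a_{N-i}$ for all $1\leq i\leq N-1$. Subscripts $k\ (\mathrm{mod}\ 2^s)$ and $k\ (\mathrm{mod}\ m)$ denote least nonnegative residues. -}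

module Defs where

open import Algebra.Apartness.Bundles using (HeytingField; HeytingCommutativeRing)
open import Algebra.Bundles using (CommutativeRing)
open import Algebra.Bundles.Raw using (RawRing; RawSemiring)
import Algebra.Definitions.RawSemiring as RawSemiringDefinitions
open import Data.Fin.Base using (Fin; toℕ)
open import Data.List.Base using (List; []; _∷_; map)
open import Data.Nat.Base as ℕ using (ℕ; zero; suc; NonZero)
open import Data.Nat.DivMod using (_mod_)
open import Data.Parity.Base using (Parity; 0ℙ; 1ℙ)
import Data.Parity.Properties as ℙ
open import Data.Product.Base using (_×_; ∃-syntax)
open import Data.Vec.Functional using (Vector)
open import Function.Bundles using (Inverse)
open import Level using (Level; _⊔_)
open import Relation.Binary.PropositionalEquality.Core using (_≡_)
open import Relation.Binary.PropositionalEquality.Properties as ≡ using ()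

private
  variable
    a : Level
    A : Set a
    n : ℕ

-- The library's ring ℙ of parities is the field with two elements.

𝔽₂-ring : CommutativeRing _ _
𝔽₂-ring = ℙ.+-*-commutativeRing

𝔽₂ : Set
𝔽₂ = CommutativeRing.Carrier 𝔽₂-ring

-- v ⟨ k ⟩ is the entry of v at the least nonnegative residue of k modulo n;
-- for k < n this is simply the k-th entry.

infix 9 _⟨_⟩

_⟨_⟩ : Vector A n → ℕ → .{{NonZero n}} → A
_⟨_⟩ {n = n} v k = v (k mod n)

-- Two indices below n with sum n both lie in 1, …, n ∸ 1.

Symmetric : Vector A n → Set _
Symmetric {n = n} v = ∀ (i j : Fin n) → toℕ i ℕ.+ toℕ j ≡ n → v i ≡ v j

------------------------------------------------------------------------
-- Polynomials in one variable

-- A polynomial is a list of coefficients, constant term first.  Trailing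
-- zeros are allowed, so equality compares coefficients in every degree.

module Polynomial {c ℓ} (R : RawRing c ℓ) where
  private module R = RawRing R

  Poly : Set c
  Poly = List R.Carrier

  coeff : Poly → ℕ → R.Carrier
  coeff []      _       = R.0#
  coeff (x ∷ p) zero    = x
  coeff (x ∷ p) (suc k) = coeff p k

  infix 4 _≈ₚ_

  _≈ₚ_ : Poly → Poly → Set ℓ
  p ≈ₚ q = ∀ k → coeff p k R.≈ coeff q k

  infixl 6 _+ₚ_
  infixl 7 _*ₚ_

  _+ₚ_ : Poly → Poly → Poly
  []      +ₚ q       = q
  (x ∷ p) +ₚ []      = x ∷ p
  (x ∷ p) +ₚ (y ∷ q) = (x R.+ y) ∷ (p +ₚ q)

  _*ₚ_ : Poly → Poly → Poly
  []      *ₚ q = []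
  (x ∷ p) *ₚ q = map (x R.*_) q +ₚ (R.0# ∷ p *ₚ q)

  rawRing : RawRing c ℓ
  rawRing = record
    { Carrier = Poly
    ; _≈_     = _≈ₚ_
    ; _+_     = _+ₚ_
    ; _*_     = _*ₚ_
    ; -_      = map R.-_
    ; 0#      = []
    ; 1#      = R.1# ∷ []
    }

  X : Poly
  X = R.0# ∷ R.1# ∷ []

module GCD {c ℓ} (R : RawSemiring c ℓ) where
  open RawSemiring R using (Carrier)
  open RawSemiringDefinitions R using (_∣_)

  IsGCD : (f g d : Carrier) → Set (c ⊔ ℓ)
  IsGCD f g d = d ∣ f × d ∣ g × (∀ {e} → e ∣ f → e ∣ g → e ∣ d)

module 𝔽₂ where
  open CommutativeRing 𝔽₂-ring public using (_*_)
  open RawSemiringDefinitions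
    (RawRing.rawSemiring (CommutativeRing.rawRing 𝔽₂-ring)) public using (sum)

-- Over 𝔽₂ the only unit of the polynomial ring is 1, so a gcd of two
-- polynomials that are not both zero is unique, and monic.

module 𝔽₂[x] where
  open Polynomial (CommutativeRing.rawRing 𝔽₂-ring) public using (Poly; X; coeff; rawRing)
  open RawRing rawRing public using (_+_; -_; 1#)
  open RawSemiringDefinitions (RawRing.rawSemiring rawRing) public using (_^_)
  open GCD (RawRing.rawSemiring rawRing) public using (IsGCD)

  X^[_]-1 : ℕ → Poly
  X^[ m ]-1 = X ^ m + - 1#

------------------------------------------------------------------------
-- Finite fields of order 2^N as extensions of 𝔽₂

-- On a finite carrier equality is decidable, so the apartness of a Heyting
-- field is just inequality, and the structure is that of an ordinary field.

module Extension {c ℓ₁ ℓ₂} (F : HeytingField c ℓ₁ ℓ₂) where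
  private
    F-ring : CommutativeRing c ℓ₁
    F-ring = HeytingCommutativeRing.commutativeRing
               (HeytingField.heytingCommutativeRing F)

  open CommutativeRing F-ring
  open RawSemiringDefinitions (RawRing.rawSemiring rawRing) using (sum; _^_)

  HasOrder : ℕ → Set (c ⊔ ℓ₁)
  HasOrder q = Inverse setoid (≡.setoid (Fin q))

  -- A ring homomorphism as soon as F has characteristic 2.

  ι : 𝔽₂ → Carrier
  ι 0ℙ = 0#
  ι 1ℙ = 1#

  combination : Vector 𝔽₂ n → Vector Carrier n → Carrier
  combination k v = sum (λ i → ι (k i) * v i)

  LinearlyIndependent : Vector Carrier n → Set ℓ₁
  LinearlyIndependent v = ∀ k → combination k v ≈ 0# → ∀ i → k i ≡ 0ℙ

  Spanning : Vector Carrier n → Set (c ⊔ ℓ₁)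
  Spanning v = ∀ x → ∃[ k ] combination k v ≈ x

  IsBasis : Vector Carrier n → Set (c ⊔ ℓ₁)
  IsBasis v = LinearlyIndependent v × Spanning v

  -- In the remaining definitions F is meant to have order 2 ^ N.

  conjugates : ∀ N → Carrier → Vector Carrier N
  conjugates N α i = α ^ (2 ℕ.^ toℕ i)

  IsNormal : ℕ → Carrier → Set (c ⊔ ℓ₁)
  IsNormal N α = IsBasis (conjugates N α)

  Tr : ℕ → Carrier → Carrier
  Tr N x = sum (conjugates N x)

  IsCorrespondingVector : ∀ N → Carrier → Vector 𝔽₂ N → Set ℓ₁
  IsCorrespondingVector N α v =
    ∀ i → ι (v i) ≈ Tr N (α * α ^ (2 ℕ.^ toℕ i))

{-# OPTIONS --safe #-}
module Submission where

-- Let σ be the Frobenius map, and let 𝔽₂[σ] act on the fixed field of σ ^ n.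
-- The corresponding vector of x, read as an element θ x of 𝔽₂[σ], satisfies
-- θ (d x) = d d⋆ (θ x), where ⋆ inverts σ.  So a symmetric vector is realized
-- once it is a norm d d⋆ times the vector of a known element.
--
-- For n = 2 ^ s put y = σ + σ⁻¹, which is nilpotent.  The hypotheses on a say
-- that a ≡ 1 + y modulo y², and θ x has the same shape whenever x has trace 1.
-- The quotient is some 1 + y w, the norm of 1 + q (1 + σ) with q + q² = w.
--
-- For n = m odd the ring is finite and reduced, so every element is a proper
-- power of itself.  This gives idempotents, from which an x with annihilator 0
-- is built; then θ x is a unit, and symmetric elements are squares of symmetric
-- elements.
--
-- By the Chinese remainder theorem the product of the two solutions has the
-- vector c with c k = a k * b k.  As an element of 𝔽₂[σ] it is a unit, because
-- its power with exponent 2 ^ s is (Σ a) b(σ ^ 2 ^ s) and b is invertible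
-- modulo X ^ m - 1.  Hence the conjugates of the product are independent.

open import Algebra.Apartness.Bundles using (HeytingField; HeytingCommutativeRing)
open import Algebra.Bundles using (CommutativeMonoid; CommutativeRing; CommutativeSemiring)
open import Algebra.Bundles.Raw using (RawRing)
import Algebra.Definitions.RawSemiring as RawSemiringDefinitions
open import Data.Bool.Base using (if_then_else_)
open import Data.Fin.Base as Fin using (Fin; zero; suc; toℕ)
open import Data.Fin.Permutation using (permutation)
import Data.Fin.Properties as Fin
open import Data.List.Base as List using ([]; _∷_; length)
open import Data.Maybe.Base using (Maybe; just; nothing)
open import Data.Nat.Base as ℕ using (ℕ; zero; suc; s≤s; z≤n; NonZero)
import Data.Nat.Divisibility as ℕ
import Data.Nat.DivMod as ℕ
import Data.Nat.Properties as ℕ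
open import Data.Parity.Base as ℙ using (0ℙ; 1ℙ)
import Data.Parity.Properties as ℙ
open import Data.Product.Base using (_×_; _,_; ∃-syntax; proj₁; proj₂)
open import Data.Sum.Base using (_⊎_; inj₁; inj₂)
import Data.Vec.Base as Vec
open import Data.Vec.Functional using (Vector; toList)
import Data.Vec.Properties as Vec
open import Function.Base using (_∘_; id)
open import Function.Bundles using (Inverse)
open import Level using (_⊔_)
open import Relation.Binary.PropositionalEquality as ≡ using (_≡_; _≢_)
open import Relation.Nullary.Decidable using (Dec; yes; no; map′; decidable-stable; ¬?)
open import Relation.Nullary.Decidable.Core using (does)
open import Relation.Nullary.Negation using (¬_; contradiction)
open import Relation.Unary using (Pred; Decidable)
open import Defs

-- Sums over ranges

-- Operators determine their coefficients because a nonzero linearized polynomial of degree below 2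
-- ^ N has too few roots to vanish on the whole field; relative traces carry this faithfulness down
-- to the fixed field of each σ ^ n. This is what turns an identity in 𝔽₂[σ] into an identity of
-- vectors.
--
-- The degree is split because the two factors meet opposite obstacles. For odd degree squaring is
-- bijective, so norms are plentiful, and the difficulty is to find an x whose θ x is a unit at all.
-- For degree 2 ^ s square roots are missing, and a norm has to be built by solving the
-- Artin-Schreier equation q + q² = w, which is possible because w is nilpotent.
--
-- The coefficient of y in θ x is the sum of the autocorrelations at the odd indices below 2 ^ (s -
-- 1). It is 1 for x of trace 1: the sum equals the norm of the trace of x to 𝔽₄, and that trace is
-- a primitive cube root of unity.

module RangeSum {c ℓ} (R : CommutativeSemiring c ℓ) where
  open CommutativeSemiring R
  open import Algebra.Properties.Semiring.Sum semiring
    using (sum; sum-cong-≋; ∑-distrib-+; ∑-comm; *-distribˡ-sum; sum-replicate-zero)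
  open import Relation.Binary.Reasoning.Setoid setoid

  Σ< : ℕ → (ℕ → Carrier) → Carrier
  Σ< n f = sum {n} (λ i → f (toℕ i))

  syntax Σ< n (λ k → x) = Σ[ k < n ] x

  Σ-cong-< : ∀ n {f g} → (∀ k → k ℕ.< n → f k ≈ g k) → Σ< n f ≈ Σ< n g
  Σ-cong-< n f≈g = sum-cong-≋ {n} (λ i → f≈g (toℕ i) (Fin.toℕ<n i))

  Σ-cong : ∀ n {f g} → (∀ k → f k ≈ g k) → Σ< n f ≈ Σ< n g
  Σ-cong n f≈g = Σ-cong-< n (λ k _ → f≈g k)

  Σ-cong-≡ : ∀ n f {g h : ℕ → ℕ} → (∀ k → g k ≡ h k) → Σ[ k < n ] f (g k) ≈ Σ[ k < n ] f (h k)
  Σ-cong-≡ n f g≡h = Σ-cong n (λ k → reflexive (≡.cong f (g≡h k)))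

  Σ-zero : ∀ n → Σ[ k < n ] 0# ≈ 0#
  Σ-zero = sum-replicate-zero

  Σ-distrib-+ : ∀ n f g → Σ[ k < n ] (f k + g k) ≈ Σ< n f + Σ< n g
  Σ-distrib-+ n f g = ∑-distrib-+ {n} (f ∘ toℕ) (g ∘ toℕ)

  *-distribˡ-Σ : ∀ n x f → x * Σ< n f ≈ Σ[ k < n ] (x * f k)
  *-distribˡ-Σ n x f = *-distribˡ-sum {n} x (f ∘ toℕ)

  *-distribʳ-Σ : ∀ n x f → Σ< n f * x ≈ Σ[ k < n ] (f k * x)
  *-distribʳ-Σ n x f = trans (*-comm _ _) (trans (*-distribˡ-Σ n x f) (Σ-cong n (λ k → *-comm x (f k))))

  Σ-swap : ∀ m n (f : ℕ → ℕ → Carrier) →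
    Σ[ i < m ] Σ[ j < n ] f i j ≈ Σ[ j < n ] Σ[ i < m ] f i j
  Σ-swap m n f = ∑-comm {m} {n} (λ i j → f (toℕ i) (toℕ j))

  Σ-last : ∀ n f → Σ< (suc n) f ≈ Σ< n f + f n
  Σ-last zero    f = +-comm _ _
  Σ-last (suc n) f = trans (+-congˡ (Σ-last n (f ∘ suc))) (sym (+-assoc _ _ _))

  Σ-split : ∀ m n f → Σ< (m ℕ.+ n) f ≈ Σ< m f + Σ[ k < n ] f (m ℕ.+ k)
  Σ-split zero    n f = sym (+-identityˡ _)
  Σ-split (suc m) n f = trans (+-congˡ (Σ-split m n (f ∘ suc))) (sym (+-assoc _ _ _))

  Σ-blocks : ∀ m n f → Σ< (m ℕ.* n) f ≈ Σ[ j < m ] Σ[ i < n ] f (j ℕ.* n ℕ.+ i)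
  Σ-blocks zero    n f = refl
  Σ-blocks (suc m) n f = trans (Σ-split n (m ℕ.* n) f) (+-congˡ (trans
    (Σ-blocks m n (λ k → f (n ℕ.+ k)))
    (Σ-cong m (λ j → Σ-cong-≡ n f (λ i → ≡.sym (ℕ.+-assoc n (j ℕ.* n) i))))))

  Σ-reverse : ∀ n f → Σ< n f ≈ Σ[ k < n ] f (n ℕ.∸ suc k)
  Σ-reverse zero    f = refl
  Σ-reverse (suc n) f = trans (Σ-last n f) (trans (+-comm _ _) (+-congˡ (Σ-reverse n f)))

  Σ-even-odd-odd : ∀ h f → Σ< (h ℕ.+ suc h) f ≈ Σ[ k < suc h ] f (k ℕ.+ k) + Σ[ k < h ] f (suc (k ℕ.+ k))
  Σ-even-odd-even : ∀ h f → Σ< (h ℕ.+ h) f ≈ Σ[ k < h ] f (k ℕ.+ k) + Σ[ k < h ] f (suc (k ℕ.+ k))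

  Σ-even-odd-odd h f = begin
    Σ< (h ℕ.+ suc h) f             ≡⟨ ≡.cong (λ n → Σ< n f) (ℕ.+-suc h h) ⟩
    Σ< (suc (h ℕ.+ h)) f           ≈⟨ Σ-last (h ℕ.+ h) f ⟩
    Σ< (h ℕ.+ h) f + f (h ℕ.+ h)   ≈⟨ +-congʳ (Σ-even-odd-even h f) ⟩
    (Σ[ k < h ] f (k ℕ.+ k) + Σ[ k < h ] f (suc (k ℕ.+ k))) + f (h ℕ.+ h)
      ≈⟨ trans (+-assoc _ _ _) (trans (+-congˡ (+-comm _ _)) (sym (+-assoc _ _ _))) ⟩
    (Σ[ k < h ] f (k ℕ.+ k) + f (h ℕ.+ h)) + Σ[ k < h ] f (suc (k ℕ.+ k))
      ≈⟨ +-congʳ (Σ-last h (λ k → f (k ℕ.+ k))) ⟨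
    Σ[ k < suc h ] f (k ℕ.+ k) + Σ[ k < h ] f (suc (k ℕ.+ k)) ∎

  Σ-even-odd-even zero    f = sym (+-identityˡ _)
  Σ-even-odd-even (suc h) f = begin
    Σ< (suc (h ℕ.+ suc h)) f       ≈⟨ Σ-last (h ℕ.+ suc h) f ⟩
    Σ< (h ℕ.+ suc h) f + f (h ℕ.+ suc h)
      ≈⟨ +-cong (Σ-even-odd-odd h f) (reflexive (≡.cong f (ℕ.+-suc h h))) ⟩
    (Σ[ k < suc h ] f (k ℕ.+ k) + Σ[ k < h ] f (suc (k ℕ.+ k))) + f (suc (h ℕ.+ h))
      ≈⟨ +-assoc _ _ _ ⟩
    Σ[ k < suc h ] f (k ℕ.+ k) + (Σ[ k < h ] f (suc (k ℕ.+ k)) + f (suc (h ℕ.+ h)))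
      ≈⟨ +-congˡ (Σ-last h (λ k → f (suc (k ℕ.+ k)))) ⟨
    Σ[ k < suc h ] f (k ℕ.+ k) + Σ[ k < suc h ] f (suc (k ℕ.+ k)) ∎

  Periodic : ℕ → (ℕ → Carrier) → Set ℓ
  Periodic n f = ∀ k → f (n ℕ.+ k) ≈ f k

  Periodic-* : ∀ n f → Periodic n f → ∀ j → Periodic (j ℕ.* n) f
  Periodic-* n f per zero    k = refl
  Periodic-* n f per (suc j) k =
    trans (reflexive (≡.cong f (ℕ.+-assoc n (j ℕ.* n) k))) (trans (per _) (Periodic-* n f per j k))

  Σ-shift : ∀ n f → Periodic n f → ∀ j → Σ[ k < n ] f (j ℕ.+ k) ≈ Σ< n f
  Σ-shift n f per zero    = refl
  Σ-shift n f per (suc j) = begin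
    Σ[ k < n ] f (suc (j ℕ.+ k))  ≈⟨ Σ-cong-≡ n f (λ k → ≡.sym (ℕ.+-suc j k)) ⟩
    Σ[ k < n ] f (j ℕ.+ suc k)
      ≈⟨ rotate n (λ k → f (j ℕ.+ k))
           (trans (reflexive
           (≡.cong f (≡.trans (ℕ.+-comm j n) (≡.cong (n ℕ.+_) (≡.sym (ℕ.+-identityʳ j)))))) (per _)) ⟩
    Σ[ k < n ] f (j ℕ.+ k)        ≈⟨ Σ-shift n f per j ⟩
    Σ< n f                        ∎
    where
    rotate : ∀ n h → h n ≈ h 0 → Σ[ k < n ] h (suc k) ≈ Σ< n h
    rotate zero    h eq = refl
    rotate (suc n) h eq = trans (Σ-last n (h ∘ suc)) (trans (+-comm _ _) (+-congʳ eq))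

  -- Doubling permutes the residues modulo the odd number `h + suc h`: the first `suc h` doubles are
  -- the even residues, and the other `h` wrap around once to the odd ones.
  Σ-double : ∀ h {f} → Periodic (h ℕ.+ suc h) f → Σ[ k < h ℕ.+ suc h ] f (k ℕ.+ k) ≈ Σ< (h ℕ.+ suc h) f
  Σ-double h {f} per = begin
    Σ[ k < h ℕ.+ suc h ] f (k ℕ.+ k)
      ≡⟨ ≡.cong (λ n → Σ[ k < n ] f (k ℕ.+ k)) (ℕ.+-comm h (suc h)) ⟩
    Σ[ k < suc h ℕ.+ h ] f (k ℕ.+ k)
      ≈⟨ Σ-split (suc h) h (λ k → f (k ℕ.+ k)) ⟩
    Σ[ k < suc h ] f (k ℕ.+ k) + Σ[ k < h ] f ((suc h ℕ.+ k) ℕ.+ (suc h ℕ.+ k))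
      ≈⟨ +-congˡ (Σ-cong h (λ k → trans (reflexive (≡.cong f (wrap k))) (per _))) ⟩
    Σ[ k < suc h ] f (k ℕ.+ k) + Σ[ k < h ] f (suc (k ℕ.+ k))
      ≈⟨ Σ-even-odd-odd h f ⟨
    Σ< (h ℕ.+ suc h) f ∎
    where
    open import Data.Nat.Solver using (module +-*-Solver)
    open +-*-Solver
    wrap : ∀ k → (suc h ℕ.+ k) ℕ.+ (suc h ℕ.+ k) ≡ (h ℕ.+ suc h) ℕ.+ suc (k ℕ.+ k)
    wrap k = solve 2 (λ h k → (con 1 :+ h :+ k) :+ (con 1 :+ h :+ k) :=
        (h :+ (con 1 :+ h)) :+ (con 1 :+ (k :+ k))) ≡.refl h k

  Periodic-scale : ∀ {n f} → Periodic n f → ∀ q → Periodic n (λ k → f (q ℕ.* k))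
  Periodic-scale {n} {f} per q k =
    trans (reflexive (≡.cong f (ℕ.*-distribˡ-+ q n k))) (Periodic-* n f per q (q ℕ.* k))

  Σ-scale-2^ : ∀ h {f} → Periodic (h ℕ.+ suc h) f → ∀ s →
      Σ[ k < h ℕ.+ suc h ] f (2 ℕ.^ s ℕ.* k) ≈ Σ< (h ℕ.+ suc h) f
  Σ-scale-2^ h {f} per zero    = Σ-cong-≡ (h ℕ.+ suc h) f ℕ.*-identityˡ
  Σ-scale-2^ h {f} per (suc s) = begin
    Σ[ k < m ] f (2 ℕ.^ suc s ℕ.* k)
      ≈⟨ Σ-cong-≡ m f
           (λ k → ≡.trans (≡.cong (ℕ._* k) (ℕ.*-comm 2 (2 ℕ.^ s)))
           (≡.trans (ℕ.*-assoc (2 ℕ.^ s) 2 k)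
           (≡.cong (λ j → 2 ℕ.^ s ℕ.* (k ℕ.+ j)) (ℕ.+-identityʳ k)))) ⟩
    Σ[ k < m ] f (2 ℕ.^ s ℕ.* (k ℕ.+ k))
      ≈⟨ Σ-double h {λ k → f (2 ℕ.^ s ℕ.* k)} (Periodic-scale {m} {f} per (2 ℕ.^ s)) ⟩
    Σ[ k < m ] f (2 ℕ.^ s ℕ.* k) ≈⟨ Σ-scale-2^ h per s ⟩
    Σ< m f ∎
    where m = h ℕ.+ suc h

  -- Each residue pair occurs once; on indices i + 2 ^ s l the second factor
  -- sees l ↦ 2 ^ s l, a permutation of the residues modulo an odd number.
  Σ-CRT : ∀ s h {f g} → Periodic (2 ℕ.^ s) f → Periodic (h ℕ.+ suc h) g →
    Σ[ k < 2 ℕ.^ s ℕ.* (h ℕ.+ suc h) ] (f k * g k) ≈ Σ< (2 ℕ.^ s) f * Σ< (h ℕ.+ suc h) g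
  Σ-CRT s h {f} {g} perf perg = begin
    Σ[ k < n ℕ.* m ] (f k * g k)  ≡⟨ ≡.cong (λ N → Σ[ k < N ] (f k * g k)) (ℕ.*-comm n m) ⟩
    Σ[ k < m ℕ.* n ] (f k * g k)  ≈⟨ Σ-blocks m n (λ k → f k * g k) ⟩
    Σ[ l < m ] Σ[ i < n ] (f (l ℕ.* n ℕ.+ i) * g (l ℕ.* n ℕ.+ i))
      ≈⟨ Σ-swap m n (λ l i → f (l ℕ.* n ℕ.+ i) * g (l ℕ.* n ℕ.+ i)) ⟩
    Σ[ i < n ] Σ[ l < m ] (f (l ℕ.* n ℕ.+ i) * g (l ℕ.* n ℕ.+ i))
      ≈⟨ Σ-cong n (λ i → Σ-cong m (λ l → *-congʳ {g (l ℕ.* n ℕ.+ i)} (Periodic-* n f perf l i))) ⟩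
    Σ[ i < n ] Σ[ l < m ] (f i * g (l ℕ.* n ℕ.+ i))
      ≈⟨ Σ-cong n (λ i → *-distribˡ-Σ m (f i) (λ l → g (l ℕ.* n ℕ.+ i))) ⟨
    Σ[ i < n ] (f i * Σ[ l < m ] g (l ℕ.* n ℕ.+ i))
      ≈⟨ Σ-cong n (λ i → *-congˡ {f i} (inner i)) ⟩
    Σ[ i < n ] (f i * Σ< m g)
      ≈⟨ *-distribʳ-Σ n (Σ< m g) f ⟨
    Σ< n f * Σ< m g ∎
    where
    n = 2 ℕ.^ s
    m = h ℕ.+ suc h
    inner : ∀ i → Σ[ l < m ] g (l ℕ.* n ℕ.+ i) ≈ Σ< m g
    inner i = begin
      Σ[ l < m ] g (l ℕ.* n ℕ.+ i)
        ≈⟨ Σ-cong-≡ m g (λ l → ≡.trans (ℕ.+-comm (l ℕ.* n) i) (≡.cong (i ℕ.+_) (ℕ.*-comm l n))) ⟩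
      Σ[ l < m ] g (i ℕ.+ n ℕ.* l)
        ≈⟨ Σ-scale-2^ h {λ k → g (i ℕ.+ k)} shifted s ⟩
      Σ[ l < m ] g (i ℕ.+ l)
        ≈⟨ Σ-shift m g perg i ⟩
      Σ< m g ∎
      where
      shifted : Periodic m (λ k → g (i ℕ.+ k))
      shifted k = trans
          (reflexive (≡.cong g
          (≡.trans (≡.sym (ℕ.+-assoc i m k))
          (≡.trans (≡.cong (ℕ._+ k) (ℕ.+-comm i m)) (ℕ.+-assoc m i k))))) (perg (i ℕ.+ k))

-- Rings of characteristic two

HasCharacteristicTwo : ∀ {c ℓ} → CommutativeRing c ℓ → Set ℓ
HasCharacteristicTwo R = 1# + 1# ≈ 0#
  where open CommutativeRing R

module CharTwo {c ℓ} (R : CommutativeRing c ℓ) (1+1≈0 : HasCharacteristicTwo R) where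
  open CommutativeRing R
  open import Algebra.Properties.Semiring.Exp semiring public
  open import Algebra.Properties.CommutativeSemiring.Exp commutativeSemiring using (^-distrib-*) public
  open import Algebra.Solver.Ring.AlmostCommutativeRing using (fromCommutativeRing; _-Raw-AlmostCommutative⟶_)
  open import Relation.Binary.Reasoning.Setoid setoid
  open RangeSum commutativeSemiring public

  x+x≈0 : ∀ x → x + x ≈ 0#
  x+x≈0 x = begin
    x + x              ≈⟨ +-cong (*-identityˡ x) (*-identityˡ x) ⟨
    1# * x + 1# * x    ≈⟨ distribʳ x 1# 1# ⟨
    (1# + 1#) * x      ≈⟨ *-congʳ 1+1≈0 ⟩
    0# * x             ≈⟨ zeroˡ x ⟩
    0#                 ∎

  -- The structure map of an 𝔽₂-algebra, needed for the field and for the operator rings alike. As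
  -- coefficient map of the ring solver it lets identities be decided modulo two.
  bit : 𝔽₂ → Carrier
  bit 0ℙ = 0#
  bit 1ℙ = 1#

  bit-+ : ∀ x y → bit (x ℙ.+ y) ≈ bit x + bit y
  bit-+ 0ℙ y  = sym (+-identityˡ _)
  bit-+ 1ℙ 0ℙ = sym (+-identityʳ _)
  bit-+ 1ℙ 1ℙ = sym 1+1≈0

  bit-* : ∀ x y → bit (x ℙ.* y) ≈ bit x * bit y
  bit-* 0ℙ y = sym (zeroˡ _)
  bit-* 1ℙ y = sym (*-identityˡ _)

  private
    neg : ∀ x → x ≈ - x
    neg x = begin
      x              ≈⟨ +-identityʳ x ⟨
      x + 0#         ≈⟨ +-congˡ (-‿inverseʳ x) ⟨
      x + (x + - x)  ≈⟨ +-assoc _ _ _ ⟨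
      (x + x) + - x  ≈⟨ +-congʳ (x+x≈0 x) ⟩
      0# + - x       ≈⟨ +-identityˡ _ ⟩
      - x            ∎

    homo : CommutativeRing.rawRing 𝔽₂-ring -Raw-AlmostCommutative⟶ fromCommutativeRing R
    homo = record
      { ⟦_⟧    = bit
      ; +-homo = bit-+
      ; *-homo = bit-*
      ; -‿homo = λ x → neg (bit x)
      ; 0-homo = refl
      ; 1-homo = refl
      }

    bit-≟ : ∀ x y → Maybe (bit x ≈ bit y)
    bit-≟ x y with x ℙ.≟ y
    ... | yes x≡y = just (reflexive (≡.cong bit x≡y))
    ... | no _    = nothing

  open import Algebra.Solver.Ring (CommutativeRing.rawRing 𝔽₂-ring) (fromCommutativeRing R) homo bit-≟ public
    using (solve; con; _:+_; _:*_; _:=_)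

  x+y≈0⇒x≈y : ∀ {x y} → x + y ≈ 0# → x ≈ y
  x+y≈0⇒x≈y {x} {y} eq = begin
    x            ≈⟨ solve 2 (λ x y → x := (x :+ y) :+ y) refl x y ⟩
    (x + y) + y  ≈⟨ +-congʳ eq ⟩
    0# + y       ≈⟨ +-identityˡ y ⟩
    y            ∎

  x≈y⇒x+y≈0 : ∀ {x y} → x ≈ y → x + y ≈ 0#
  x≈y⇒x+y≈0 {x} {y} eq = trans (+-congʳ eq) (x+x≈0 y)

  -- In the field this is the action of σ ^ t; in an operator ring it raises the operator itself to
  -- the power 2 ^ t, which is a different map.
  frob : ℕ → Carrier → Carrier
  frob t x = x ^ (2 ℕ.^ t)

  x^2≈x*x : ∀ x → x ^ 2 ≈ x * x
  x^2≈x*x x = *-congˡ (*-identityʳ x)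

  frob-suc : ∀ t x → frob (suc t) x ≈ frob t (x * x)
  frob-suc t x = trans (sym (^-assocʳ x 2 (2 ℕ.^ t))) (^-congˡ (2 ℕ.^ t) (x^2≈x*x x))

  frob-sq : ∀ t x → frob (suc t) x ≈ frob t x * frob t x
  frob-sq t x = trans (frob-suc t x) (^-distrib-* x x (2 ℕ.^ t))

  frob-cong : ∀ t {x y} → x ≈ y → frob t x ≈ frob t y
  frob-cong t = ^-congˡ (2 ℕ.^ t)

  frob-0 : ∀ t → frob t 0# ≈ 0#
  frob-0 zero    = zeroˡ _
  frob-0 (suc t) = trans (frob-suc t 0#) (trans (frob-cong t (zeroˡ _)) (frob-0 t))

  frob-1 : ∀ t → frob t 1# ≈ 1#
  frob-1 zero    = *-identityʳ _
  frob-1 (suc t) = trans (frob-suc t 1#) (trans (frob-cong t (*-identityʳ _)) (frob-1 t))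

  frob-bit : ∀ t x → frob t (bit x) ≈ bit x
  frob-bit t 0ℙ = frob-0 t
  frob-bit t 1ℙ = frob-1 t

  frob-+ : ∀ t x y → frob t (x + y) ≈ frob t x + frob t y
  frob-+ zero    x y = trans (*-identityʳ _) (sym (+-cong (*-identityʳ _) (*-identityʳ _)))
  frob-+ (suc t) x y = begin
    frob (suc t) (x + y)           ≈⟨ frob-suc t _ ⟩
    frob t ((x + y) * (x + y))
      ≈⟨ frob-cong t (solve 2 (λ x y → (x :+ y) :* (x :+ y) := x :* x :+ y :* y) refl x y) ⟩
    frob t (x * x + y * y)         ≈⟨ frob-+ t _ _ ⟩
    frob t (x * x) + frob t (y * y) ≈⟨ +-cong (frob-suc t x) (frob-suc t y) ⟨
    frob (suc t) x + frob (suc t) y ∎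

  frob-* : ∀ t x y → frob t (x * y) ≈ frob t x * frob t y
  frob-* t x y = ^-distrib-* x y (2 ℕ.^ t)

  frob-Σ : ∀ t n f → frob t (Σ< n f) ≈ Σ[ k < n ] frob t (f k)
  frob-Σ t zero    f = frob-0 t
  frob-Σ t (suc n) f = trans (frob-+ t _ _) (+-congˡ (frob-Σ t n (f ∘ suc)))

  bit-sum : ∀ n (f : ℕ → 𝔽₂) → bit (𝔽₂.sum {n} (f ∘ toℕ)) ≈ Σ[ k < n ] bit (f k)
  bit-sum zero    f = refl
  bit-sum (suc n) f = trans (bit-+ (f 0) (𝔽₂.sum {n} (f ∘ suc ∘ toℕ))) (+-congˡ (bit-sum n (f ∘ suc)))

  1^n≈1 : ∀ n → 1# ^ n ≈ 1#
  1^n≈1 zero    = refl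
  1^n≈1 (suc n) = trans (*-identityˡ _) (1^n≈1 n)

  -- An element that is a proper power of itself generates the same ideal as an idempotent, namely
  -- `e`.
  module Periodic-power {x u} (per : x ^ (2 ℕ.+ u) ≈ x) where
    e : Carrier
    e = x ^ suc u

    e-identity : e * x ≈ x
    e-identity = trans (*-comm _ _) per

    e-idem : e * e ≈ e
    e-idem = begin
      (x * x ^ u) * e  ≈⟨ trans (*-congʳ (*-comm _ _)) (*-assoc _ _ _) ⟩
      x ^ u * (x * e)  ≈⟨ *-congˡ per ⟩
      x ^ u * x        ≈⟨ *-comm _ _ ⟩
      e                ∎

  -- x ^ k + x⁻¹ ^ k is a Dickson polynomial in y; only its residue modulo y² is needed.
  module Dickson {x x⁻¹} (inv : x * x⁻¹ ≈ 1#) where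
    private y = x + x⁻¹

    -- Since x x⁻¹ = 1, the sums D k = x ^ k + x⁻¹ ^ k satisfy D (2 + k) = y D (1 + k) + D k.
    -- Removing the part linear in y and dividing by y² leaves this recursion.
    quotient : ℕ → Carrier
    quotient zero          = 0#
    quotient (suc zero)    = 0#
    quotient (suc (suc k)) = bit (ℕ.parity (suc k)) + y * quotient (suc k) + quotient k

    dickson : ∀ k → x ^ k + x⁻¹ ^ k ≈ bit (ℕ.parity k) * y + y * y * quotient k
    dickson zero          = trans 1+1≈0 (sym (trans (+-cong (zeroˡ y) (zeroʳ (y * y))) (+-identityˡ 0#)))
    dickson (suc zero)    = trans (+-cong (*-identityʳ x) (*-identityʳ x⁻¹))
      (sym (trans (+-cong (*-identityˡ y) (zeroʳ (y * y))) (+-identityʳ y)))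
    dickson (suc (suc k)) = begin
      x * (x * p) + x⁻¹ * (x⁻¹ * q)
        ≈⟨ solve 4 (λ x z p q → x :* (x :* p) :+ z :* (z :* q) :=
             (x :+ z) :* (x :* p :+ z :* q) :+ (x :* z) :* (p :+ q)) refl x x⁻¹ p q ⟩
      y * (x * p + x⁻¹ * q) + (x * x⁻¹) * (p + q)
        ≈⟨ +-cong (*-congˡ (dickson (suc k))) (trans (*-congʳ inv) (trans (*-identityˡ _) (dickson k))) ⟩
      y * (bit (ℕ.parity (suc k)) * y + y * y * quotient (suc k))
          + (bit (ℕ.parity k) * y + y * y * quotient k)
        ≈⟨ solve 5 (λ y a b g h → y :* (b :* y :+ y :* y :* h) :+ (a :* y :+ y :* y :* g) :=
             a :* y :+ y :* y :* (b :+ y :* h :+ g)) refl y (bit (ℕ.parity k))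
                 (bit (ℕ.parity (suc k))) (quotient k) (quotient (suc k)) ⟩
      bit (ℕ.parity k) * y + y * y * quotient (suc (suc k)) ∎
      where
      p = x ^ k
      q = x⁻¹ ^ k

  -- An endomorphism that is not known to respect ≈; its fixed points are
  -- therefore tracked through the expressions that produce them.
  module Involution (_⋆ : Carrier → Carrier)
    (⋆-+ : ∀ x y → (x + y) ⋆ ≈ x ⋆ + y ⋆) (⋆-* : ∀ x y → (x * y) ⋆ ≈ x ⋆ * y ⋆)
    (⋆-1 : 1# ⋆ ≈ 1#) (⋆-0 : 0# ⋆ ≈ 0#) where

    Sym : Carrier → Set ℓ
    Sym x = x ⋆ ≈ x

    Sym-+ : ∀ {x y} → Sym x → Sym y → Sym (x + y)
    Sym-+ p q = trans (⋆-+ _ _) (+-cong p q)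

    Sym-* : ∀ {x y} → Sym x → Sym y → Sym (x * y)
    Sym-* p q = trans (⋆-* _ _) (*-cong p q)

    Sym-^ : ∀ {x} → Sym x → ∀ n → Sym (x ^ n)
    Sym-^ p zero    = ⋆-1
    Sym-^ p (suc n) = Sym-* p (Sym-^ p n)

    Sym-bit : ∀ x → Sym (bit x)
    Sym-bit 0ℙ = ⋆-0
    Sym-bit 1ℙ = ⋆-1

    Sym-Σ : ∀ n {f} → (∀ k → Sym (f k)) → Sym (Σ< n f)
    Sym-Σ zero    p = ⋆-0
    Sym-Σ (suc n) p = Sym-+ (p 0) (Sym-Σ n (p ∘ suc))

    IsNormOf : Carrier → Carrier → Carrier → Set ℓ
    IsNormOf x θ d = (d * d ⋆) * θ ≈ x

    -- For odd index the Frobenius is bijective, so symmetric elements are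
    -- squares of symmetric elements, i.e. norms.
    norm-odd : ∀ {t u b θ} → 2 ℕ.^ suc t ≡ 2 ℕ.+ u → Sym b → Sym θ →
      frob (suc t) b ≈ b → frob (suc t) θ ≈ θ → θ ^ suc u ≈ 1# → ∃[ d ] IsNormOf b θ d
    norm-odd {t} {u} {b} {θ} 2^t≡ sb sθ bper θper unit = d , (begin
      (d * d ⋆) * θ                    ≈⟨ *-congʳ (*-congˡ (Sym-^ (Sym-* sb (Sym-^ sθ u)) (2 ℕ.^ t))) ⟩
      (d * d) * θ                      ≈⟨ *-congʳ (frob-sq t (b * θ ^ u)) ⟨
      frob (suc t) (b * θ ^ u) * θ     ≈⟨ *-congʳ (frob-* (suc t) b (θ ^ u)) ⟩
      (frob (suc t) b * frob (suc t) (θ ^ u)) * θ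
        ≈⟨ *-congʳ (*-cong bper (trans (^-assocʳ θ u q) (trans (^-congʳ θ (ℕ.*-comm u q))
             (trans (sym (^-assocʳ θ q u)) (^-congˡ u θper))))) ⟩
      (b * θ ^ u) * θ                  ≈⟨ trans (*-assoc _ _ _) (*-congˡ (trans (*-comm _ _) unit)) ⟩
      b * 1#                           ≈⟨ *-identityʳ b ⟩
      b                                ∎)
      where
      -- `θ ^ u` is the inverse of θ. As `frob (suc t)` fixes b and θ, `frob t` extracts the square
      -- root of their quotient.
      d = frob t (b * θ ^ u)
      q = 2 ℕ.^ suc t

    -- With y = σ + σ⁻¹ nilpotent, a / θ = 1 + y w and q = Σ_{i<r} w ^ 2 ^ i
    -- solves q + q² = w; the norm of 1 + q (1 + σ) is 1 + y (q + q²).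
    norm-2-power : ∀ {σ σ⁻¹ r g g′ a θ} → let y = σ + σ⁻¹ in
      σ * σ⁻¹ ≈ 1# → σ ⋆ ≈ σ⁻¹ → Sym y → Sym g → Sym g′ → frob r y ≈ 0# →
      a ≈ 1# + y + y * y * g → θ ≈ 1# + y + y * y * g′ → ∃[ d ] IsNormOf a θ d
    norm-2-power {σ} {σ⁻¹} {r} {g} {g′} {a} {θ} inv σ⋆ sy sg sg′ nil a≈ θ≈ = d , (begin
      (d * d ⋆) * θ                ≈⟨ *-congʳ (*-congˡ d⋆) ⟩
      (d * (1# + q * (1# + σ⁻¹))) * θ
        ≈⟨ *-congʳ (solve 3
             (λ q s t → (con 1ℙ :+ q :* (con 1ℙ :+ s)) :* (con 1ℙ :+ q :* (con 1ℙ :+ t)) :=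
             con 1ℙ :+ q :* (s :+ t) :+ q :* q :* ((con 1ℙ :+ s :+ t) :+ s :* t)) refl q σ σ⁻¹) ⟩
      (1# + q * y + q * q * ((1# + σ + σ⁻¹) + σ * σ⁻¹)) * θ
        ≈⟨ *-congʳ (+-congˡ (*-congˡ (+-congˡ inv))) ⟩
      (1# + q * y + q * q * ((1# + σ + σ⁻¹) + 1#)) * θ
        ≈⟨ *-congʳ (solve 3
             (λ q s t → con 1ℙ :+ q :* (s :+ t) :+ q :* q :* ((con 1ℙ :+ s :+ t) :+ con 1ℙ) :=
             con 1ℙ :+ (s :+ t) :* (q :+ q :* q)) refl q σ σ⁻¹) ⟩
      (1# + y * (q + q * q)) * θ   ≈⟨ *-congʳ (+-congˡ (*-congˡ q+q²≈w)) ⟩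
      (1# + y * w) * θ             ≈⟨ *-congˡ θ≈ ⟩
      (1# + y * (θ₀ ^ u * (y * (g + g′)))) * θ₀
        ≈⟨ solve 4 (λ t v y h →
             (con 1ℙ :+ y :* (v :* (y :* h))) :* t := t :+ (t :* v) :* (y :* y :* h)) refl θ₀
             (θ₀ ^ u) y (g + g′) ⟩
      θ₀ + θ₀ ^ suc u * (y * y * (g + g′)) ≈⟨ +-congˡ (*-congʳ unit) ⟩
      θ₀ + 1# * (y * y * (g + g′))
        ≈⟨ solve 3 (λ y g h → (con 1ℙ :+ y :+ y :* y :* h) :+ con 1ℙ :* (y :* y :* (g :+ h)) :=
             con 1ℙ :+ y :+ y :* y :* g) refl y g g′ ⟩
      1# + y + y * y * g           ≈⟨ a≈ ⟨
      a                            ∎)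
      where
      y = σ + σ⁻¹
      θ₀ = 1# + y + y * y * g′
      u = ℕ.pred (2 ℕ.^ r)
      -- `θ₀ ^ u` is the inverse of θ₀, and a + θ = y² (g + g′). Only one factor y is split off; the
      -- one kept inside makes w nilpotent, so that the telescoping sum for q + q² ends in w alone.
      w = θ₀ ^ u * (y * (g + g′))
      q = Σ[ i < r ] frob i w
      d = 1# + q * (1# + σ)

      unit : θ₀ ^ suc u ≈ 1#
      unit = begin
        θ₀ ^ suc u  ≡⟨ ≡.cong (θ₀ ^_) (ℕ.suc-pred (2 ℕ.^ r) {{ℕ.m^n≢0 2 r}}) ⟩
        frob r θ₀
          ≈⟨ frob-cong r
               (solve 2 (λ y g → con 1ℙ :+ y :+ y :* y :* g := con 1ℙ :+ y :* (con 1ℙ :+ y :* g))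
               refl y g′) ⟩
        frob r (1# + y * (1# + y * g′)) ≈⟨ frob-+ r _ _ ⟩
        frob r 1# + frob r (y * (1# + y * g′))
          ≈⟨ +-cong (frob-1 r) (trans (frob-* r _ _) (trans (*-congʳ nil) (zeroˡ _))) ⟩
        1# + 0#     ≈⟨ +-identityʳ 1# ⟩
        1#          ∎

      sθ₀ : Sym θ₀
      sθ₀ = Sym-+ (Sym-+ ⋆-1 sy) (Sym-* (Sym-* sy sy) sg′)

      sw : Sym w
      sw = Sym-* (Sym-^ sθ₀ u) (Sym-* sy (Sym-+ sg sg′))

      sq : Sym q
      sq = Sym-Σ r (λ i → Sym-^ sw (2 ℕ.^ i))

      d⋆ : d ⋆ ≈ 1# + q * (1# + σ⁻¹)
      d⋆ = trans (⋆-+ _ _) (+-cong ⋆-1 (trans (⋆-* _ _) (*-cong sq (trans (⋆-+ _ _) (+-cong ⋆-1 σ⋆)))))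

      frob-w : frob r w ≈ 0#
      frob-w = trans (frob-* r _ _)
          (trans (*-congˡ (trans (frob-* r _ _) (trans (*-congʳ nil) (zeroˡ _)))) (zeroʳ _))

      telescope : ∀ n → Σ[ i < n ] frob i w + Σ[ i < n ] frob (suc i) w ≈ w + frob n w
      telescope zero    = trans (+-identityˡ _) (sym (trans (+-congˡ (*-identityʳ w)) (x+x≈0 w)))
      telescope (suc n) = begin
        Σ[ i < suc n ] frob i w + Σ[ i < suc n ] frob (suc i) w
          ≈⟨ +-cong (Σ-last n (λ i → frob i w)) (Σ-last n (λ i → frob (suc i) w)) ⟩
        (A + frob n w) + (B + frob (suc n) w)
          ≈⟨ solve 4 (λ A B f g → (A :+ f) :+ (B :+ g) := (A :+ B) :+ (f :+ g)) refl A B (frob n w)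
               (frob (suc n) w) ⟩
        (A + B) + (frob n w + frob (suc n) w)  ≈⟨ +-congʳ (telescope n) ⟩
        (w + frob n w) + (frob n w + frob (suc n) w)
          ≈⟨ solve 3 (λ w f g → (w :+ f) :+ (f :+ g) := w :+ g) refl w (frob n w) (frob (suc n) w) ⟩
        w + frob (suc n) w ∎
        where
        A = Σ[ i < n ] frob i w
        B = Σ[ i < n ] frob (suc i) w

      q+q²≈w : q + q * q ≈ w
      q+q²≈w = begin
        q + q * q                          ≈⟨ +-congˡ (x^2≈x*x q) ⟨
        q + frob 1 q                       ≈⟨ +-congˡ (frob-Σ 1 r (λ i → frob i w)) ⟩
        q + Σ[ i < r ] frob 1 (frob i w)
          ≈⟨ +-congˡ (Σ-cong r
               (λ i → trans (^-assocʳ w (2 ℕ.^ i) 2) (^-congʳ w (ℕ.*-comm (2 ℕ.^ i) 2)))) ⟩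
        q + Σ[ i < r ] frob (suc i) w      ≈⟨ telescope r ⟩
        w + frob r w                       ≈⟨ +-congˡ frob-w ⟩
        w + 0#                             ≈⟨ +-identityʳ w ⟩
        w                                  ∎

-- Finite fields

module FiniteField {c ℓ₁ ℓ₂} (F : HeytingField c ℓ₁ ℓ₂) (q : ℕ) (order : Extension.HasOrder F q) where
  open HeytingField F using (#⇒invertible; invertible⇒#; #-irrefl; tight)
  open CommutativeRing (HeytingCommutativeRing.commutativeRing (HeytingField.heytingCommutativeRing F)) hiding (zero)
  open import Algebra.Properties.Ring ring using (-0#≈0#)
  open import Algebra.Properties.Semiring.Exp semiring using (_^_; ^-congˡ)
  open import Algebra.Properties.Semiring.Mult semiring using (×1-homo-*) renaming (_×_ to _·_)
  import Algebra.Properties.CommutativeMonoid.Sum as Sum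
  open import Relation.Binary.Reasoning.Setoid setoid
  open Inverse order public using (to; from)
  open Inverse order using (to-cong; strictlyInverseˡ; strictlyInverseʳ)

  private variable
    x y z : Carrier

  to-injective : to x ≡ to y → x ≈ y
  to-injective {x} {y} eq =
    trans (sym (strictlyInverseʳ x)) (trans (reflexive (≡.cong from eq)) (strictlyInverseʳ y))

  from-injective : ∀ {i j} → from i ≈ from j → i ≡ j
  from-injective {i} {j} eq =
    ≡.trans (≡.sym (strictlyInverseˡ i)) (≡.trans (to-cong eq) (strictlyInverseˡ j))

  infix 4 _≟_
  _≟_ : ∀ x y → Dec (x ≈ y)
  x ≟ y = map′ to-injective to-cong (to x Fin.≟ to y)

  search : ∀ {p} {P : Pred Carrier p} → (∀ {x y} → x ≈ y → P x → P y) → Decidable P → Dec (∃[ x ] P x)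
  search resp P? = map′ (λ (i , p) → from i , p)
                        (λ (x , p) → to x , resp (sym (strictlyInverseʳ x)) p)
                        (Fin.any? (P? ∘ from))

  -- If 1 = 0, all elements coincide; then 0 - 0 is invertible and 0 is apart from itself.
  1≉0 : ¬ 1# ≈ 0#
  1≉0 1≈0 = #-irrefl refl (invertible⇒# {0#} {0#} (0# , (trivial _ _ , trivial _ _)))
    where
    trivial : ∀ x y → x ≈ y
    trivial x y = trans (zero! x) (sym (zero! y))
      where
      zero! : ∀ x → x ≈ 0#
      zero! x = trans (sym (*-identityˡ x)) (trans (*-congʳ 1≈0) (zeroˡ x))

  -- Tightness of the apartness yields only that an inverse cannot fail to exist; searching the
  -- finite carrier removes the double negation.
  invert : ¬ x ≈ 0# → ∃[ y ] y * x ≈ 1#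
  invert {x} x≉0 = decidable-stable
    (search (λ eq p → trans (*-congʳ (sym eq)) p) (λ y → y * x ≟ 1#))
    λ ∄ → x≉0 (proj₁ (tight x 0#) λ x#0 → let y , y*x-0 , _ = #⇒invertible x#0 in
      ∄ (y , trans (*-congˡ (trans (sym (+-identityʳ x)) (+-congˡ (sym -0#≈0#)))) y*x-0))

  x*y≈0⇒y≈0 : ¬ x ≈ 0# → x * y ≈ 0# → y ≈ 0#
  x*y≈0⇒y≈0 {x} {y} x≉0 xy≈0 = let x⁻¹ , inv = invert x≉0 in begin
    y              ≈⟨ *-identityˡ y ⟨
    1# * y         ≈⟨ *-congʳ inv ⟨
    (x⁻¹ * x) * y  ≈⟨ *-assoc _ _ _ ⟩
    x⁻¹ * (x * y)  ≈⟨ *-congˡ xy≈0 ⟩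
    x⁻¹ * 0#       ≈⟨ zeroʳ _ ⟩
    0#             ∎

  x^n≈0⇒x≈0 : ∀ n → x ^ n ≈ 0# → x ≈ 0#
  x^n≈0⇒x≈0     zero    eq = contradiction eq 1≉0
  x^n≈0⇒x≈0 {x} (suc n) eq with x ≟ 0#
  ... | yes x≈0 = x≈0
  ... | no x≉0  = x^n≈0⇒x≈0 n (x*y≈0⇒y≈0 x≉0 eq)

  private
    module _ {m ℓ} (M : CommutativeMonoid m ℓ) where
      module M = CommutativeMonoid M
      open Sum M using (sum; sum-cong-≋; sum-permute)

      -- Stated for a general commutative monoid because it serves additively for the translation by
      -- 1 and multiplicatively for the scaling by a nonzero element.
      sum-bijection : ∀ {g : Carrier → M.Carrier} → (∀ {x y} → x ≈ y → g x M.≈ g y) →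
        (f f⁻¹ : Carrier → Carrier) → (∀ {x y} → x ≈ y → f x ≈ f y) → (∀ {x y} → x ≈ y → f⁻¹ x ≈ f⁻¹ y) →
        (∀ x → f (f⁻¹ x) ≈ x) → (∀ x → f⁻¹ (f x) ≈ x) →
        sum (λ i → g (from i)) M.≈ sum (λ i → g (f (from i)))
      sum-bijection {g} g-cong f f⁻¹ f-cong f⁻¹-cong ff⁻¹ f⁻¹f = M.trans
        (sum-permute (g ∘ from) (permutation (to ∘ f ∘ from) (to ∘ f⁻¹ ∘ from)
          (λ i → ≡.trans (to-cong (trans (f-cong (strictlyInverseʳ _)) (ff⁻¹ _))) (strictlyInverseˡ i))
          (λ i → ≡.trans (to-cong (trans (f⁻¹-cong (strictlyInverseʳ _)) (f⁻¹f _)))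
              (strictlyInverseˡ i))))
        (sum-cong-≋ {q} (λ i → g-cong (strictlyInverseʳ _)))

  -- Translation by 1 permutes the field, so the sum S of all elements satisfies S = S + q · 1.
  order·1≈0 : q · 1# ≈ 0#
  order·1≈0 = begin
    q · 1#                          ≈⟨ sum-replicate q ⟨
    T                               ≈⟨ +-identityˡ T ⟨
    0# + T                          ≈⟨ +-congʳ (-‿inverseˡ S) ⟨
    (- S + S) + T                   ≈⟨ +-assoc _ _ _ ⟩
    - S + (S + T)                   ≈⟨ +-congˡ (∑-distrib-+ {q} from (λ _ → 1#)) ⟨
    - S + sum (λ i → from i + 1#)
      ≈⟨ +-congˡ (sum-bijection +-commutativeMonoid id (_+ 1#) (_+ - 1#) +-congʳ +-congʳ
                                         (λ x → trans (+-assoc _ _ _)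
                                             (trans (+-congˡ (-‿inverseˡ 1#)) (+-identityʳ x)))
                                         (λ x → trans (+-assoc _ _ _)
                                             (trans (+-congˡ (-‿inverseʳ 1#)) (+-identityʳ x)))) ⟨
    - S + S                         ≈⟨ -‿inverseˡ S ⟩
    0#                              ∎
    where
    open Sum +-commutativeMonoid using (sum; ∑-distrib-+; sum-replicate)
    S = sum from
    T = sum {q} (λ _ → 1#)

  -- For x nonzero, multiplication by x permutes the nonzero elements, so it leaves their product
  -- unchanged.
  fermat : ∀ x → x ^ q ≈ x
  fermat x with x ≟ 0#
  ... | yes x≈0 = trans (^-congˡ q x≈0) (trans (0^n (to 0#)) (sym x≈0))
    where
    -- The inhabitant of `Fin n` is evidence that the exponent is positive.
    0^n : ∀ {n} → Fin n → 0# ^ n ≈ 0#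
    0^n {suc n} _ = zeroˡ _
  ... | no x≉0 = begin
    x ^ q
      ≈⟨ all-but-one k (to 0#) (k-zero (strictlyInverseʳ 0#))
           (λ i i≢ → k-nonzero λ eq → i≢ (≡.trans (≡.sym (strictlyInverseˡ i)) (to-cong eq))) ⟨
    x * Π k         ≈⟨ *-congˡ Πk≈1 ⟩
    x * 1#          ≈⟨ *-identityʳ x ⟩
    x               ∎
    where
    open Sum *-commutativeMonoid using (∑-distrib-+; sum-remove; sum-replicate; sum-cong-≋) renaming (sum to Π)

    all-but-one : ∀ {n} (t : Vector Carrier n) i → t i ≈ 1# → (∀ j → j ≢ i → t j ≈ x) → x * Π t ≈ x ^ n
    all-but-one {suc n} t i ti tj = *-congˡ (begin
      Π t           ≈⟨ sum-remove {i = i} t ⟩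
      t i * Π (t ∘ Fin.punchIn i)
        ≈⟨ *-cong ti (sum-cong-≋ {n} {t ∘ Fin.punchIn i} (λ j → tj _ (Fin.punchInᵢ≢i i j))) ⟩
      1# * Π {n} (λ _ → x)         ≈⟨ *-identityˡ _ ⟩
      Π {n} (λ _ → x)              ≈⟨ sum-replicate n ⟩
      x ^ n                        ∎)

    -- To keep the product over the whole carrier, `g` replaces 0 by 1, and `kk y` is the factor
    -- that `g` gains when y is multiplied by x: it is x except at 0. The factors then multiply to x
    -- ^ (q - 1).
    g kk : Carrier → Carrier
    g y with y ≟ 0#
    ... | yes _ = 1#
    ... | no  _ = y
    kk y with y ≟ 0#
    ... | yes _ = 1#
    ... | no  _ = x

    k : Fin q → Carrier
    k i = kk (from i)

    k-zero : y ≈ 0# → kk y ≈ 1#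
    k-zero {y} y≈0 with y ≟ 0#
    ... | yes _  = refl
    ... | no y≉0 = contradiction y≈0 y≉0

    k-nonzero : ¬ y ≈ 0# → kk y ≈ x
    k-nonzero {y} y≉0 with y ≟ 0#
    ... | yes y≈0 = contradiction y≈0 y≉0
    ... | no _    = refl

    g-cong : y ≈ z → g y ≈ g z
    g-cong {y} {z} eq with y ≟ 0# | z ≟ 0#
    ... | yes _   | yes _   = refl
    ... | yes y≈0 | no z≉0  = contradiction (trans (sym eq) y≈0) z≉0
    ... | no y≉0  | yes z≈0 = contradiction (trans eq z≈0) y≉0
    ... | no _    | no _    = eq

    g-nonzero : ∀ y → ¬ g y ≈ 0#
    g-nonzero y with y ≟ 0#
    ... | yes _  = 1≉0
    ... | no y≉0 = y≉0

    g-scale : ∀ y → g (x * y) ≈ g y * kk y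
    g-scale y with y ≟ 0# | x * y ≟ 0#
    ... | yes _   | yes _    = sym (*-identityʳ _)
    ... | yes y≈0 | no xy≉0  = contradiction (trans (*-congˡ y≈0) (zeroʳ x)) xy≉0
    ... | no y≉0  | yes xy≈0 = contradiction (x*y≈0⇒y≈0 x≉0 xy≈0) y≉0
    ... | no _    | no _     = *-comm x y

    Π-nonzero : ∀ {n} (t : Vector Carrier n) → (∀ i → ¬ t i ≈ 0#) → ¬ Π t ≈ 0#
    Π-nonzero {zero}  t nz = 1≉0
    Π-nonzero {suc n} t nz eq = Π-nonzero (t ∘ suc) (nz ∘ suc) (x*y≈0⇒y≈0 (nz zero) eq)

    P : Carrier
    P = Π (g ∘ from)

    P≈P*Πk : P ≈ P * Π k
    P≈P*Πk = let x⁻¹ , inv = invert x≉0 in begin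
      P
        ≈⟨ sum-bijection *-commutativeMonoid g-cong (x *_) (x⁻¹ *_) *-congˡ *-congˡ
                                          (λ y → trans (sym (*-assoc _ _ _))
                                              (trans (*-congʳ (trans (*-comm _ _) inv)) (*-identityˡ y)))
                                          (λ y → trans (sym (*-assoc _ _ _))
                                              (trans (*-congʳ inv) (*-identityˡ y))) ⟩
      Π (λ i → g (x * from i))       ≈⟨ sum-cong-≋ {q} (λ i → g-scale (from i)) ⟩
      Π (λ i → g (from i) * k i)     ≈⟨ ∑-distrib-+ {q} (g ∘ from) k ⟩
      P * Π k                        ∎

    Πk≈1 : Π k ≈ 1#
    Πk≈1 = let P⁻¹ , inv = invert (Π-nonzero (g ∘ from) (g-nonzero ∘ from)) in begin
      Π k               ≈⟨ *-identityˡ _ ⟨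
      1# * Π k          ≈⟨ *-congʳ inv ⟨
      (P⁻¹ * P) * Π k   ≈⟨ *-assoc _ _ _ ⟩
      P⁻¹ * (P * Π k)   ≈⟨ *-congˡ P≈P*Πk ⟨
      P⁻¹ * P           ≈⟨ inv ⟩
      1#                ∎

  -- 2 ^ N · 1 = (1 + 1) ^ N vanishes, and a field has no nonzero nilpotent elements.
  characteristic-two : ∀ N → q ≡ 2 ℕ.^ N → 1# + 1# ≈ 0#
  characteristic-two N q≡ =
      x^n≈0⇒x≈0 N (trans (sym (2^N·1 N)) (trans (reflexive (≡.cong (_· 1#) (≡.sym q≡))) order·1≈0))
    where
    2^N·1 : ∀ n → (2 ℕ.^ n) · 1# ≈ (1# + 1#) ^ n
    2^N·1 zero    = +-identityʳ 1#
    2^N·1 (suc n) = trans (×1-homo-* 2 (2 ℕ.^ n)) (*-cong (+-congˡ (+-identityʳ 1#)) (2^N·1 n))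

-- Linearized polynomials

⟨⟩-toℕ : ∀ {n} .{{_ : NonZero n}} {A : Set} (v : Vector A n) i → v ⟨ toℕ i ⟩ ≡ v i
⟨⟩-toℕ {n} v i = ≡.cong v (Fin.toℕ-injective (≡.trans (Fin.toℕ-fromℕ< _) (ℕ.m<n⇒m%n≡m (Fin.toℕ<n i))))

⟨⟩-periodic : ∀ {n} .{{_ : NonZero n}} {A : Set} (v : Vector A n) k → v ⟨ n ℕ.+ k ⟩ ≡ v ⟨ k ⟩
⟨⟩-periodic {n} v k = ≡.cong v (Fin.toℕ-injective (≡.trans (Fin.toℕ-fromℕ< _)
  (≡.trans (≡.trans (≡.cong (ℕ._% n) (ℕ.+-comm n k)) (ℕ.[m+n]%n≡m%n k n)) (≡.sym (Fin.toℕ-fromℕ< _)))))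

module Frobenius {c ℓ₁ ℓ₂} (F : HeytingField c ℓ₁ ℓ₂) (N : ℕ)
    (order : Extension.HasOrder F (2 ℕ.^ N)) where
  F-ring : CommutativeRing c ℓ₁
  F-ring = HeytingCommutativeRing.commutativeRing (HeytingField.heytingCommutativeRing F)

  open CommutativeRing F-ring hiding (zero)
  open FiniteField F (2 ℕ.^ N) order public
  open CharTwo F-ring (characteristic-two N ≡.refl) public
  open import Relation.Binary.Reasoning.Setoid setoid

  -- IsPoly d l f: f is given by a polynomial in which x ^ d has coefficient l
  -- and no higher power of x occurs.
  data IsPoly : ℕ → Carrier → (Carrier → Carrier) → Set (c ⊔ ℓ₁) where
    constant : ∀ {l f} → (∀ x → f x ≈ l) → IsPoly 0 l f
    horner   : ∀ {d l f} a {g} → IsPoly d l g → (∀ x → f x ≈ a + x * g x) → IsPoly (suc d) l f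

  IsPoly-≈ : ∀ {d l l′ f f′} → IsPoly d l f → l ≈ l′ → (∀ x → f x ≈ f′ x) → IsPoly d l′ f′
  IsPoly-≈ (constant f≈) l≈ f≈f′ = constant (λ x → trans (sym (f≈f′ x)) (trans (f≈ x) l≈))
  IsPoly-≈ (horner a p f≈) l≈ f≈f′ =
      horner a (IsPoly-≈ p l≈ (λ _ → refl)) (λ x → trans (sym (f≈f′ x)) (f≈ x))

  IsPoly-+ : ∀ {d l l′ f f′} → IsPoly d l f → IsPoly d l′ f′ → IsPoly d (l + l′) (λ x → f x + f′ x)
  IsPoly-+ (constant p) (constant q) = constant (λ x → +-cong (p x) (q x))
  IsPoly-+ (horner a {g} p f≈) (horner b {h} q f′≈) =
      horner (a + b) (IsPoly-+ p q) (λ x → trans (+-cong (f≈ x) (f′≈ x))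
    (solve 5 (λ a b x g h → (a :+ x :* g) :+ (b :+ x :* h) := (a :+ b) :+ x :* (g :+ h)) refl a b x
        (g x) (h x)))

  IsPoly-* : ∀ {d l f} y → IsPoly d l f → IsPoly d (y * l) (λ x → y * f x)
  IsPoly-* y (constant p) = constant (λ x → *-congˡ (p x))
  IsPoly-* y (horner a {g} p f≈) = horner (y * a) (IsPoly-* y p) (λ x → trans (*-congˡ (f≈ x))
    (solve 4 (λ y a x g → y :* (a :+ x :* g) := y :* a :+ x :* (y :* g)) refl y a x (g x)))

  IsPoly-raise : ∀ {d l f} → IsPoly d l f → IsPoly (suc d) 0# f
  IsPoly-raise {l = l} (constant p) =
      horner l (constant (λ _ → refl))
      (λ x → trans (p x) (sym (trans (+-congˡ (zeroʳ x)) (+-identityʳ l))))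
  IsPoly-raise (horner a p f≈) = horner a (IsPoly-raise p) f≈

  IsPoly-< : ∀ {d d′ l f} → d ℕ.< d′ → IsPoly d l f → IsPoly d′ 0# f
  IsPoly-< {d} d<d′ p = go (ℕ.≤⇒≤′ d<d′)
    where
    go : ∀ {d′} → suc d ℕ.≤′ d′ → IsPoly d′ 0# _
    go (ℕ.≤′-reflexive ≡.refl) = IsPoly-raise p
    go (ℕ.≤′-step lt)          = IsPoly-raise (go lt)

  IsPoly-^ : ∀ n → IsPoly n 1# (_^ n)
  IsPoly-^ zero    = constant (λ _ → refl)
  IsPoly-^ (suc n) = horner 0# (IsPoly-^ n) (λ x → sym (+-identityˡ _))

  -- Synthetic division by x - r. The quotient keeps the leading coefficient, which is what the
  -- induction in `root-bound` tracks.
  factor : ∀ {d l f} → IsPoly (suc d) l f → ∀ r →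
    ∃[ h ] IsPoly d l h × (∀ x → f x + f r ≈ (x + r) * h x)
  factor {l = l} {f} (horner a {g} (constant g≈) f≈) r = (λ _ → l) , constant (λ _ → refl) , λ x → begin
    f x + f r
      ≈⟨ +-cong (trans (f≈ x) (+-congˡ (*-congˡ (g≈ x)))) (trans (f≈ r) (+-congˡ (*-congˡ (g≈ r)))) ⟩
    (a + x * l) + (a + r * l)
      ≈⟨ solve 4 (λ a x r l → (a :+ x :* l) :+ (a :+ r :* l) := (x :+ r) :* l) refl a x r l ⟩
    (x + r) * l                        ∎
  factor {f = f} (horner a {g} p@(horner _ _ _) f≈) r = let h , ph , gx+gr = factor p r in
    (λ x → g r + x * h x) , horner (g r) ph (λ _ → refl) , λ x → begin
    f x + f r                          ≈⟨ +-cong (f≈ x) (f≈ r) ⟩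
    (a + x * g x) + (a + r * g r)
      ≈⟨ solve 5 (λ a x r g k → (a :+ x :* g) :+ (a :+ r :* k) := x :* (g :+ k) :+ (x :+ r) :* k)
           refl a x r (g x) (g r) ⟩
    x * (g x + g r) + (x + r) * g r    ≈⟨ +-congʳ (*-congˡ (gx+gr x)) ⟩
    x * ((x + r) * h x) + (x + r) * g r
      ≈⟨ solve 4 (λ x r h k → x :* ((x :+ r) :* h) :+ (x :+ r) :* k := (x :+ r) :* (k :+ x :* h))
           refl x r (h x) (g r) ⟩
    (x + r) * (g r + x * h x)          ∎

  -- Splitting off one root lowers d by one and leaves the remaining points as roots of the
  -- quotient. It is applied to linearized polynomials, for the independence of the powers of σ, and
  -- to y ^ 2 ^ n + y, for spanning.
  root-bound : ∀ {d l f} → IsPoly d l f → (v : Vector Carrier (suc d)) →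
    (∀ {i j} → v i ≈ v j → i ≡ j) → (∀ i → f (v i) ≈ 0#) → l ≈ 0#
  root-bound (constant f≈) v inj root = trans (sym (f≈ _)) (root zero)
  root-bound {f = f} p@(horner _ _ _) v inj root = let h , ph , eq = factor p (v zero) in
    root-bound ph (v ∘ suc) (Fin.suc-injective ∘ inj) λ i →
      x*y≈0⇒y≈0 (λ eq₀ → contradiction (inj (x+y≈0⇒x≈y eq₀)) λ ())
        (trans (sym (eq (v (suc i)))) (trans (+-cong (root (suc i)) (root zero)) (+-identityˡ 0#)))

  frob-frob : ∀ j k x → frob j (frob k x) ≈ frob (j ℕ.+ k) x
  frob-frob j k x = trans (^-assocʳ x (2 ℕ.^ k) (2 ℕ.^ j))
    (^-congʳ x (≡.trans (ℕ.*-comm (2 ℕ.^ k) (2 ℕ.^ j)) (≡.sym (ℕ.^-distribˡ-+-* 2 j k))))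

  frob-comm : ∀ j k x → frob j (frob k x) ≈ frob k (frob j x)
  frob-comm j k x =
      trans (frob-frob j k x)
      (trans (^-congʳ x (≡.cong (2 ℕ.^_) (ℕ.+-comm j k))) (sym (frob-frob k j x)))

  linearized : ℕ → (ℕ → 𝔽₂) → Carrier → Carrier
  linearized n r x = Σ[ k < n ] (bit (r k) * frob k x)

  IsPoly-frob : ∀ k → IsPoly (2 ℕ.^ k) 1# (frob k)
  IsPoly-frob k = IsPoly-^ (2 ℕ.^ k)

  -- The two bounds feed each other: the first d terms stay below degree 2 ^ d, so term d alone
  -- supplies the coefficient there, and the result is again below degree 2 ^ (d + 1).
  linearized-top : ∀ d r → IsPoly (2 ℕ.^ d) (bit (r d)) (linearized (suc d) r)
  linearized-low : ∀ d r → IsPoly (2 ℕ.^ d) 0# (linearized d r)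

  linearized-top d r = IsPoly-≈
    (IsPoly-+ (linearized-low d r) (IsPoly-* (bit (r d)) (IsPoly-frob d)))
    (trans (+-identityˡ _) (*-identityʳ _))
    (λ x → sym (Σ-last d (λ k → bit (r k) * frob k x)))

  linearized-low zero    r =
      horner 0# (constant (λ _ → refl)) (λ x → sym (trans (+-identityˡ _) (zeroʳ x)))
  linearized-low (suc d) r = IsPoly-< (ℕ.^-monoʳ-< 2 (s≤s (s≤s z≤n)) (ℕ.n<1+n d)) (linearized-top d r)

  bit≈0 : ∀ x → bit x ≈ 0# → x ≡ 0ℙ
  bit≈0 0ℙ _   = ≡.refl
  bit≈0 1ℙ 1≈0 = contradiction 1≈0 1≉0

  bit-injective : ∀ {x y} → bit x ≈ bit y → x ≡ y
  bit-injective {0ℙ} {0ℙ} _ = ≡.refl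
  bit-injective {0ℙ} {1ℙ} e = contradiction (sym e) 1≉0
  bit-injective {1ℙ} {0ℙ} e = contradiction e 1≉0
  bit-injective {1ℙ} {1ℙ} _ = ≡.refl

  -- Independence of automorphisms by counting: with top index d < N the degree is at most 2 ^ d,
  -- while all 2 ^ N field elements are roots. The coefficients are removed from the top downwards.
  linearized-independent : ∀ n → n ℕ.≤ N → ∀ r → (∀ x → linearized n r x ≈ 0#) → ∀ k → k ℕ.< n → r k ≡ 0ℙ
  linearized-independent (suc d) d<N r vanish k k<1+d = case (ℕ.m≤n⇒m<n∨m≡n (ℕ.s≤s⁻¹ k<1+d))
    where
    bound : suc (2 ℕ.^ d) ℕ.≤ 2 ℕ.^ N
    bound = ℕ.^-monoʳ-< 2 (s≤s (s≤s z≤n)) d<N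

    top : bit (r d) ≈ 0#
    top = root-bound (linearized-top d r) (λ i → from (Fin.inject≤ i bound))
      (λ eq → Fin.inject≤-injective bound bound _ _ (from-injective eq)) (λ i → vanish _)

    vanish′ : ∀ x → linearized d r x ≈ 0#
    vanish′ x = begin
      linearized d r x                         ≈⟨ +-identityʳ _ ⟨
      linearized d r x + 0#                    ≈⟨ +-congˡ (trans (*-congʳ top) (zeroˡ _)) ⟨
      linearized d r x + bit (r d) * frob d x  ≈⟨ Σ-last d (λ k → bit (r k) * frob k x) ⟨
      linearized (suc d) r x                   ≈⟨ vanish x ⟩
      0#                                       ∎

    case : k ℕ.< d ⊎ k ≡ d → r k ≡ 0ℙ
    case (inj₁ k<d)    = linearized-independent d (ℕ.<⇒≤ d<N) r vanish′ k k<d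
    case (inj₂ ≡.refl) = bit≈0 (r d) top

-- Traces

module Trace {c ℓ₁ ℓ₂} (F : HeytingField c ℓ₁ ℓ₂) (N : ℕ) (order : Extension.HasOrder F (2 ℕ.^ N)) where
  open Frobenius F N order public
  open CommutativeRing F-ring hiding (zero)
  open import Relation.Binary.Reasoning.Setoid setoid

  -- For n dividing N this cuts out the subfield with 2 ^ n elements. As a predicate on the one
  -- field it lets elements of different subfields be multiplied without embeddings.
  Fixed : ℕ → Carrier → Set ℓ₁
  Fixed n x = frob n x ≈ x

  Fixed-N : ∀ x → Fixed N x
  Fixed-N = fermat

  Fixed-+ : ∀ n {x y} → Fixed n x → Fixed n y → Fixed n (x + y)
  Fixed-+ n fx fy = trans (frob-+ n _ _) (+-cong fx fy)

  Fixed-* : ∀ n {x y} → Fixed n x → Fixed n y → Fixed n (x * y)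
  Fixed-* n fx fy = trans (frob-* n _ _) (*-cong fx fy)

  Fixed-frob : ∀ n {x} k → Fixed n x → Fixed n (frob k x)
  Fixed-frob n k fx = trans (frob-comm n k _) (frob-cong k fx)

  frob-periodic : ∀ n x → Fixed n x → Periodic n (λ k → frob k x)
  frob-periodic n x fx k = trans (sym (frob-frob n k x)) (Fixed-frob n k fx)

  tr : ℕ → Carrier → Carrier
  tr n x = Σ[ k < n ] frob k x

  tr-cong : ∀ n {x y} → x ≈ y → tr n x ≈ tr n y
  tr-cong n {x} {y} eq = Σ-cong n {λ k → frob k x} {λ k → frob k y} (λ k → frob-cong k eq)

  tr-+ : ∀ n x y → tr n (x + y) ≈ tr n x + tr n y
  tr-+ n x y = trans (Σ-cong n (λ k → frob-+ k x y)) (Σ-distrib-+ n (λ k → frob k x) (λ k → frob k y))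

  tr-0 : ∀ n → tr n 0# ≈ 0#
  tr-0 n = trans (Σ-cong n frob-0) (Σ-zero n)

  tr-frob : ∀ n {x} → Fixed n x → ∀ j → tr n (frob j x) ≈ tr n x
  tr-frob n {x} fx j = trans
    (Σ-cong n (λ k → trans (frob-frob k j x) (^-congʳ x (≡.cong (2 ℕ.^_) (ℕ.+-comm k j)))))
    (Σ-shift n (λ k → frob k x) (frob-periodic n x fx) j)

  frob-tr : ∀ n {x} → Fixed n x → ∀ j → frob j (tr n x) ≈ tr n x
  frob-tr n {x} fx j = trans (frob-Σ j n (λ k → frob k x)) (trans (Σ-cong n (λ k → frob-frob j k x))
    (Σ-shift n (λ k → frob k x) (frob-periodic n x fx) j))

  frob1-fixed : ∀ {x} → frob 1 x ≈ x → x ≈ 0# ⊎ x ≈ 1#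
  frob1-fixed {x} eq with x ≟ 0#
  ... | yes x≈0 = inj₁ x≈0
  ... | no x≉0  = inj₂ (sym (x+y≈0⇒x≈y (x*y≈0⇒y≈0 x≉0 (begin
    x * (1# + x)   ≈⟨ trans (distribˡ x 1# x) (+-cong (*-identityʳ x) (trans (sym (x^2≈x*x x)) eq)) ⟩
    x + x          ≈⟨ x+x≈0 x ⟩
    0#             ∎))))

  tr-01 : ∀ n {x} → Fixed n x → tr n x ≈ 0# ⊎ tr n x ≈ 1#
  tr-01 n fx = frob1-fixed (frob-tr n fx 1)

  unbit : Carrier → 𝔽₂
  unbit x with x ≟ 0#
  ... | yes _ = 0ℙ
  ... | no _  = 1ℙ

  bit-unbit : ∀ {x} → x ≈ 0# ⊎ x ≈ 1# → bit (unbit x) ≈ x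
  bit-unbit {x} x01 with x ≟ 0# | x01
  ... | yes x≈0 | _        = sym x≈0
  ... | no x≉0  | inj₁ x≈0 = contradiction x≈0 x≉0
  ... | no _    | inj₂ x≈1 = sym x≈1

  unbit-cong : ∀ {x y} → x ≈ y → unbit x ≡ unbit y
  unbit-cong {x} {y} eq with x ≟ 0# | y ≟ 0#
  ... | yes _   | yes _   = ≡.refl
  ... | yes x≈0 | no y≉0  = contradiction (trans (sym eq) x≈0) y≉0
  ... | no x≉0  | yes y≈0 = contradiction (trans eq y≈0) x≉0
  ... | no _    | no _    = ≡.refl

  linearized-cong : ∀ n r {x y} → x ≈ y → linearized n r x ≈ linearized n r y
  linearized-cong n r eq = Σ-cong n (λ k → *-congˡ {bit (r k)} (frob-cong k eq))

  linearized-+ : ∀ n r r′ x → linearized n r x + linearized n r′ x ≈ linearized n (λ k → r k ℙ.+ r′ k) x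
  linearized-+ n r r′ x =
      trans (sym (Σ-distrib-+ n (λ k → bit (r k) * frob k x) (λ k → bit (r′ k) * frob k x)))
      (Σ-cong n (λ k →
    trans (sym (distribʳ (frob k x) (bit (r k)) (bit (r′ k)))) (*-congʳ (sym (bit-+ (r k) (r′ k))))))

  module Subfield (n M : ℕ) (M*n≡N : M ℕ.* n ≡ N) where

    -- The trace from the field to the fixed field of σ ^ n; it is the source of elements of that
    -- subfield.
    relative-trace : Carrier → Carrier
    relative-trace x = Σ[ j < M ] frob (j ℕ.* n) x

    relative-trace-fixed : ∀ x → Fixed n (relative-trace x)
    relative-trace-fixed x = trans (frob-Σ n M (λ j → frob (j ℕ.* n) x)) (trans
      (Σ-cong M (λ j → frob-frob n (j ℕ.* n) x))
      (Σ-shift M (λ j → frob (j ℕ.* n) x) periodic 1))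
      where
      periodic : Periodic M (λ j → frob (j ℕ.* n) x)
      periodic j =
          trans (^-congʳ x
          (≡.cong (2 ℕ.^_) (≡.trans (ℕ.*-distribʳ-+ n M j) (≡.cong (ℕ._+ j ℕ.* n) M*n≡N))))
                         (frob-periodic N x (Fixed-N x) (j ℕ.* n))

    relative-trace-cong : ∀ {x y} → x ≈ y → relative-trace x ≈ relative-trace y
    relative-trace-cong {x} {y} eq = Σ-cong M {λ j → frob (j ℕ.* n) x} {λ j → frob (j ℕ.* n) y}
        (λ j → frob-cong (j ℕ.* n) eq)

    relative-trace-linear : ∀ {x y} → Fixed n y → y * relative-trace x ≈ relative-trace (y * x)
    relative-trace-linear {x} {y} fy = trans (*-distribˡ-Σ M y (λ j → frob (j ℕ.* n) x))
      (Σ-cong M (λ j → sym (trans (frob-* (j ℕ.* n) y x) (*-congʳ (fixed-mult j)))))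
      where
      fixed-mult : ∀ j → frob (j ℕ.* n) y ≈ y
      fixed-mult j = begin
        frob (j ℕ.* n) y             ≡⟨ ≡.cong (λ k → frob k y) (ℕ.+-identityʳ (j ℕ.* n)) ⟨
        frob (j ℕ.* n ℕ.+ 0) y       ≈⟨ Periodic-* n (λ k → frob k y) (frob-periodic n y fy) j 0 ⟩
        frob 0 y                     ≈⟨ *-identityʳ y ⟩
        y                            ∎

    -- The indices k + j n with k < n and j < M run once through all those below N. Hence statements
    -- about operators on the large field descend to the subfield.
    linearized-relative-trace : ∀ r → (∀ k → r (n ℕ.+ k) ≡ r k) → ∀ x →
      linearized n r (relative-trace x) ≈ linearized N r x
    linearized-relative-trace r per x = begin
      linearized n r (relative-trace x)
        ≈⟨ Σ-cong n (λ k →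
             *-congˡ {bit (r k)}
             (trans (frob-Σ k M (λ j → frob (j ℕ.* n) x)) (Σ-cong M (λ j → frob-frob k (j ℕ.* n) x)))) ⟩
      Σ[ k < n ] (bit (r k) * Σ[ j < M ] frob (k ℕ.+ j ℕ.* n) x)
        ≈⟨ Σ-cong n (λ k → *-distribˡ-Σ M (bit (r k)) (λ j → frob (k ℕ.+ j ℕ.* n) x)) ⟩
      Σ[ k < n ] Σ[ j < M ] (bit (r k) * frob (k ℕ.+ j ℕ.* n) x)
        ≈⟨ Σ-swap n M (λ k j → bit (r k) * frob (k ℕ.+ j ℕ.* n) x) ⟩
      Σ[ j < M ] Σ[ k < n ] (bit (r k) * frob (k ℕ.+ j ℕ.* n) x)
        ≈⟨ Σ-cong M (λ j →
             Σ-cong n (λ k →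
             *-cong (sym (per-* j k)) (^-congʳ x (≡.cong (2 ℕ.^_) (ℕ.+-comm k (j ℕ.* n)))))) ⟩
      Σ[ j < M ] Σ[ k < n ] (bit (r (j ℕ.* n ℕ.+ k)) * frob (j ℕ.* n ℕ.+ k) x)
        ≈⟨ Σ-blocks M n (λ k → bit (r k) * frob k x) ⟨
      linearized (M ℕ.* n) r x
        ≡⟨ ≡.cong (λ N → linearized N r x) M*n≡N ⟩
      linearized N r x ∎
      where
      per-* : ∀ j k → bit (r (j ℕ.* n ℕ.+ k)) ≈ bit (r k)
      per-* = Periodic-* n (bit ∘ r) (λ k → reflexive (≡.cong bit (per k)))

    module _ .{{_ : NonZero M}} where

      n≤N : n ℕ.≤ N
      n≤N = ≡.subst (n ℕ.≤_) M*n≡N (ℕ.m≤n*m n M)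

      -- Faithfulness of 𝔽₂[X] / (X ^ n - 1) on the fixed field of σ ^ n: an operator that kills all
      -- relative traces is an operator of full length that kills the whole field.
      linearized-faithful : ∀ r → (∀ k → r (n ℕ.+ k) ≡ r k) →
        (∀ x → Fixed n x → linearized n r x ≈ 0#) → ∀ k → k ℕ.< n → r k ≡ 0ℙ
      linearized-faithful r per vanish k k<n = linearized-independent N ℕ.≤-refl r
        (λ x → trans (sym (linearized-relative-trace r per x)) (vanish _ (relative-trace-fixed x)))
        k (ℕ.≤-trans k<n n≤N)

      linearized-nonzero : ∀ r → (∀ k → r (n ℕ.+ k) ≡ r k) → ∀ k → k ℕ.< n → r k ≢ 0ℙ →
        ∃[ x ] Fixed n x × ¬ linearized n r x ≈ 0#
      linearized-nonzero r per k k<n rk≢0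
        with search {P = λ x → ¬ linearized n r (relative-trace x) ≈ 0#}
          (λ eq p q → p (trans (linearized-cong n r (relative-trace-cong eq)) q))
          (λ x → ¬? (linearized n r (relative-trace x) ≟ 0#))
      ... | yes (x , p) = relative-trace x , relative-trace-fixed x , p
      ... | no ∄ = contradiction (linearized-independent N ℕ.≤-refl r
              (λ x → trans (sym (linearized-relative-trace r per x))
                  (decidable-stable (_ ≟ 0#) λ p → ∄ (x , p)))
              k (ℕ.≤-trans k<n n≤N)) rk≢0

    tr-relative-trace : ∀ x → tr n (relative-trace x) ≈ tr N x
    tr-relative-trace x = begin
      tr n (relative-trace x)
        ≈⟨ Σ-cong n (λ k → *-identityˡ (frob k (relative-trace x))) ⟨
      linearized n (λ _ → 1ℙ) (relative-trace x)
        ≈⟨ linearized-relative-trace (λ _ → 1ℙ) (λ _ → ≡.refl) x ⟩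
      linearized N (λ _ → 1ℙ) x                      ≈⟨ Σ-cong N (λ k → *-identityˡ (frob k x)) ⟩
      tr N x                                         ∎

  -- The trace is the linearized polynomial with all coefficients 1, so it is not identically zero,
  -- and its only nonzero value is 1.
  trace-one : .{{_ : NonZero N}} → ∃[ x ] tr N x ≈ 1#
  trace-one with Subfield.linearized-nonzero N 1 (ℕ.*-identityˡ N) (λ _ → 1ℙ) (λ _ → ≡.refl) 0
      (ℕ.>-nonZero⁻¹ N) (λ ())
  ... | x , fx , nz with tr-01 N fx
  ... | inj₂ one  = x , one
  ... | inj₁ none = contradiction (trans (Σ-cong N (λ k → *-identityˡ (frob k x))) none) nz

  module _ .{{_ : NonZero N}} n M (M*n≡N : M ℕ.* n ≡ N) where
    open Subfield n M M*n≡N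

    trace-one-fixed : ∃[ x ] Fixed n x × tr n x ≈ 1#
    trace-one-fixed = let x , one = trace-one in
      relative-trace x , relative-trace-fixed x , trans (tr-relative-trace x) one

    -- If x is nonzero and z has trace 1, then y = `relative-trace (x⁻¹ * z)` contradicts
    -- orthogonality: by linearity over the subfield, x y is the relative trace of z, whose trace is
    -- 1.
    tr-nondegenerate : ∀ {x} → Fixed n x → (∀ y → Fixed n y → tr n (x * y) ≈ 0#) → x ≈ 0#
    tr-nondegenerate {x} fx orth = decidable-stable (x ≟ 0#) λ x≉0 →
      let x⁻¹ , inv = invert x≉0
          z , one   = trace-one
      in 1≉0 (begin
        1#                                    ≈⟨ one ⟨
        tr N z                                ≈⟨ tr-relative-trace z ⟨
        tr n (relative-trace z)
          ≈⟨ tr-cong n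
               (relative-trace-cong
               (trans (sym (*-identityˡ z))
               (trans (*-congʳ (trans (sym inv) (*-comm _ _))) (*-assoc _ _ _)))) ⟩
        tr n (relative-trace (x * (x⁻¹ * z))) ≈⟨ tr-cong n (relative-trace-linear fx) ⟨
        tr n (x * relative-trace (x⁻¹ * z))   ≈⟨ orth _ (relative-trace-fixed _) ⟩
        0#                                    ∎)

  vec : ∀ {n} .{{_ : NonZero n}} → Vector 𝔽₂ n → ℕ → 𝔽₂
  vec v k = v ⟨ k ⟩

  -- The 2 ^ n combinations of conjugates of x are distinct roots of y ^ 2 ^ n + y.
  module Span {n} .{{_ : NonZero n}} {x} (fx : Fixed n x)
    (independent : ∀ v → linearized n (vec v) x ≈ 0# → ∀ i → v i ≡ 0ℙ) where

    private
      digit : Fin 2 → 𝔽₂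
      digit zero       = 0ℙ
      digit (suc zero) = 1ℙ

      digit-injective : ∀ {i j} → digit i ≡ digit j → i ≡ j
      digit-injective {zero}     {zero}     _ = ≡.refl
      digit-injective {suc zero} {suc zero} _ = ≡.refl
      digit-injective {zero}     {suc zero} ()
      digit-injective {suc zero} {zero}     ()

      digits : Fin (2 ℕ.^ n) → Vector 𝔽₂ n
      digits i = digit ∘ Fin.finToFun i

      funToFin-cong : ∀ {k} {f g : Fin k → Fin 2} → (∀ i → f i ≡ g i) → Fin.funToFin f ≡ Fin.funToFin g
      funToFin-cong {zero}  eq = ≡.refl
      funToFin-cong {suc k} eq = ≡.cong₂ Fin.combine (eq zero) (funToFin-cong (eq ∘ suc))

      digits-injective : ∀ {i j} → (∀ k → digits i k ≡ digits j k) → i ≡ j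
      digits-injective {i} {j} eq = ≡.trans (≡.sym (Fin.funToFin-finToFin {n} {2} i))
        (≡.trans (funToFin-cong (digit-injective ∘ eq)) (Fin.funToFin-finToFin {n} {2} j))

      point : Fin (2 ℕ.^ n) → Carrier
      point i = linearized n (vec (digits i)) x

      point-injective : ∀ {i j} → point i ≈ point j → i ≡ j
      point-injective {i} {j} eq = digits-injective λ k → ℙ.+-cancelʳ-≡ (digits j k) _ _ (≡.trans
        (independent (λ k → digits i k ℙ.+ digits j k)
          (trans (sym (linearized-+ n (vec (digits i)) (vec (digits j)) x)) (x≈y⇒x+y≈0 eq)) k)
        (≡.sym (ℙ.p+p≡0ℙ (digits j k))))

      point-fixed : ∀ i → Fixed n (point i)
      point-fixed i = trans (frob-Σ n n (λ k → bit (vec (digits i) k) * frob k x))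
        (Σ-cong n (λ k → Fixed-* n {bit (vec (digits i) k)} (frob-bit n (vec (digits i) k))
            (Fixed-frob n k fx)))

    spanning : ∀ y → Fixed n y → ∃[ v ] linearized n (vec v) x ≈ y
    spanning y fy with Fin.any? (λ i → point i ≟ y)
    ... | yes (i , eq) = digits i , eq
    -- Otherwise y together with the combinations gives 2 ^ n + 1 distinct roots of a polynomial of
    -- degree 2 ^ n with leading coefficient 1.
    ... | no ∄ = contradiction (trans (sym (+-identityʳ 1#)) (root-bound
            (IsPoly-+ (IsPoly-frob n)
                (IsPoly-< (ℕ.^-monoʳ-< 2 (s≤s (s≤s z≤n)) (ℕ.>-nonZero⁻¹ n)) (IsPoly-frob 0)))
            points points-injective
            (λ i → x≈y⇒x+y≈0 (trans (points-fixed i) (sym (*-identityʳ _)))))) 1≉0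
      where
      points : Vector Carrier (suc (2 ℕ.^ n))
      points zero    = y
      points (suc i) = point i

      points-injective : ∀ {i j} → points i ≈ points j → i ≡ j
      points-injective {zero}  {zero}  eq = ≡.refl
      points-injective {zero}  {suc j} eq = contradiction (j , sym eq) ∄
      points-injective {suc i} {zero}  eq = contradiction (i , eq) ∄
      points-injective {suc i} {suc j} eq = ≡.cong suc (point-injective eq)

      points-fixed : ∀ i → Fixed n (points i)
      points-fixed zero    = fy
      points-fixed (suc i) = point-fixed i

-- Operators and correlations

infixl 6 _+ₒ_
infixl 7 _*ₒ_

-- Terms for the elements of 𝔽₂[σ], compared by their action on the fixed field
-- of σ ^ n.  Being syntax, they carry the involution σ ↦ σ⁻¹ by recursion.
data Op : Set where
  σ 0ₒ 1ₒ : Op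
  _+ₒ_ _*ₒ_ : Op → Op → Op

module Operator {c ℓ₁ ℓ₂} (F : HeytingField c ℓ₁ ℓ₂) (N : ℕ)
    (order : Extension.HasOrder F (2 ℕ.^ N)) where
  open Trace F N order public
  open CommutativeRing F-ring hiding (zero)
  open import Relation.Binary.Reasoning.Setoid setoid

  ⟦_⟧ : Op → Carrier → Carrier
  ⟦ σ ⟧      x = frob 1 x
  ⟦ 0ₒ ⟧     x = 0#
  ⟦ 1ₒ ⟧     x = x
  ⟦ r +ₒ s ⟧ x = ⟦ r ⟧ x + ⟦ s ⟧ x
  ⟦ r *ₒ s ⟧ x = ⟦ r ⟧ (⟦ s ⟧ x)

  ⟦⟧-cong : ∀ r {x y} → x ≈ y → ⟦ r ⟧ x ≈ ⟦ r ⟧ y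
  ⟦⟧-cong σ        eq = frob-cong 1 eq
  ⟦⟧-cong 0ₒ       eq = refl
  ⟦⟧-cong 1ₒ       eq = eq
  ⟦⟧-cong (r +ₒ s) eq = +-cong (⟦⟧-cong r eq) (⟦⟧-cong s eq)
  ⟦⟧-cong (r *ₒ s) eq = ⟦⟧-cong r (⟦⟧-cong s eq)

  ⟦⟧-+ : ∀ r x y → ⟦ r ⟧ (x + y) ≈ ⟦ r ⟧ x + ⟦ r ⟧ y
  ⟦⟧-+ σ        x y = frob-+ 1 x y
  ⟦⟧-+ 0ₒ       x y = sym (+-identityˡ _)
  ⟦⟧-+ 1ₒ       x y = refl
  ⟦⟧-+ (r +ₒ s) x y = trans (+-cong (⟦⟧-+ r x y) (⟦⟧-+ s x y))
    (solve 4 (λ a b c d → (a :+ b) :+ (c :+ d) := (a :+ c) :+ (b :+ d)) refl (⟦ r ⟧ x) (⟦ r ⟧ y)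
        (⟦ s ⟧ x) (⟦ s ⟧ y))
  ⟦⟧-+ (r *ₒ s) x y = trans (⟦⟧-cong r (⟦⟧-+ s x y)) (⟦⟧-+ r _ _)

  ⟦⟧-0 : ∀ r → ⟦ r ⟧ 0# ≈ 0#
  ⟦⟧-0 σ        = frob-0 1
  ⟦⟧-0 0ₒ       = refl
  ⟦⟧-0 1ₒ       = refl
  ⟦⟧-0 (r +ₒ s) = trans (+-cong (⟦⟧-0 r) (⟦⟧-0 s)) (+-identityˡ 0#)
  ⟦⟧-0 (r *ₒ s) = trans (⟦⟧-cong r (⟦⟧-0 s)) (⟦⟧-0 r)

  ⟦⟧-frob : ∀ r k x → ⟦ r ⟧ (frob k x) ≈ frob k (⟦ r ⟧ x)
  ⟦⟧-frob σ        k x = frob-comm 1 k x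
  ⟦⟧-frob 0ₒ       k x = sym (frob-0 k)
  ⟦⟧-frob 1ₒ       k x = refl
  ⟦⟧-frob (r +ₒ s) k x = trans (+-cong (⟦⟧-frob r k x) (⟦⟧-frob s k x)) (sym (frob-+ k _ _))
  ⟦⟧-frob (r *ₒ s) k x = trans (⟦⟧-cong r (⟦⟧-frob s k x)) (⟦⟧-frob r k _)

  ⟦⟧-comm : ∀ r s x → ⟦ r ⟧ (⟦ s ⟧ x) ≈ ⟦ s ⟧ (⟦ r ⟧ x)
  ⟦⟧-comm r σ        x = ⟦⟧-frob r 1 x
  ⟦⟧-comm r 0ₒ       x = ⟦⟧-0 r
  ⟦⟧-comm r 1ₒ       x = refl
  ⟦⟧-comm r (s +ₒ t) x = trans (⟦⟧-+ r _ _) (+-cong (⟦⟧-comm r s x) (⟦⟧-comm r t x))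
  ⟦⟧-comm r (s *ₒ t) x = trans (⟦⟧-comm r s _) (⟦⟧-cong s (⟦⟧-comm r t x))

  ⟦⟧-fixed : ∀ n r {x} → Fixed n x → Fixed n (⟦ r ⟧ x)
  ⟦⟧-fixed n r fx = trans (sym (⟦⟧-frob r n _)) (⟦⟧-cong r fx)

  -- A record rather than a Π-type, so that r and s can be inferred.
  record Equal (n : ℕ) (r s : Op) : Set (c ⊔ ℓ₁) where
    constructor equal
    field at : ∀ x → Fixed n x → ⟦ r ⟧ x ≈ ⟦ s ⟧ x
  open Equal public

  -- Multiplication is composition. It commutes because each operator is additive and commutes with
  -- the Frobenius map, and it respects `Equal n` because operators preserve the fixed field.
  -- Negation is the identity in characteristic two.
  Op-ring : ℕ → CommutativeRing _ _
  Op-ring n = record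
    { Carrier = Op
    ; _≈_ = Equal n
    ; _+_ = _+ₒ_ ; _*_ = _*ₒ_ ; -_ = id ; 0# = 0ₒ ; 1# = 1ₒ
    ; isCommutativeRing = record
      { isRing = record
        { +-isAbelianGroup = record
          { isGroup = record
            { isMonoid = record
              { isSemigroup = record
                { isMagma = record
                  { isEquivalence = record
                    { refl  = equal λ x _ → refl
                    ; sym   = λ p → equal λ x fx → sym (at p x fx)
                    ; trans = λ p q → equal λ x fx → trans (at p x fx) (at q x fx) }
                  ; ∙-cong = λ p q → equal λ x fx → +-cong (at p x fx) (at q x fx) }
                ; assoc = λ r s t → equal λ x _ → +-assoc _ _ _ }
              ; identity = (λ r → equal λ x _ → +-identityˡ _) , (λ r → equal λ x _ → +-identityʳ _) }
            ; inverse = (λ r → equal λ x _ → x+x≈0 _) , (λ r → equal λ x _ → x+x≈0 _)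
            ; ⁻¹-cong = id }
          ; comm = λ r s → equal λ x _ → +-comm _ _ }
        ; *-cong = λ {r} {r′} {s} {s′} p q → equal λ x fx →
            trans (⟦⟧-cong r (at q x fx)) (at p _ (⟦⟧-fixed n s′ fx))
        ; *-assoc = λ r s t → equal λ x _ → refl
        ; *-identity = (λ r → equal λ x _ → refl) , (λ r → equal λ x _ → refl)
        ; distrib = (λ r s t → equal λ x _ → ⟦⟧-+ r _ _) , (λ r s t → equal λ x _ → refl) }
      ; *-comm = λ r s → equal λ x _ → ⟦⟧-comm r s x } }

  module Algebra (n : ℕ) where
    open CommutativeRing (Op-ring n) public using () renaming (_≈_ to _≈ₒ_)
    module A where
      open CommutativeRing (Op-ring n) public
      open CharTwo (Op-ring n) (equal λ x _ → x+x≈0 x) public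
    open A using () renaming (_^_ to _^ₒ_)

    ⟦bit⟧ : ∀ b x → ⟦ A.bit b ⟧ x ≈ bit b * x
    ⟦bit⟧ 0ℙ x = sym (zeroˡ x)
    ⟦bit⟧ 1ℙ x = sym (*-identityˡ x)

    ⟦Σ⟧ : ∀ k f x → ⟦ A.Σ< k f ⟧ x ≈ Σ[ i < k ] ⟦ f i ⟧ x
    ⟦Σ⟧ zero    f x = refl
    ⟦Σ⟧ (suc k) f x = +-congˡ (⟦Σ⟧ k (f ∘ suc) x)

    ⟦σ^⟧ : ∀ k x → ⟦ σ ^ₒ k ⟧ x ≈ frob k x
    ⟦σ^⟧ zero    x = sym (*-identityʳ x)
    ⟦σ^⟧ (suc k) x = trans (frob-cong 1 (⟦σ^⟧ k x)) (frob-frob 1 k x)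

    fromSeq : (ℕ → 𝔽₂) → Op
    fromSeq r = A.Σ< n (λ k → A.bit (r k) A.* σ ^ₒ k)

    ⟦fromSeq⟧ : ∀ r x → ⟦ fromSeq r ⟧ x ≈ linearized n r x
    ⟦fromSeq⟧ r x = trans (⟦Σ⟧ n (λ k → A.bit (r k) A.* σ ^ₒ k) x)
      (Σ-cong n (λ k → trans (⟦bit⟧ (r k) (⟦ σ ^ₒ k ⟧ x)) (*-congˡ (⟦σ^⟧ k x))))

    σ^n≈1 : σ ^ₒ n ≈ₒ 1ₒ
    σ^n≈1 = equal λ x fx → trans (⟦σ^⟧ n x) fx

    σ^-periodic : A.Periodic n (λ k → σ ^ₒ k)
    σ^-periodic k = equal λ x fx →
        trans (⟦σ^⟧ (n ℕ.+ k) x) (trans (frob-periodic n x fx k) (sym (⟦σ^⟧ k x)))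

    correlation : Carrier → Carrier → ℕ → Carrier
    correlation x y k = tr n (x * frob k y)

    correlation-01 : ∀ {x y} → Fixed n x → Fixed n y → ∀ k →
        correlation x y k ≈ 0# ⊎ correlation x y k ≈ 1#
    correlation-01 fx fy k = tr-01 n (Fixed-* n fx (Fixed-frob n k fy))

    -- θ x x is the corresponding vector of x, read as a polynomial in σ.
    θ : Carrier → Carrier → Op
    θ x y = fromSeq (λ k → unbit (correlation x y k))

    private
      -- The action of `θ x y` on z with the correlations left as field elements: in this form it is
      -- visibly additive in x and in y, which `unbit` would hide.
      Θ : (x y z : Carrier) → Carrier
      Θ x y z = Σ[ k < n ] (correlation x y k * frob k z)

      Θ-0ˡ : ∀ y z → Θ 0# y z ≈ 0#
      Θ-0ˡ y z = trans
          (Σ-cong n (λ k → trans (*-congʳ (trans (tr-cong n (zeroˡ (frob k y))) (tr-0 n)))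
          (zeroˡ (frob k z)))) (Σ-zero n)

      Θ-0ʳ : ∀ x z → Θ x 0# z ≈ 0#
      Θ-0ʳ x z = trans
          (Σ-cong n (λ k →
          trans (*-congʳ (trans (tr-cong n (trans (*-congˡ (frob-0 k)) (zeroʳ x))) (tr-0 n)))
          (zeroˡ (frob k z)))) (Σ-zero n)

      Θ-+ˡ : ∀ x x′ y z → Θ (x + x′) y z ≈ Θ x y z + Θ x′ y z
      Θ-+ˡ x x′ y z = trans
        (Σ-cong n (λ k → trans (*-congʳ (trans (tr-cong n (distribʳ (frob k y) x x′)) (tr-+ n _ _)))
            (distribʳ (frob k z) _ _)))
        (Σ-distrib-+ n (λ k → tr n (x * frob k y) * frob k z) (λ k → tr n (x′ * frob k y) * frob k z))

      Θ-+ʳ : ∀ x y y′ z → Θ x (y + y′) z ≈ Θ x y z + Θ x y′ z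
      Θ-+ʳ x y y′ z = trans
        (Σ-cong n (λ k →
            trans (*-congʳ
            (trans (tr-cong n (trans (*-congˡ (frob-+ k y y′)) (distribˡ x _ _))) (tr-+ n _ _)))
            (distribʳ (frob k z) _ _)))
        (Σ-distrib-+ n (λ k → tr n (x * frob k y) * frob k z) (λ k → tr n (x * frob k y′) * frob k z))

      Θ-periodic : ∀ x {y z} → Fixed n y → Fixed n z → Periodic n (λ k → tr n (x * frob k y) * frob k z)
      Θ-periodic x {y} {z} fy fz k = *-cong (tr-cong n (*-congˡ (frob-periodic n y fy k)))
          (frob-periodic n z fz k)

      -- The case of σ is a shift of the summation index by one. The trace does not change when both
      -- its factors are conjugated, and its value is itself fixed by σ.
      Θ-⟦⟧ˡ : ∀ r {x y z} → Fixed n x → Fixed n y → Fixed n z → Θ (⟦ r ⟧ x) y z ≈ ⟦ r ⟧ (Θ x y z)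
      Θ-⟦⟧ˡ σ {x} {y} {z} fx fy fz = begin
        Θ (frob 1 x) y z
          ≈⟨ Σ-shift n (λ k → tr n (frob 1 x * frob k y) * frob k z) (Θ-periodic _ fy fz) 1 ⟨
        Σ[ k < n ] (tr n (frob 1 x * frob (suc k) y) * frob (suc k) z)
          ≈⟨ Σ-cong n (λ k → *-cong
               (begin
                  tr n (frob 1 x * frob (suc k) y)
                    ≈⟨ tr-cong n
                         (trans (*-congˡ (sym (frob-frob 1 k y))) (sym (frob-* 1 x (frob k y)))) ⟩
                  tr n (frob 1 (x * frob k y))        ≈⟨ tr-frob n (Fixed-* n fx (Fixed-frob n k fy)) 1 ⟩
                  tr n (x * frob k y)                 ≈⟨ frob-tr n (Fixed-* n fx (Fixed-frob n k fy)) 1 ⟨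
                  frob 1 (tr n (x * frob k y))        ∎)
               (sym (frob-frob 1 k z))) ⟩
        Σ[ k < n ] (frob 1 (tr n (x * frob k y)) * frob 1 (frob k z))
          ≈⟨ Σ-cong n (λ k → frob-* 1 (tr n (x * frob k y)) (frob k z)) ⟨
        Σ[ k < n ] frob 1 (tr n (x * frob k y) * frob k z)
          ≈⟨ frob-Σ 1 n (λ k → tr n (x * frob k y) * frob k z) ⟨
        frob 1 (Θ x y z) ∎
      Θ-⟦⟧ˡ 0ₒ fx fy fz = Θ-0ˡ _ _
      Θ-⟦⟧ˡ 1ₒ fx fy fz = refl
      Θ-⟦⟧ˡ (r +ₒ s) fx fy fz = trans (Θ-+ˡ _ _ _ _) (+-cong (Θ-⟦⟧ˡ r fx fy fz) (Θ-⟦⟧ˡ s fx fy fz))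
      Θ-⟦⟧ˡ (r *ₒ s) fx fy fz = trans (Θ-⟦⟧ˡ r (⟦⟧-fixed n s fx) fy fz) (⟦⟧-cong r (Θ-⟦⟧ˡ s fx fy fz))

      ⟦θ⟧ : ∀ {x y} → Fixed n x → Fixed n y → ∀ z → ⟦ θ x y ⟧ z ≈ Θ x y z
      ⟦θ⟧ {x} {y} fx fy z = trans (⟦fromSeq⟧ (λ k → unbit (correlation x y k)) z)
        (Σ-cong n (λ k → *-congʳ {frob k z} (bit-unbit (correlation-01 fx fy k))))

    θ-⟦⟧ˡ : ∀ r {x y} → Fixed n x → Fixed n y → θ (⟦ r ⟧ x) y ≈ₒ r *ₒ θ x y
    θ-⟦⟧ˡ r {x} {y} fx fy = equal λ z fz → trans (⟦θ⟧ (⟦⟧-fixed n r fx) fy z)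
      (trans (Θ-⟦⟧ˡ r fx fy fz) (⟦⟧-cong r (sym (⟦θ⟧ fx fy z))))

    module _ .{{_ : NonZero n}} where

      infix 20 _⋆
      _⋆ : Op → Op
      σ ⋆        = σ ^ₒ ℕ.pred n
      0ₒ ⋆       = 0ₒ
      1ₒ ⋆       = 1ₒ
      (r +ₒ s) ⋆ = r ⋆ +ₒ s ⋆
      (r *ₒ s) ⋆ = r ⋆ *ₒ s ⋆

      open A.Involution _⋆ (λ _ _ → A.refl) (λ _ _ → A.refl) A.refl A.refl public

      σ⋆*σ≈1 : σ ⋆ A.* σ ≈ₒ 1ₒ
      σ⋆*σ≈1 = A.trans (A.*-comm (σ ⋆) σ) (A.trans (A.reflexive (≡.cong (σ ^ₒ_) (ℕ.suc-pred n))) σ^n≈1)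

      private
        -- Conjugating both x and y leaves the correlations unchanged, so by `Θ-⟦⟧ˡ` applying σ to y
        -- must undo applying σ to x. This is where ⋆ enters.
        Θ-⟦⟧ʳ : ∀ r {x y z} → Fixed n x → Fixed n y → Fixed n z → Θ x (⟦ r ⟧ y) z ≈ ⟦ r ⋆ ⟧ (Θ x y z)
        Θ-⟦⟧ʳ σ {x} {y} {z} fx fy fz = begin
          Θ x (frob 1 y) z
            ≈⟨ at σ⋆*σ≈1 _ fΘ ⟨
          ⟦ σ ⋆ ⟧ (frob 1 (Θ x (frob 1 y) z))
            ≈⟨ ⟦⟧-cong (σ ⋆) (Θ-⟦⟧ˡ σ fx (⟦⟧-fixed n σ fy) fz) ⟨
          ⟦ σ ⋆ ⟧ (Θ (frob 1 x) (frob 1 y) z)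
            ≈⟨ ⟦⟧-cong (σ ⋆) (Σ-cong n (λ k → *-congʳ {frob k z} (trans
                 (tr-cong n (trans (*-congˡ (frob-comm k 1 y)) (sym (frob-* 1 x (frob k y)))))
                 (tr-frob n (Fixed-* n fx (Fixed-frob n k fy)) 1)))) ⟩
          ⟦ σ ⋆ ⟧ (Θ x y z) ∎
          where
          fΘ : Fixed n (Θ x (frob 1 y) z)
          fΘ = trans (frob-Σ n n (λ k → tr n (x * frob k (frob 1 y)) * frob k z)) (Σ-cong n (λ k →
            Fixed-* n (frob-tr n (Fixed-* n fx (Fixed-frob n k (Fixed-frob n 1 fy))) n)
                (Fixed-frob n k fz)))
        Θ-⟦⟧ʳ 0ₒ fx fy fz = Θ-0ʳ _ _
        Θ-⟦⟧ʳ 1ₒ fx fy fz = refl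
        Θ-⟦⟧ʳ (r +ₒ s) fx fy fz = trans (Θ-+ʳ _ _ _ _) (+-cong (Θ-⟦⟧ʳ r fx fy fz) (Θ-⟦⟧ʳ s fx fy fz))
        Θ-⟦⟧ʳ (r *ₒ s) fx fy fz =
            trans (Θ-⟦⟧ʳ r fx (⟦⟧-fixed n s fy) fz) (⟦⟧-cong (r ⋆) (Θ-⟦⟧ʳ s fx fy fz))

      θ-⟦⟧ʳ : ∀ r {x y} → Fixed n x → Fixed n y → θ x (⟦ r ⟧ y) ≈ₒ r ⋆ *ₒ θ x y
      θ-⟦⟧ʳ r {x} {y} fx fy = equal λ z fz → trans (⟦θ⟧ fx (⟦⟧-fixed n r fy) z)
        (trans (Θ-⟦⟧ʳ r fx fy fz) (⟦⟧-cong (r ⋆) (sym (⟦θ⟧ fx fy z))))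

      θ-norm : ∀ d {a x} → Fixed n x → IsNormOf a (θ x x) d → θ (⟦ d ⟧ x) (⟦ d ⟧ x) ≈ₒ a
      θ-norm d fx norm = A.trans (θ-⟦⟧ˡ d fx (⟦⟧-fixed n d fx)) (A.trans (A.*-congˡ (θ-⟦⟧ʳ d fx fx))
        (A.trans (A.sym (A.*-assoc _ _ _)) norm))

-- Symmetric periodic sequences as operators fixed by ⋆

module SequenceRing {c ℓ₁ ℓ₂} (F : HeytingField c ℓ₁ ℓ₂) (N : ℕ) (order : Extension.HasOrder F (2 ℕ.^ N))
  (n : ℕ) .{{_ : NonZero n}} where
  open Operator F N order public
  open Algebra n public
  open A using () renaming (_^_ to _^ₒ_)
  open import Relation.Binary.Reasoning.Setoid A.setoid

  private module F = CommutativeRing F-ring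

  SymmetricSeq : (ℕ → 𝔽₂) → Set
  SymmetricSeq r = ∀ i j → i ℕ.+ j ≡ n → r i ≡ r j

  PeriodicSeq : (ℕ → 𝔽₂) → Set
  PeriodicSeq r = ∀ k → r (n ℕ.+ k) ≡ r k

  σ*σ⋆≈1 : σ A.* σ ⋆ ≈ₒ 1ₒ
  σ*σ⋆≈1 = A.trans (A.*-comm σ (σ ⋆)) σ⋆*σ≈1

  σ^i≈σ⋆^j : ∀ i j → i ℕ.+ j ≡ n → σ ^ₒ i ≈ₒ (σ ⋆) ^ₒ j
  σ^i≈σ⋆^j i j i+j≡n = begin
    σ ^ₒ i                                    ≈⟨ A.*-identityʳ _ ⟨
    σ ^ₒ i A.* 1ₒ                             ≈⟨ A.*-congˡ (A.trans (A.^-congˡ j σ*σ⋆≈1) (A.1^n≈1 j)) ⟨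
    σ ^ₒ i A.* (σ A.* σ ⋆) ^ₒ j               ≈⟨ A.*-congˡ (A.^-distrib-* σ (σ ⋆) j) ⟩
    σ ^ₒ i A.* (σ ^ₒ j A.* (σ ⋆) ^ₒ j)        ≈⟨ A.*-assoc _ _ _ ⟨
    (σ ^ₒ i A.* σ ^ₒ j) A.* (σ ⋆) ^ₒ j        ≈⟨ A.*-congʳ (A.^-homo-* σ i j) ⟨
    σ ^ₒ (i ℕ.+ j) A.* (σ ⋆) ^ₒ j             ≡⟨ ≡.cong (λ k → σ ^ₒ k A.* (σ ⋆) ^ₒ j) i+j≡n ⟩
    σ ^ₒ n A.* (σ ⋆) ^ₒ j                     ≈⟨ A.*-congʳ σ^n≈1 ⟩
    1ₒ A.* (σ ⋆) ^ₒ j                         ≈⟨ A.*-identityˡ _ ⟩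
    (σ ⋆) ^ₒ j                                ∎

  ⋆-^ : ∀ r k → (r ^ₒ k) ⋆ ≈ₒ (r ⋆) ^ₒ k
  ⋆-^ r zero    = A.refl
  ⋆-^ r (suc k) = A.*-congˡ (⋆-^ r k)

  ⋆-Σ : ∀ k f → (A.Σ< k f) ⋆ ≈ₒ A.Σ< k (λ i → f i ⋆)
  ⋆-Σ zero    f = A.refl
  ⋆-Σ (suc k) f = A.+-congˡ (⋆-Σ k (f ∘ suc))

  σ⋆⋆≈σ : σ ⋆ ⋆ ≈ₒ σ
  σ⋆⋆≈σ = A.trans (⋆-^ σ (ℕ.pred n))
      (A.trans (A.sym (σ^i≈σ⋆^j 1 (ℕ.pred n) (ℕ.suc-pred n))) (A.*-identityʳ σ))

  -- Reflection of the index k to n - k. The reflected sum runs over 1, ..., n instead of 0, ..., n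
  -- - 1, which periodicity repairs.
  Sym-fromSeq : ∀ {r} → SymmetricSeq r → PeriodicSeq r → Sym (fromSeq r)
  Sym-fromSeq {r} symm per = begin
    (fromSeq r) ⋆                                    ≈⟨ ⋆-Σ n (λ k → A.bit (r k) A.* σ ^ₒ k) ⟩
    A.Σ< n (λ k → (A.bit (r k)) ⋆ A.* (σ ^ₒ k) ⋆)
      ≈⟨ A.Σ-cong n (λ k → A.*-cong (Sym-bit (r k)) (⋆-^ σ k)) ⟩
    A.Σ< n (λ k → A.bit (r k) A.* (σ ⋆) ^ₒ k)
      ≈⟨ A.Σ-reverse n (λ k → A.bit (r k) A.* (σ ⋆) ^ₒ k) ⟩
    A.Σ< n (λ k → A.bit (r (n ℕ.∸ suc k)) A.* (σ ⋆) ^ₒ (n ℕ.∸ suc k))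
      ≈⟨ A.Σ-cong-< n
           (λ k k<n → A.*-cong (A.reflexive (≡.cong A.bit (symm (n ℕ.∸ suc k) (suc k) (ℕ.m∸n+n≡m k<n))))
           (A.sym (σ^i≈σ⋆^j (suc k) (n ℕ.∸ suc k) (ℕ.m+[n∸m]≡n k<n)))) ⟩
    A.Σ< n (λ k → A.bit (r (1 ℕ.+ k)) A.* σ ^ₒ (1 ℕ.+ k))
      ≈⟨ A.Σ-shift n (λ k → A.bit (r k) A.* σ ^ₒ k)
           (λ k → A.*-cong (A.reflexive (≡.cong A.bit (per k))) (σ^-periodic k)) 1 ⟩
    fromSeq r ∎

  correlation-periodic : ∀ x {y} → Fixed n y → PeriodicSeq (λ k → unbit (correlation x y k))
  correlation-periodic x {y} fy k = unbit-cong (tr-cong n (F.*-congˡ (frob-periodic n y fy k)))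

  -- For i + j = n, applying σ ^ j to x σ ^ i (x) exchanges the roles of the two factors, and the
  -- trace does not see it.
  autocorrelation-symmetric : ∀ {x} → Fixed n x → SymmetricSeq (λ k → unbit (correlation x x k))
  autocorrelation-symmetric {x} fx i j i+j≡n = unbit-cong (F.trans
    (F.sym (tr-frob n (Fixed-* n fx (Fixed-frob n i fx)) j))
    (tr-cong n (F.trans (frob-* j x (frob i x)) (F.trans (F.*-congˡ (F.trans (frob-frob j i x)
      (F.trans (^-congʳ x (≡.cong (2 ℕ.^_) (≡.trans (ℕ.+-comm j i) i+j≡n))) fx))) (F.*-comm _ _)))))

  Sym-θ : ∀ {x} → Fixed n x → Sym (θ x x)
  Sym-θ {x} fx = Sym-fromSeq {λ k → unbit (correlation x x k)} (autocorrelation-symmetric fx)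
      (correlation-periodic x fx)

  frob-fromSeq : ∀ t r → A.frob t (fromSeq r) ≈ₒ A.Σ< n (λ k → A.bit (r k) A.* σ ^ₒ (k ℕ.* 2 ℕ.^ t))
  frob-fromSeq t r = A.trans (A.frob-Σ t n (λ k → A.bit (r k) A.* σ ^ₒ k)) (A.Σ-cong n λ k →
    A.trans (A.frob-* t (A.bit (r k)) (σ ^ₒ k))
        (A.*-cong (A.frob-bit t (r k)) (A.^-assocʳ σ k (2 ℕ.^ t))))

  seq-mod : ∀ {r} → PeriodicSeq r → ∀ k → r k ≡ r (k ℕ.% n)
  seq-mod {r} per k =
      ≡.trans (≡.cong r (≡.trans (ℕ.m≡m%n+[m/n]*n k n) (ℕ.+-comm (k ℕ.% n) (k ℕ./ n ℕ.* n))))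
      (mult (k ℕ./ n))
    where
    mult : ∀ q → r (q ℕ.* n ℕ.+ k ℕ.% n) ≡ r (k ℕ.% n)
    mult zero    = ≡.refl
    mult (suc q) = ≡.trans (≡.cong r (ℕ.+-assoc n (q ℕ.* n) _)) (≡.trans (per _) (mult q))

  module Faithful (M : ℕ) .{{_ : NonZero M}} (M*n≡N : M ℕ.* n ≡ N) where
    open Subfield n M M*n≡N

    -- The way back from operators to coefficients: equality of actions on the fixed field becomes
    -- equality of sequences by faithfulness.
    fromSeq-injective : ∀ {r r′} → PeriodicSeq r → PeriodicSeq r′ → fromSeq r ≈ₒ fromSeq r′ → ∀ k →
        r k ≡ r′ k
    fromSeq-injective {r} {r′} per per′ eq k = ≡.trans (seq-mod per k) (≡.trans
      (ℙ.+-cancelʳ-≡ (r′ (k ℕ.% n)) _ _ (≡.trans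
        (linearized-faithful (λ k → r k ℙ.+ r′ k) (λ k → ≡.cong₂ ℙ._+_ (per k) (per′ k)) vanish
            (k ℕ.% n) (ℕ.m%n<n k n))
        (≡.sym (ℙ.p+p≡0ℙ (r′ (k ℕ.% n))))))
      (≡.sym (seq-mod per′ k)))
      where
      vanish : ∀ x → Fixed n x → linearized n (λ k → r k ℙ.+ r′ k) x F.≈ F.0#
      vanish x fx = F.trans (F.sym (linearized-+ n r r′ x)) (x≈y⇒x+y≈0
        (F.trans (F.sym (⟦fromSeq⟧ r x)) (F.trans (at eq x fx) (⟦fromSeq⟧ r′ x))))

    θ≈fromSeq⇒correlation : ∀ {x y r} → Fixed n x → Fixed n y → PeriodicSeq r → θ x y ≈ₒ fromSeq r →
      ∀ k → correlation x y k F.≈ bit (r k)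
    θ≈fromSeq⇒correlation {x} fx fy per eq k = F.trans (F.sym (bit-unbit (correlation-01 fx fy k)))
      (F.reflexive (≡.cong bit (fromSeq-injective (correlation-periodic x fy) per eq k)))

-- Degree a power of two

2^suc : ∀ t → 2 ℕ.^ t ℕ.+ 2 ℕ.^ t ≡ 2 ℕ.^ suc t
2^suc t = ≡.cong (2 ℕ.^ t ℕ.+_) (≡.sym (ℕ.+-identityʳ (2 ℕ.^ t)))

parity-double : ∀ k → ℕ.parity (k ℕ.+ k) ≡ 0ℙ
parity-double zero    = ≡.refl
parity-double (suc k) = ≡.trans (≡.cong (λ i → ℕ.parity (suc i)) (ℕ.+-suc k k)) (parity-double k)

parity-suc-double : ∀ k → ℕ.parity (suc (k ℕ.+ k)) ≡ 1ℙ
parity-suc-double zero    = ≡.refl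
parity-suc-double (suc k) = ≡.trans (≡.cong (λ i → ℕ.parity (suc (suc i))) (ℕ.+-suc k k))
    (parity-suc-double k)

module BinaryPart {c ℓ₁ ℓ₂} (F : HeytingField c ℓ₁ ℓ₂) (N : ℕ)
    (order : Extension.HasOrder F (2 ℕ.^ N)) (t : ℕ) where
  -- With n = 2 ^ s and s = t + 2, `h` is half of n, the middle index at which a symmetric vector is
  -- its own mirror image, and `e` is a quarter of n, the number of odd indices below `h`.
  e = 2 ℕ.^ t
  h = 2 ℕ.^ suc t
  n = 2 ℕ.^ suc (suc t)

  private instance
    n≢0 : NonZero n
    n≢0 = ℕ.m^n≢0 2 (suc (suc t))

  open SequenceRing F N order n
  open A using () renaming (_^_ to _^ₒ_)

  private
    h+h≡n : h ℕ.+ h ≡ n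
    h+h≡n = 2^suc (suc t)

    e+e≡h : e ℕ.+ e ≡ h
    e+e≡h = 2^suc t

    y : Op
    y = σ A.+ σ ⋆

    Sym-y : Sym y
    Sym-y = A.trans (A.+-congˡ σ⋆⋆≈σ) (A.+-comm (σ ⋆) σ)

    -- The power with exponent h is σ ^ h + σ ^ (-h), whose terms agree because σ ^ (2 h) = 1.
    y-nilpotent : A.frob (suc t) y ≈ₒ 0ₒ
    y-nilpotent = A.trans (A.frob-+ (suc t) σ (σ ⋆)) (A.x≈y⇒x+y≈0 (σ^i≈σ⋆^j h h h+h≡n))

    open A.Dickson σ*σ⋆≈1

    Sym-quotient : ∀ k → Sym (quotient k)
    Sym-quotient zero          = A.refl
    Sym-quotient (suc zero)    = A.refl
    Sym-quotient (suc (suc k)) =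
        Sym-+ (Sym-+ (Sym-bit (ℕ.parity (suc k))) (Sym-* Sym-y (Sym-quotient (suc k)))) (Sym-quotient k)

    module _ where
      open import Relation.Binary.Reasoning.Setoid A.setoid

      -- Mirror indices pair up to r k (σ ^ k + σ ^ (-k)), which is r k y modulo y² for odd k and 0
      -- for even k. The unpaired indices 0 and h contribute 1 and 0, and `odd` makes the
      -- coefficient of y equal to 1.
      one+y+y²g : ∀ {r} → SymmetricSeq r → r 0 ≡ 1ℙ → r h ≡ 0ℙ →
        A.Σ< h (λ k → A.bit (r k) A.* A.bit (ℕ.parity k)) ≈ₒ 1ₒ →
        ∃[ g ] Sym g × fromSeq r ≈ₒ 1ₒ A.+ y A.+ y A.* y A.* g
      one+y+y²g {r} symm r0 rh odd = g , Sym-Σ h (λ k → Sym-* (Sym-bit (r k)) (Sym-quotient k)) , (begin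
        fromSeq r
          ≡⟨ ≡.cong (λ n → A.Σ< n p) h+h≡n ⟨
        A.Σ< (h ℕ.+ h) p
          ≈⟨ A.Σ-split h h p ⟩
        A.Σ< h p A.+ A.Σ< h (λ k → p (h ℕ.+ k))
          ≈⟨ A.+-congˡ (A.Σ-reverse h (λ k → p (h ℕ.+ k))) ⟩
        A.Σ< h p A.+ A.Σ< h (λ k → p (h ℕ.+ (h ℕ.∸ suc k)))
          ≈⟨ A.+-congˡ (A.Σ-cong-< h λ k k<h → A.*-cong
               (A.reflexive (≡.cong A.bit (symm _ (suc k) (complement k k<h))))
               (σ^i≈σ⋆^j _ (suc k) (complement k k<h))) ⟩
        A.Σ< h p A.+ A.Σ< h (λ k → q (suc k))
          ≈⟨ A.+-congˡ (rotate h) ⟩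
        A.Σ< h p A.+ (q 0 A.+ A.Σ< h q A.+ q h)
          ≈⟨ A.+-congˡ (A.+-cong (A.+-congʳ (A.*-cong (A.reflexive (≡.cong A.bit r0)) A.refl))
               (A.trans (A.*-congʳ (A.reflexive (≡.cong A.bit rh))) (A.zeroˡ _))) ⟩
        A.Σ< h p A.+ (1ₒ A.* 1ₒ A.+ A.Σ< h q A.+ 0ₒ)
          ≈⟨ A.solve 2
               (λ P Q → P A.:+ (A.con 1ℙ A.:* A.con 1ℙ A.:+ Q A.:+ A.con 0ℙ) A.:= A.con 1ℙ
               A.:+ (P A.:+ Q)) A.refl (A.Σ< h p) (A.Σ< h q) ⟩
        1ₒ A.+ (A.Σ< h p A.+ A.Σ< h q)
          ≈⟨ A.+-congˡ (A.Σ-distrib-+ h p q) ⟨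
        1ₒ A.+ A.Σ< h (λ k → p k A.+ q k)
          ≈⟨ A.+-congˡ (A.Σ-cong h λ k → A.trans (A.sym (A.distribˡ (A.bit (r k)) (σ ^ₒ k) (σ ⋆ ^ₒ k)))
               (A.trans (A.*-congˡ (dickson k))
                   (A.solve 4 (λ b i y g → b A.:* (i A.:* y A.:+ y A.:* y A.:* g) A.:=
                 (b A.:* i) A.:* y A.:+ y A.:* y A.:* (b A.:* g)) A.refl (A.bit (r k))
                     (A.bit (ℕ.parity k)) y (quotient k)))) ⟩
        1ₒ A.+ A.Σ< h (λ k → (u k A.* y) A.+ (y A.* y A.* v k))
          ≈⟨ A.+-congˡ (A.trans (A.Σ-distrib-+ h (λ k → u k A.* y) (λ k → y A.* y A.* v k))
               (A.+-cong (A.sym (A.*-distribʳ-Σ h y u)) (A.sym (A.*-distribˡ-Σ h (y A.* y) v)))) ⟩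
        1ₒ A.+ (A.Σ< h u A.* y A.+ y A.* y A.* g)
          ≈⟨ A.+-congˡ (A.+-congʳ (A.trans (A.*-congʳ odd) (A.*-identityˡ y))) ⟩
        1ₒ A.+ (y A.+ y A.* y A.* g)
          ≈⟨ A.+-assoc _ _ _ ⟨
        1ₒ A.+ y A.+ y A.* y A.* g ∎)
        where
        p q u v : ℕ → Op
        p k = A.bit (r k) A.* σ ^ₒ k
        q k = A.bit (r k) A.* σ ⋆ ^ₒ k
        u k = A.bit (r k) A.* A.bit (ℕ.parity k)
        v k = A.bit (r k) A.* quotient k
        g = A.Σ< h v

        complement : ∀ k → k ℕ.< h → h ℕ.+ (h ℕ.∸ suc k) ℕ.+ suc k ≡ n
        complement k k<h =
            ≡.trans (ℕ.+-assoc h _ (suc k)) (≡.trans (≡.cong (h ℕ.+_) (ℕ.m∸n+n≡m k<h)) h+h≡n)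

        -- `q 0` is inserted twice: one copy extends the sum to start at index 0, the other becomes
        -- the constant 1 of the result.
        rotate : ∀ k → A.Σ< k (λ i → q (suc i)) ≈ₒ q 0 A.+ A.Σ< k q A.+ q k
        rotate k = begin
          S                            ≈⟨ A.solve 2 (λ a S → S A.:= a A.:+ (a A.:+ S)) A.refl (q 0) S ⟩
          q 0 A.+ A.Σ< (suc k) q       ≈⟨ A.+-congˡ (A.Σ-last k q) ⟩
          q 0 A.+ (A.Σ< k q A.+ q k)   ≈⟨ A.+-assoc _ _ _ ⟨
          q 0 A.+ A.Σ< k q A.+ q k     ∎
          where S = A.Σ< k (λ i → q (suc i))

  open CommutativeRing F-ring hiding (zero)
  open import Relation.Binary.Reasoning.Setoid setoid

  private
    op-sum : ∀ (r : ℕ → 𝔽₂) → Σ[ k < h ] (bit (r k) * bit (ℕ.parity k)) ≈ 1# →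
      A.Σ< h (λ k → A.bit (r k) A.* A.bit (ℕ.parity k)) ≈ₒ 1ₒ
    op-sum r eq = A.trans (A.Σ-cong h (λ k → A.sym (A.bit-* (r k) (ℕ.parity k))))
      (A.trans (A.sym (A.bit-sum h (λ k → r k ℙ.* ℕ.parity k)))
      (A.reflexive
          (≡.cong A.bit
          (bit-injective {𝔽₂.sum {h} (λ i → r (toℕ i) ℙ.* ℕ.parity (toℕ i))} {1ℙ}
          (trans (bit-sum h (λ k → r k ℙ.* ℕ.parity k))
        (trans (Σ-cong h (λ k → bit-* (r k) (ℕ.parity k))) eq))))))

    module _ {β} (fβ : Fixed n β) (tr-β : tr n β ≈ 1#) where
      private
        -- The sum of the even conjugates, which is the trace from the fixed field of σ ^ n to that
        -- of σ ^ 2.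
        E : Carrier → Carrier
        E x = Σ[ i < h ] frob (i ℕ.+ i) x

        o : ℕ → ℕ
        o j = suc (j ℕ.+ j)

        ω : ℕ → Carrier
        ω j = β * frob (o j) β

        fω : ∀ j → Fixed n (ω j)
        fω j = Fixed-* n fβ (Fixed-frob n (o j) fβ)

        double-shift : ∀ i j → (i ℕ.+ j) ℕ.+ (i ℕ.+ j) ≡ (i ℕ.+ i) ℕ.+ (j ℕ.+ j)
        double-shift i j = interchange i j i j
          where open import Algebra.Properties.CommutativeSemigroup ℕ.+-commutativeSemigroup using (interchange)

        even-periodic : ∀ {x} → Fixed n x → Periodic h (λ j → frob (j ℕ.+ j) x)
        even-periodic {x} fx j =
            trans (^-congʳ x
            (≡.cong (2 ℕ.^_) (≡.trans (double-shift h j) (≡.cong (ℕ._+ (j ℕ.+ j)) h+h≡n))))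
          (frob-periodic n x fx (j ℕ.+ j))

        frob-even-E : ∀ {x} → Fixed n x → ∀ l → frob (l ℕ.+ l) (E x) ≈ E x
        frob-even-E {x} fx l = begin
          frob (l ℕ.+ l) (E x)
            ≈⟨ frob-Σ (l ℕ.+ l) h (λ i → frob (i ℕ.+ i) x) ⟩
          Σ[ i < h ] frob (l ℕ.+ l) (frob (i ℕ.+ i) x)
            ≈⟨ Σ-cong h (λ i →
                 trans (frob-frob (l ℕ.+ l) (i ℕ.+ i) x)
                 (^-congʳ x (≡.cong (2 ℕ.^_) (≡.sym (double-shift l i))))) ⟩
          Σ[ i < h ] frob ((l ℕ.+ i) ℕ.+ (l ℕ.+ i)) x
            ≈⟨ Σ-shift h (λ j → frob (j ℕ.+ j) x) (even-periodic fx) l ⟩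
          E x                                               ∎

        frob-odd-E : ∀ {x} → Fixed n x → ∀ l → frob (o l) (E x) ≈ frob 1 (E x)
        frob-odd-E {x} fx l = trans (sym (frob-frob 1 (l ℕ.+ l) (E x))) (frob-cong 1 (frob-even-E fx l))

        E-frob : ∀ k x → E (frob k x) ≈ frob k (E x)
        E-frob k x = trans (Σ-cong h (λ i → frob-comm (i ℕ.+ i) k x))
            (sym (frob-Σ k h (λ i → frob (i ℕ.+ i) x)))

        E-cong : ∀ {x x′} → x ≈ x′ → E x ≈ E x′
        E-cong {x} {x′} eq = Σ-cong h {λ i → frob (i ℕ.+ i) x} {λ i → frob (i ℕ.+ i) x′}
            (λ i → frob-cong (i ℕ.+ i) eq)

        tr≈E+σE : ∀ x → tr n x ≈ E x + frob 1 (E x)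
        tr≈E+σE x = begin
          tr n x             ≡⟨ ≡.cong (λ n → tr n x) h+h≡n ⟨
          tr (h ℕ.+ h) x     ≈⟨ Σ-even-odd-even h (λ k → frob k x) ⟩
          E x + Σ[ k < h ] frob (suc (k ℕ.+ k)) x
            ≈⟨ +-congˡ (Σ-cong h (λ k → frob-frob 1 (k ℕ.+ k) x)) ⟨
          E x + Σ[ k < h ] frob 1 (frob (k ℕ.+ k) x)
            ≈⟨ +-congˡ (frob-Σ 1 h (λ k → frob (k ℕ.+ k) x)) ⟨
          E x + frob 1 (E x) ∎

        -- T is a root of x² + x + 1, so its norm T T² is 1.
        E*σE≈1 : E β * frob 1 (E β) ≈ 1#
        E*σE≈1 = begin
          T * frob 1 T
            ≈⟨ solve 2 (λ T S → T :* S := T :* (T :+ S) :+ T :* T) refl T (frob 1 T) ⟩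
          T * (T + frob 1 T) + T * T
            ≈⟨ +-cong (*-congˡ (trans (sym (tr≈E+σE β)) tr-β)) (sym (x^2≈x*x T)) ⟩
          T * 1# + frob 1 T         ≈⟨ +-congʳ (*-identityʳ T) ⟩
          T + frob 1 T              ≈⟨ tr≈E+σE β ⟨
          tr n β                    ≈⟨ tr-β ⟩
          1#                        ∎
          where T = E β

        -- The product pairs every even conjugate of β with every odd one. Grouping the pairs by the
        -- difference of their indices, an odd number 2 j + 1, gives the even conjugates of `ω j`.
        E*σE≈ΣEω : E β * frob 1 (E β) ≈ Σ[ j < h ] E (ω j)
        E*σE≈ΣEω = begin
          E β * frob 1 (E β)
            ≈⟨ *-congˡ (trans (frob-Σ 1 h (λ k → frob (k ℕ.+ k) β))
                 (Σ-cong h (λ k → frob-frob 1 (k ℕ.+ k) β))) ⟩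
          E β * Σ[ j < h ] frob (o j) β
            ≈⟨ *-distribʳ-Σ h (Σ[ j < h ] frob (o j) β) (λ i → frob (i ℕ.+ i) β) ⟩
          Σ[ i < h ] (frob (i ℕ.+ i) β * Σ[ j < h ] frob (o j) β)
            ≈⟨ Σ-cong h (λ i →
                 *-congˡ {frob (i ℕ.+ i) β} (Σ-shift h (λ j → frob (o j) β) odd-periodic i)) ⟨
          Σ[ i < h ] (frob (i ℕ.+ i) β * Σ[ j < h ] frob (o (i ℕ.+ j)) β)
            ≈⟨ Σ-cong h (λ i → *-distribˡ-Σ h (frob (i ℕ.+ i) β) (λ j → frob (o (i ℕ.+ j)) β)) ⟩
          Σ[ i < h ] Σ[ j < h ] (frob (i ℕ.+ i) β * frob (o (i ℕ.+ j)) β)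
            ≈⟨ Σ-cong h (λ i →
                 Σ-cong h (λ j → trans (frob-* (i ℕ.+ i) β (frob (o j) β)) (*-congˡ {frob (i ℕ.+ i) β}
                 (trans (frob-frob (i ℕ.+ i) (o j) β)
                     (^-congʳ β (≡.cong (2 ℕ.^_)
                     (≡.trans (ℕ.+-suc (i ℕ.+ i) (j ℕ.+ j))
                     (≡.cong suc (≡.sym (double-shift i j)))))))))) ⟨
          Σ[ i < h ] Σ[ j < h ] frob (i ℕ.+ i) (ω j)
            ≈⟨ Σ-swap h h (λ i j → frob (i ℕ.+ i) (ω j)) ⟩
          Σ[ j < h ] E (ω j) ∎
          where
          odd-periodic : Periodic h (λ j → frob (o j) β)
          odd-periodic j = trans (sym (frob-frob 1 ((h ℕ.+ j) ℕ.+ (h ℕ.+ j)) β))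
              (trans (frob-cong 1 (even-periodic fβ j)) (frob-frob 1 (j ℕ.+ j) β))

        -- The odd index 2 j + 1 is reflected to n - (2 j + 1), and the product at the reflected
        -- index is an odd conjugate of `ω j`. On values of E every odd power of σ acts as σ.
        Eω-reflect : ∀ j → j ℕ.< h → E (ω (h ℕ.∸ suc j)) ≈ frob 1 (E (ω j))
        Eω-reflect j j<h = begin
          E (ω j′)                       ≈⟨ E-cong (begin
              β * frob (o j′) β                         ≈⟨ *-comm _ _ ⟩
              frob (o j′) β * β
                ≈⟨ *-congˡ (trans (^-congʳ β (≡.cong (2 ℕ.^_) o+o≡n)) fβ) ⟨
              frob (o j′) β * frob (o j′ ℕ.+ o j) β     ≈⟨ *-congˡ (frob-frob (o j′) (o j) β) ⟨
              frob (o j′) β * frob (o j′) (frob (o j) β) ≈⟨ frob-* (o j′) β (frob (o j) β) ⟨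
              frob (o j′) (ω j)                         ∎) ⟩
          E (frob (o j′) (ω j))          ≈⟨ E-frob (o j′) (ω j) ⟩
          frob (o j′) (E (ω j))          ≈⟨ frob-odd-E (fω j) j′ ⟩
          frob 1 (E (ω j))               ∎
          where
          j′ = h ℕ.∸ suc j
          o+o≡n : o j′ ℕ.+ o j ≡ n
          o+o≡n = ≡.trans (≡.cong suc (ℕ.+-suc (j′ ℕ.+ j′) (j ℕ.+ j)))
              (≡.trans (≡.cong (λ i → suc (suc i)) (≡.sym (double-shift j′ j)))
            (≡.trans (≡.cong suc (≡.sym (ℕ.+-suc (j′ ℕ.+ j) (j′ ℕ.+ j))))
            (≡.trans (≡.cong₂ ℕ._+_ j′+ j′+) h+h≡n)))
            where
            j′+ : suc (j′ ℕ.+ j) ≡ h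
            j′+ = ≡.trans (≡.sym (ℕ.+-suc j′ j)) (ℕ.m∸n+n≡m j<h)

      -- Each trace is E (ω j) plus its conjugate, and by reflection the conjugates are the values
      -- of E ∘ ω on the upper half of the range below h. The full range sums to the norm of E β,
      -- which is 1.
      odd-autocorrelations : Σ[ j < e ] correlation β β (suc (j ℕ.+ j)) ≈ 1#
      odd-autocorrelations = begin
        Σ[ j < e ] tr n (ω j)
          ≈⟨ Σ-cong e (λ j → tr≈E+σE (ω j)) ⟩
        Σ[ j < e ] (E (ω j) + frob 1 (E (ω j)))
          ≈⟨ Σ-distrib-+ e (λ j → E (ω j)) (λ j → frob 1 (E (ω j))) ⟩
        Σ[ j < e ] E (ω j) + Σ[ j < e ] frob 1 (E (ω j))
          ≈⟨ +-congˡ (Σ-cong-< e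
               (λ j j<e → trans (E-cong (reflexive (≡.cong ω (reindex j j<e))))
               (Eω-reflect j (ℕ.≤-trans j<e e≤h)))) ⟨
        Σ[ j < e ] E (ω j) + Σ[ j < e ] E (ω (e ℕ.+ (e ℕ.∸ suc j)))
          ≈⟨ +-congˡ (Σ-reverse e (λ j → E (ω (e ℕ.+ j)))) ⟨
        Σ[ j < e ] E (ω j) + Σ[ j < e ] E (ω (e ℕ.+ j))
          ≈⟨ Σ-split e e (λ j → E (ω j)) ⟨
        Σ[ j < e ℕ.+ e ] E (ω j)
          ≡⟨ ≡.cong (λ k → Σ[ j < k ] E (ω j)) e+e≡h ⟩
        Σ[ j < h ] E (ω j)
          ≈⟨ E*σE≈ΣEω ⟨
        E β * frob 1 (E β)
          ≈⟨ E*σE≈1 ⟩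
        1# ∎
        where
        e≤h : e ℕ.≤ h
        e≤h = ≡.subst (e ℕ.≤_) e+e≡h (ℕ.m≤m+n e e)
        reindex : ∀ j → j ℕ.< e → e ℕ.+ (e ℕ.∸ suc j) ≡ h ℕ.∸ suc j
        reindex j j<e = ≡.trans (≡.sym (ℕ.+-∸-assoc e j<e)) (≡.cong (ℕ._∸ suc j) e+e≡h)

      autocorrelation-0 : correlation β β 0 ≈ 1#
      autocorrelation-0 = begin
        tr n (β * frob 0 β)  ≈⟨ tr-cong n (trans (*-congˡ (*-identityʳ β)) (sym (x^2≈x*x β))) ⟩
        tr n (frob 1 β)      ≈⟨ tr-frob n fβ 1 ⟩
        tr n β               ≈⟨ tr-β ⟩
        1#                   ∎

      -- The product of β and σ ^ h (β) is fixed by σ ^ h, so its trace counts the same half sum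
      -- twice.
      autocorrelation-h : correlation β β h ≈ 0#
      autocorrelation-h = begin
        tr n z                                                ≡⟨ ≡.cong (λ n → tr n z) h+h≡n ⟨
        tr (h ℕ.+ h) z                                        ≈⟨ Σ-split h h (λ k → frob k z) ⟩
        tr h z + Σ[ k < h ] frob (h ℕ.+ k) z
          ≈⟨ +-congˡ (Σ-cong h (λ k → frob-periodic h z fz k)) ⟩
        tr h z + tr h z                                       ≈⟨ x+x≈0 (tr h z) ⟩
        0#                                                    ∎
        where
        z = β * frob h β
        fz : Fixed h z
        fz = trans (frob-* h β (frob h β)) (trans (*-congˡ (trans (frob-frob h h β)
          (trans (^-congʳ β (≡.cong (2 ℕ.^_) h+h≡n)) fβ))) (*-comm _ _))

      private
        c′ : ℕ → 𝔽₂
        c′ k = unbit (correlation β β k)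

        bit-c′ : ∀ k → bit (c′ k) ≈ correlation β β k
        bit-c′ k = bit-unbit (correlation-01 fβ fβ k)

        odd-sum : Σ[ k < h ] (bit (c′ k) * bit (ℕ.parity k)) ≈ 1#
        odd-sum = begin
          Σ< h f                     ≡⟨ ≡.cong (λ h → Σ< h f) e+e≡h ⟨
          Σ< (e ℕ.+ e) f             ≈⟨ Σ-even-odd-even e f ⟩
          Σ[ k < e ] f (k ℕ.+ k) + Σ[ k < e ] f (suc (k ℕ.+ k))
            ≈⟨ +-cong
                 (trans (Σ-cong e
                     (λ k → trans
                     (*-congˡ {bit (c′ (k ℕ.+ k))} (reflexive (≡.cong bit (parity-double k))))
                     (zeroʳ (bit (c′ (k ℕ.+ k)))))) (Σ-zero e))
                 (Σ-cong e (λ k →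
                     trans (*-cong (bit-c′ (suc (k ℕ.+ k)))
                     (reflexive (≡.cong bit (parity-suc-double k)))) (*-identityʳ _))) ⟩
          0# + Σ[ k < e ] correlation β β (suc (k ℕ.+ k))
            ≈⟨ trans (+-identityˡ _) odd-autocorrelations ⟩
          1# ∎
          where
          f : ℕ → Carrier
          f k = bit (c′ k) * bit (ℕ.parity k)

      θ-one+y+y²g : ∃[ g ] Sym g × θ β β ≈ₒ 1ₒ A.+ y A.+ y A.* y A.* g
      θ-one+y+y²g = one+y+y²g (autocorrelation-symmetric fβ)
        (bit-injective (trans (bit-c′ 0) autocorrelation-0))
        (bit-injective (trans (bit-c′ h) autocorrelation-h))
        (op-sum c′ odd-sum)

  autocorrelation-realizable : .{{_ : NonZero N}} (M : ℕ) .{{_ : NonZero M}} → M ℕ.* n ≡ N → ∀ r →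
    SymmetricSeq r → PeriodicSeq r → r 0 ≡ 1ℙ → r h ≡ 0ℙ →
    Σ[ k < h ] (bit (r k) * bit (ℕ.parity k)) ≈ 1# →
    ∃[ x ] Fixed n x × (∀ k → correlation x x k ≈ bit (r k))
  autocorrelation-realizable M M*n≡N r symm per r0 rh odd =
    let β , fβ , tr-β = trace-one-fixed n M M*n≡N
        g′ , sg′ , θ≈ = θ-one+y+y²g fβ tr-β
        g , sg , r≈   = one+y+y²g symm r0 rh (op-sum r odd)
        d , norm      = norm-2-power {r = suc t} σ*σ⋆≈1 A.refl Sym-y sg sg′ y-nilpotent r≈ θ≈
        fx            = ⟦⟧-fixed n d fβ
    in ⟦ d ⟧ β , fx , Faithful.θ≈fromSeq⇒correlation M M*n≡N fx fx per (θ-norm d fβ norm)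

-- Odd degree

module _ (h : ℕ) where
  private m = h ℕ.+ suc h

  ∣2^*⇒∣ : ∀ i x → m ℕ.∣ 2 ℕ.^ i ℕ.* x → m ℕ.∣ x
  ∣2^*⇒∣ zero    x m∣ = ≡.subst (m ℕ.∣_) (ℕ.*-identityˡ x) m∣
  ∣2^*⇒∣ (suc i) x m∣ = ∣2^*⇒∣ i x (∣2*⇒∣ (≡.subst (m ℕ.∣_) (ℕ.*-assoc 2 (2 ℕ.^ i) x) m∣))
    where
    open import Data.Nat.Solver using (module +-*-Solver)
    open +-*-Solver
    ∣2*⇒∣ : ∀ {y} → m ℕ.∣ 2 ℕ.* y → m ℕ.∣ y
    -- `suc h` is the inverse of 2 modulo m = 2 h + 1.
    ∣2*⇒∣ {y} m∣2y = ℕ.∣m+n∣m⇒∣n (≡.subst (m ℕ.∣_)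
      (solve 2 (λ h y → (con 1 :+ h) :* (con 2 :* y) := (h :+ (con 1 :+ h)) :* y :+ y) ≡.refl h y)
      (ℕ.∣n⇒∣m*n (suc h) m∣2y)) (ℕ.m∣m*n y)

  -- Two of the powers 2 ^ 0, ..., 2 ^ m agree modulo m, and the smaller one cancels from their
  -- difference. The exponent is kept as a successor so that `frob t` can later serve as a square
  -- root.
  order-of-2 : ∃[ t ] ∃[ c ] 2 ℕ.^ suc t ≡ 1 ℕ.+ c ℕ.* m
  order-of-2 with Fin.pigeonhole (ℕ.n<1+n m) (λ i → 2 ℕ.^ toℕ i ℕ.mod m)
    where instance
      m≢0 : NonZero m
      m≢0 = ≡.subst NonZero (≡.sym (ℕ.+-suc h h)) _
  ... | i , j , i<j , eq =
      t , c , (≡.trans (≡.sym (ℕ.suc-pred (2 ℕ.^ suc t) {{ℕ.m^n≢0 2 (suc t)}})) (≡.cong suc pred≡))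
    where
    instance
      m≢0 : NonZero m
      m≢0 = ≡.subst NonZero (≡.sym (ℕ.+-suc h h)) _
    a = toℕ i
    b = toℕ j
    t = b ℕ.∸ suc a

    mod≡ : 2 ℕ.^ a ℕ.% m ≡ 2 ℕ.^ b ℕ.% m
    mod≡ = ≡.trans (≡.sym (Fin.toℕ-fromℕ< _)) (≡.trans (≡.cong toℕ eq) (Fin.toℕ-fromℕ< _))

    p = ℕ.pred (2 ℕ.^ suc t)

    2^b : 2 ℕ.^ b ≡ 2 ℕ.^ a ℕ.* p ℕ.+ 2 ℕ.^ a
    2^b = ≡.trans (≡.cong (2 ℕ.^_) (≡.sym (≡.trans (ℕ.+-suc a t) (ℕ.m+[n∸m]≡n i<j))))
      (≡.trans (ℕ.^-distribˡ-+-* 2 a (suc t))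
      (≡.trans (≡.cong (2 ℕ.^ a ℕ.*_) (≡.sym (ℕ.suc-pred (2 ℕ.^ suc t) {{ℕ.m^n≢0 2 (suc t)}})))
      (≡.trans (ℕ.*-suc (2 ℕ.^ a) p) (ℕ.+-comm (2 ℕ.^ a) _))))

    u = 2 ℕ.^ a ℕ.% m
    qa = 2 ℕ.^ a ℕ./ m ℕ.* m
    qb = 2 ℕ.^ b ℕ./ m ℕ.* m

    difference : qb ≡ qa ℕ.+ 2 ℕ.^ a ℕ.* p
    difference =
        ℕ.+-cancelˡ-≡ u _ _
        (≡.trans (≡.cong (ℕ._+ qb) mod≡) (≡.trans (≡.sym (ℕ.m≡m%n+[m/n]*n (2 ℕ.^ b) m))
      (≡.trans 2^b
          (≡.trans (ℕ.+-comm _ (2 ℕ.^ a))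
          (≡.trans (≡.cong (ℕ._+ 2 ℕ.^ a ℕ.* p) (ℕ.m≡m%n+[m/n]*n (2 ℕ.^ a) m)) (ℕ.+-assoc u qa _))))))

    m∣p : m ℕ.∣ p
    m∣p = ∣2^*⇒∣ a p
        (ℕ.∣m+n∣m⇒∣n (≡.subst (m ℕ.∣_) difference (ℕ.n∣m*n (2 ℕ.^ b ℕ./ m))) (ℕ.n∣m*n (2 ℕ.^ a ℕ./ m)))

    c = ℕ._∣_.quotient m∣p
    pred≡ = ℕ._∣_.equality m∣p

module OddPart {c ℓ₁ ℓ₂} (F : HeytingField c ℓ₁ ℓ₂) (N : ℕ) (order : Extension.HasOrder F (2 ℕ.^ N))
  .{{_ : NonZero N}} (l M : ℕ) .{{_ : NonZero M}} (M*m≡N : M ℕ.* (l ℕ.+ suc l) ≡ N) where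

  n = l ℕ.+ suc l

  private instance
    n≢0 : NonZero n
    n≢0 = ≡.subst NonZero (≡.sym (ℕ.+-suc l l)) _

  open SequenceRing F N order n
  open Faithful M M*m≡N
  open Subfield n M M*m≡N using (linearized-nonzero)
  open A using () renaming (_^_ to _^ₒ_)
  open CommutativeRing F-ring hiding (zero)

  private
    t : ℕ
    t = proj₁ (order-of-2 l)

    u : ℕ
    u = 2 ℕ.^ suc t ℕ.∸ 2

    2^t≡2+u : 2 ℕ.^ suc t ≡ 2 ℕ.+ u
    2^t≡2+u = ≡.sym (ℕ.m+[n∸m]≡n {2} (ℕ.*-monoʳ-≤ 2 (ℕ.m^n>0 2 t)))

  -- Raising to the power 2 ^ (t + 1) multiplies each exponent of σ by a number congruent to 1
  -- modulo n.
  frob-t-fromSeq : ∀ r → A.frob (suc t) (fromSeq r) ≈ₒ fromSeq r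
  frob-t-fromSeq r =
      A.trans (frob-fromSeq (suc t) r) (A.Σ-cong n λ k → A.*-congˡ {A.bit (r k)} (exponent k))
    where
    d = proj₁ (proj₂ (order-of-2 l))
    exponent : ∀ k → σ ^ₒ (k ℕ.* 2 ℕ.^ suc t) ≈ₒ σ ^ₒ k
    exponent k =
        A.trans (A.reflexive (≡.cong (σ ^ₒ_) (≡.trans (≡.cong (k ℕ.*_) (proj₂ (proj₂ (order-of-2 l))))
      (≡.trans (ℕ.*-suc k (d ℕ.* n))
          (≡.trans (≡.cong (k ℕ.+_) (≡.sym (ℕ.*-assoc k d n))) (ℕ.+-comm k _))))))
      (A.Periodic-* n (σ ^ₒ_) σ^-periodic (k ℕ.* d) k)

  power-periodic : ∀ r → fromSeq r ^ₒ (2 ℕ.+ u) ≈ₒ fromSeq r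
  power-periodic r = A.trans (A.reflexive (≡.cong (fromSeq r ^ₒ_) (≡.sym 2^t≡2+u))) (frob-t-fromSeq r)

  -- Inclusion of the annihilator of x in that of y.
  _≼_ : Carrier → Carrier → Set ℓ₁
  x ≼ y = ∀ r → ⟦ r ⟧ x ≈ 0# → ⟦ r ⟧ y ≈ 0#

  Detects : Carrier → Vector 𝔽₂ n → Set ℓ₁
  Detects x v = ⟦ fromSeq (vec v) ⟧ x ≈ 0# → ∀ i → v i ≡ 0ℙ

  -- If ρ = fromSeq v kills x, then adding e y with e the idempotent of ρ and
  -- ρ y ≢ 0 shrinks the annihilator of x, and ρ leaves it.
  improve : ∀ {x} → Fixed n x → ∀ v → ∃[ x′ ] Fixed n x′ × x′ ≼ x × Detects x′ v
  improve {x} fx v with Fin.all? (λ i → v i ℙ.≟ 0ℙ) | ⟦ fromSeq (vec v) ⟧ x ≟ 0#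
  ... | yes v≡0 | _        = x , fx , (λ _ → id) , λ _ → v≡0
  ... | no _    | no ρx≉0  = x , fx , (λ _ → id) , λ ρx≈0 → contradiction ρx≈0 ρx≉0
  ... | no v≢0  | yes ρx≈0 =
    x′ , fx′ , smaller , λ ρx′≈0 →
        contradiction (trans (sym ρx′≈ρy) ρx′≈0) (λ eq → ρy≉0 (trans (sym (⟦fromSeq⟧ (vec v) y)) eq))
    where
    open import Relation.Binary.Reasoning.Setoid setoid
    ρ = fromSeq (vec v)
    open A.Periodic-power {ρ} {u} (power-periodic (vec v))
    witness = Fin.¬∀⟶∃¬ n (λ i → v i ≡ 0ℙ) (λ i → v i ℙ.≟ 0ℙ) v≢0
    i = proj₁ witness
    y-spec = linearized-nonzero (vec v) (⟨⟩-periodic v) (toℕ i) (Fin.toℕ<n i)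
        (λ eq → proj₂ witness (≡.trans (≡.sym (⟨⟩-toℕ v i)) eq))
    y = proj₁ y-spec
    fy = proj₁ (proj₂ y-spec)
    ρy≉0 = proj₂ (proj₂ y-spec)
    x′ = x + ⟦ e ⟧ y
    fx′ : Fixed n x′
    fx′ = Fixed-+ n fx (⟦⟧-fixed n e fy)

    ρx′≈ρy : ⟦ ρ ⟧ x′ ≈ ⟦ ρ ⟧ y
    ρx′≈ρy = begin
      ⟦ ρ ⟧ x′                     ≈⟨ ⟦⟧-+ ρ x (⟦ e ⟧ y) ⟩
      ⟦ ρ ⟧ x + ⟦ ρ ⟧ (⟦ e ⟧ y)    ≈⟨ +-cong ρx≈0 (at (A.trans (A.*-comm ρ e) e-identity) y fy) ⟩
      0# + ⟦ ρ ⟧ y                 ≈⟨ +-identityˡ _ ⟩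
      ⟦ ρ ⟧ y                      ∎

    ex≈0 : ⟦ e ⟧ x ≈ 0#
    ex≈0 = trans (⟦⟧-comm ρ (ρ ^ₒ u) x) (trans (⟦⟧-cong (ρ ^ₒ u) ρx≈0) (⟦⟧-0 (ρ ^ₒ u)))

    x≈ : ⟦ 1ₒ +ₒ e ⟧ x′ ≈ x
    x≈ = begin
      x′ + ⟦ e ⟧ x′                                    ≈⟨ +-congˡ (⟦⟧-+ e x (⟦ e ⟧ y)) ⟩
      (x + ⟦ e ⟧ y) + (⟦ e ⟧ x + ⟦ e ⟧ (⟦ e ⟧ y))      ≈⟨ +-congˡ (+-cong ex≈0 (at e-idem y fy)) ⟩
      (x + ⟦ e ⟧ y) + (0# + ⟦ e ⟧ y)
        ≈⟨ solve 2 (λ x z → (x :+ z) :+ (con 0ℙ :+ z) := x) refl x (⟦ e ⟧ y) ⟩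
      x                                                ∎

    smaller : x′ ≼ x
    smaller r rx′≈0 = begin
      ⟦ r ⟧ x                      ≈⟨ ⟦⟧-cong r x≈ ⟨
      ⟦ r ⟧ (⟦ 1ₒ +ₒ e ⟧ x′)       ≈⟨ ⟦⟧-comm r (1ₒ +ₒ e) x′ ⟩
      ⟦ 1ₒ +ₒ e ⟧ (⟦ r ⟧ x′)       ≈⟨ ⟦⟧-cong (1ₒ +ₒ e) rx′≈0 ⟩
      ⟦ 1ₒ +ₒ e ⟧ 0#               ≈⟨ ⟦⟧-0 (1ₒ +ₒ e) ⟩
      0#                           ∎

  -- All vectors are visited by recursion on their bits. What was detected earlier stays detected,
  -- because annihilators only shrink along the way.
  improve-all : ∀ k (g : Vec.Vec 𝔽₂ k → Vector 𝔽₂ n) → ∀ {x} → Fixed n x →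
    ∃[ x′ ] Fixed n x′ × x′ ≼ x × (∀ w → Detects x′ (g w))
  improve-all zero    g fx = let x′ , fx′ , x′≼x , det = improve fx (g Vec.[]) in
    x′ , fx′ , x′≼x , λ { Vec.[] → det }
  improve-all (suc k) g fx =
    let x₀ , fx₀ , x₀≼x  , det₀ = improve-all k (g ∘ (0ℙ Vec.∷_)) fx
        x₁ , fx₁ , x₁≼x₀ , det₁ = improve-all k (g ∘ (1ℙ Vec.∷_)) fx₀
    in x₁ , fx₁ , (λ r → x₀≼x r ∘ x₁≼x₀ r) ,
       λ { (0ℙ Vec.∷ w) → det₀ w ∘ x₁≼x₀ (fromSeq (vec (g (0ℙ Vec.∷ w)))) ; (1ℙ Vec.∷ w) → det₁ w }

  normal-element : ∃[ x ] Fixed n x ×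
      (∀ (v : Vector 𝔽₂ n) → linearized n (vec v) x ≈ 0# → ∀ i → v i ≡ 0ℙ)
  -- The improvement starts from x = 0, whose annihilator is everything.
  normal-element = let x , fx , _ , det = improve-all n Vec.lookup (frob-0 n) in
    x , fx , λ v lin≈0 i → ≡.trans (≡.sym (Vec.lookup∘tabulate v i)) (det (Vec.tabulate v)
      (trans (⟦fromSeq⟧ (vec (Vec.lookup (Vec.tabulate v))) x)
      (trans (Σ-cong n λ k →
          *-congʳ {frob k x} (reflexive (≡.cong bit (Vec.lookup∘tabulate v (k ℕ.mod n))))) lin≈0)) i)

  module _ {x} (fx : Fixed n x)
      (independent : ∀ (v : Vector 𝔽₂ n) → linearized n (vec v) x ≈ 0# → ∀ i → v i ≡ 0ℙ) where
    open Span fx independent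

    private
      ρ = θ x x

      -- The complement of the idempotent that belongs to ρ; ρ is a unit as soon as ζ vanishes.
      ζ : Op
      ζ = ρ ^ₒ suc u +ₒ 1ₒ

      ζ*ρ≈0 : ζ *ₒ ρ ≈ₒ 0ₒ
      ζ*ρ≈0 = A.trans (A.distribʳ ρ (ρ ^ₒ suc u) 1ₒ) (A.x≈y⇒x+y≈0 (A.trans (A.*-comm (ρ ^ₒ suc u) ρ)
        (A.trans (power-periodic (λ k → unbit (correlation x x k))) (A.sym (A.*-identityˡ ρ)))))

      fζx : Fixed n (⟦ ζ ⟧ x)
      fζx = ⟦⟧-fixed n ζ fx

      correlation≈0 : ∀ k → correlation (⟦ ζ ⟧ x) x k ≈ 0#
      correlation≈0 = θ≈fromSeq⇒correlation {r = λ _ → 0ℙ} fζx fx (λ _ → ≡.refl)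
        (A.trans (θ-⟦⟧ˡ ζ fx fx)
            (A.trans ζ*ρ≈0 (A.sym (A.trans (A.Σ-cong n (λ k → A.zeroˡ (σ ^ₒ k))) (A.Σ-zero n)))))

      tr-bit : ∀ b y → tr n (bit b * y) ≈ bit b * tr n y
      tr-bit 0ℙ y = trans (tr-cong n (zeroˡ y)) (trans (tr-0 n) (sym (zeroˡ _)))
      tr-bit 1ℙ y = trans (tr-cong n (*-identityˡ y)) (sym (*-identityˡ _))

      tr-Σ : ∀ k f → tr n (Σ< k f) ≈ Σ[ i < k ] tr n (f i)
      tr-Σ zero    f = tr-0 n
      tr-Σ (suc k) f = trans (tr-+ n _ _) (+-congˡ (tr-Σ k (f ∘ suc)))

      orthogonal : ∀ y → Fixed n y → tr n (⟦ ζ ⟧ x * y) ≈ 0#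
      orthogonal y fy = let v , lin≈y = spanning y fy in begin
        tr n (z * y)                                          ≈⟨ tr-cong n (*-congˡ lin≈y) ⟨
        tr n (z * linearized n (vec v) x)
          ≈⟨ tr-cong n (*-distribˡ-Σ n z (λ k → bit (vec v k) * frob k x)) ⟩
        tr n (Σ[ k < n ] (z * (bit (vec v k) * frob k x)))
          ≈⟨ tr-Σ n (λ k → z * (bit (vec v k) * frob k x)) ⟩
        Σ[ k < n ] tr n (z * (bit (vec v k) * frob k x))      ≈⟨ Σ-cong n (λ k → trans
            (tr-cong n (solve 3 (λ z b f → z :* (b :* f) := b :* (z :* f)) refl z (bit (vec v k))
                (frob k x)))
            (trans (tr-bit (vec v k) (z * frob k x))
                (trans (*-congˡ {bit (vec v k)} (correlation≈0 k)) (zeroʳ (bit (vec v k)))))) ⟩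
        Σ[ k < n ] 0#                                         ≈⟨ Σ-zero n ⟩
        0#                                                    ∎
        where
        open import Relation.Binary.Reasoning.Setoid setoid
        z = ⟦ ζ ⟧ x

      ζx≈0 : ⟦ ζ ⟧ x ≈ 0#
      ζx≈0 = tr-nondegenerate n M M*m≡N fζx orthogonal

    -- From ζ ρ = 0, the element ζ x is orthogonal under the trace to all conjugates of x. These
    -- span, so ζ x = 0 by nondegeneracy; as ζ commutes with every operator, it then kills the whole
    -- span.
    θ-unit : θ x x ^ₒ suc u ≈ₒ 1ₒ
    θ-unit = A.x+y≈0⇒x≈y {ρ ^ₒ suc u} {1ₒ} (equal λ y fy → let v , lin≈y = spanning y fy in begin
      ⟦ ζ ⟧ y                            ≈⟨ ⟦⟧-cong ζ (trans (sym lin≈y) (sym (⟦fromSeq⟧ (vec v) x))) ⟩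
      ⟦ ζ ⟧ (⟦ fromSeq (vec v) ⟧ x)      ≈⟨ ⟦⟧-comm ζ (fromSeq (vec v)) x ⟩
      ⟦ fromSeq (vec v) ⟧ (⟦ ζ ⟧ x)      ≈⟨ ⟦⟧-cong (fromSeq (vec v)) ζx≈0 ⟩
      ⟦ fromSeq (vec v) ⟧ 0#             ≈⟨ ⟦⟧-0 (fromSeq (vec v)) ⟩
      0#                                 ∎)
      where open import Relation.Binary.Reasoning.Setoid setoid

  autocorrelation-realizable : ∀ r → SymmetricSeq r → PeriodicSeq r →
    ∃[ x ] Fixed n x × (∀ k → correlation x x k ≈ bit (r k))
  autocorrelation-realizable r symm per =
    let x , fx , independent = normal-element
        d , norm = norm-odd {t = t} {u} 2^t≡2+u (Sym-fromSeq symm per) (Sym-θ fx) (frob-t-fromSeq r)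
                     (frob-t-fromSeq (λ k → unbit (correlation x x k))) (θ-unit fx independent)
        fdx = ⟦⟧-fixed n d fx
    in ⟦ d ⟧ x , fdx , θ≈fromSeq⇒correlation fdx fdx per (θ-norm d fx norm)

-- Polynomials over 𝔽₂

module _ where
  open Polynomial (CommutativeRing.rawRing 𝔽₂-ring)
  open RawSemiringDefinitions (RawRing.rawSemiring rawRing) using (_∣_; _^_)
  open import Algebra.Definitions.RawMagma (RawRing.*-rawMagma rawRing) using (_,_)

  coeff-+ₚ : ∀ p q k → coeff (p +ₚ q) k ≡ coeff p k ℙ.+ coeff q k
  coeff-+ₚ []      q       k       = ≡.refl
  coeff-+ₚ (x ∷ p) []      k       = ≡.sym (ℙ.+-identityʳ _)
  coeff-+ₚ (x ∷ p) (y ∷ q) zero    = ≡.refl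
  coeff-+ₚ (x ∷ p) (y ∷ q) (suc k) = coeff-+ₚ p q k

  coeff-map : ∀ x p k → coeff (List.map (x ℙ.*_) p) k ≡ x ℙ.* coeff p k
  coeff-map x []      k       = ≡.sym (ℙ.*-zeroʳ x)
  coeff-map x (y ∷ p) zero    = ≡.refl
  coeff-map x (y ∷ p) (suc k) = coeff-map x p k

  coeff-∷* : ∀ x p q k → coeff ((x ∷ p) *ₚ q) k ≡ x ℙ.* coeff q k ℙ.+ coeff (0ℙ ∷ p *ₚ q) k
  coeff-∷* x p q k = ≡.trans (coeff-+ₚ (List.map (x ℙ.*_) q) (0ℙ ∷ p *ₚ q) k)
      (≡.cong (ℙ._+ _) (coeff-map x q k))

  *ₚ-distribʳ : ∀ p q r → (p +ₚ q) *ₚ r ≈ₚ p *ₚ r +ₚ q *ₚ r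
  *ₚ-distribʳ []      q       r k = ≡.refl
  *ₚ-distribʳ (x ∷ p) []      r k = ≡.sym (≡.trans (coeff-+ₚ ((x ∷ p) *ₚ r) [] k) (ℙ.+-identityʳ _))
  *ₚ-distribʳ (x ∷ p) (y ∷ q) r k = begin
    coeff (((x ℙ.+ y) ∷ (p +ₚ q)) *ₚ r) k
      ≡⟨ coeff-∷* (x ℙ.+ y) (p +ₚ q) r k ⟩
    (x ℙ.+ y) ℙ.* coeff r k ℙ.+ coeff (0ℙ ∷ (p +ₚ q) *ₚ r) k
      ≡⟨ ≡.cong₂ ℙ._+_ (ℙ.*-distribʳ-+ (coeff r k) x y) (tails k) ⟩
    ((x ℙ.* coeff r k) ℙ.+ (y ℙ.* coeff r k)) ℙ.+ (coeff (0ℙ ∷ p *ₚ r) k ℙ.+ coeff (0ℙ ∷ q *ₚ r) k)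
      ≡⟨ interchange (x ℙ.* coeff r k) _ _ _ ⟩
    (x ℙ.* coeff r k ℙ.+ coeff (0ℙ ∷ p *ₚ r) k) ℙ.+ (y ℙ.* coeff r k ℙ.+ coeff (0ℙ ∷ q *ₚ r) k)
      ≡⟨ ≡.cong₂ ℙ._+_ (coeff-∷* x p r k) (coeff-∷* y q r k) ⟨
    coeff ((x ∷ p) *ₚ r) k ℙ.+ coeff ((y ∷ q) *ₚ r) k
      ≡⟨ coeff-+ₚ ((x ∷ p) *ₚ r) ((y ∷ q) *ₚ r) k ⟨
    coeff ((x ∷ p) *ₚ r +ₚ (y ∷ q) *ₚ r) k ∎
    where
    open ≡.≡-Reasoning
    open import Algebra.Properties.CommutativeSemigroup ℙ.+-commutativeSemigroup using (interchange)
    tails : ∀ k → coeff (0ℙ ∷ (p +ₚ q) *ₚ r) k ≡ coeff (0ℙ ∷ p *ₚ r) k ℙ.+ coeff (0ℙ ∷ q *ₚ r) k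
    tails zero    = ≡.refl
    tails (suc k) = ≡.trans (*ₚ-distribʳ p q r k) (coeff-+ₚ (p *ₚ r) (q *ₚ r) k)

  ∣-refl : ∀ p → p ∣ p
  ∣-refl p = (1ℙ ∷ []) , λ k →
      ≡.trans (coeff-∷* 1ℙ [] p k) (≡.trans (≡.cong (coeff p k ℙ.+_) (zeros k)) (ℙ.+-identityʳ _))
    where
    zeros : ∀ k → coeff (0ℙ ∷ []) k ≡ 0ℙ
    zeros zero    = ≡.refl
    zeros (suc k) = ≡.refl

  ∣-0∷ : ∀ {p q} → p ∣ q → p ∣ (0ℙ ∷ q)
  ∣-0∷ {p} (r , rp≈q) = (0ℙ ∷ r) , λ k → ≡.trans (coeff-∷* 0ℙ r p k) (shifted k)
    where
    shifted : ∀ k → coeff (0ℙ ∷ r *ₚ p) k ≡ coeff (0ℙ ∷ _) k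
    shifted zero    = ≡.refl
    shifted (suc k) = rp≈q k

  ∣-+ₚ : ∀ {p q q′ q″} → p ∣ q → p ∣ q′ → q +ₚ q′ ≈ₚ q″ → p ∣ q″
  ∣-+ₚ {p} {q} {q′} (r , rp≈q) (r′ , r′p≈q′) eq = (r +ₚ r′) , λ k → ≡.trans (*ₚ-distribʳ r r′ p k)
    (≡.trans (coeff-+ₚ (r *ₚ p) (r′ *ₚ p) k) (≡.trans (≡.cong₂ ℙ._+_ (rp≈q k) (r′p≈q′ k))
    (≡.trans (≡.sym (coeff-+ₚ q q′ k)) (eq k))))

  length-+ₚ : ∀ p q → length p ℕ.≤ length q → length (p +ₚ q) ≡ length q
  length-+ₚ []      q       _         = ≡.refl
  length-+ₚ (x ∷ p) (y ∷ q) (s≤s p≤q) = ≡.cong suc (length-+ₚ p q p≤q)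

  -- Reverses one reduction of the Euclidean algorithm: it lets a common divisor of q + p and 1 + X
  -- q be recognized as a divisor of 1 + X p.
  +ₚ-cancel : ∀ p q → (0ℙ ∷ (q +ₚ p)) +ₚ (1ℙ ∷ q) ≈ₚ 1ℙ ∷ p
  +ₚ-cancel p q zero    = ≡.refl
  +ₚ-cancel p q (suc k) = begin
    coeff ((q +ₚ p) +ₚ q) k                 ≡⟨ coeff-+ₚ (q +ₚ p) q k ⟩
    coeff (q +ₚ p) k ℙ.+ coeff q k          ≡⟨ ≡.cong (ℙ._+ coeff q k) (coeff-+ₚ q p k) ⟩
    (coeff q k ℙ.+ coeff p k) ℙ.+ coeff q k ≡⟨ ≡.cong (ℙ._+ coeff q k) (ℙ.+-comm (coeff q k) _) ⟩
    (coeff p k ℙ.+ coeff q k) ℙ.+ coeff q k ≡⟨ ℙ.+-assoc (coeff p k) _ _ ⟩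
    coeff p k ℙ.+ (coeff q k ℙ.+ coeff q k) ≡⟨ ≡.cong (coeff p k ℙ.+_) (ℙ.p+p≡0ℙ (coeff q k)) ⟩
    coeff p k ℙ.+ 0ℙ                        ≡⟨ ℙ.+-identityʳ _ ⟩
    coeff p k                               ∎
    where open ≡.≡-Reasoning

  X^-constant : ∀ m .{{_ : NonZero m}} → coeff (X ^ m) 0 ≡ 0ℙ
  X^-constant (suc m) = ≡.trans (coeff-∷* 0ℙ (1ℙ ∷ []) (X ^ m) 0) ≡.refl

  module _ {c ℓ} (R : CommutativeRing c ℓ) (1+1≈0 : HasCharacteristicTwo R) where
    open CommutativeRing R hiding (zero)
    open CharTwo R 1+1≈0 renaming (_^_ to _↑_)
    open import Relation.Binary.Reasoning.Setoid setoid

    module Evaluation (x : Carrier) where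
      eval : Poly → Carrier
      eval []      = 0#
      eval (a ∷ p) = bit a + x * eval p

      eval-0 : ∀ p → (∀ k → coeff p k ≡ 0ℙ) → eval p ≈ 0#
      eval-0 []      _  = refl
      eval-0 (a ∷ p) eq =
          trans (+-cong (reflexive (≡.cong bit (eq 0)))
          (trans (*-congˡ (eval-0 p (eq ∘ suc))) (zeroʳ x))) (+-identityˡ 0#)

      eval-≈ₚ : ∀ p q → p ≈ₚ q → eval p ≈ eval q
      eval-≈ₚ []      q       eq = sym (eval-0 q (≡.sym ∘ eq))
      eval-≈ₚ (a ∷ p) []      eq = eval-0 (a ∷ p) eq
      eval-≈ₚ (a ∷ p) (b ∷ q) eq =
          +-cong (reflexive (≡.cong bit (eq 0))) (*-congˡ (eval-≈ₚ p q (eq ∘ suc)))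

      eval-+ₚ : ∀ p q → eval (p +ₚ q) ≈ eval p + eval q
      eval-+ₚ []      q       = sym (+-identityˡ _)
      eval-+ₚ (a ∷ p) []      = sym (+-identityʳ _)
      eval-+ₚ (a ∷ p) (b ∷ q) = trans (+-cong (bit-+ a b) (*-congˡ (eval-+ₚ p q)))
        (solve 5 (λ a b x p q → (a :+ b) :+ x :* (p :+ q) := (a :+ x :* p) :+ (b :+ x :* q)) refl
            (bit a) (bit b) x (eval p) (eval q))

      eval-map : ∀ a q → eval (List.map (a ℙ.*_) q) ≈ bit a * eval q
      eval-map a []      = sym (zeroʳ _)
      eval-map a (b ∷ q) = trans (+-cong (bit-* a b) (*-congˡ (eval-map a q)))
        (solve 4 (λ a b x q → a :* b :+ x :* (a :* q) := a :* (b :+ x :* q)) refl (bit a) (bit b) x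
            (eval q))

      eval-*ₚ : ∀ p q → eval (p *ₚ q) ≈ eval p * eval q
      eval-*ₚ []      q = sym (zeroˡ _)
      eval-*ₚ (a ∷ p) q = trans (eval-+ₚ (List.map (a ℙ.*_) q) (0ℙ ∷ p *ₚ q))
        (trans (+-cong (eval-map a q) (+-congˡ (*-congˡ (eval-*ₚ p q))))
        (solve 4 (λ a q x p → a :* q :+ (con 0ℙ :+ x :* (p :* q)) := (a :+ x :* p) :* q) refl
            (bit a) (eval q) x (eval p)))

      eval-X^ : ∀ m → eval (X ^ m) ≈ x ↑ m
      eval-X^ zero    = trans (+-congˡ (zeroʳ x)) (+-identityʳ 1#)
      eval-X^ (suc m) = trans (eval-*ₚ X (X ^ m)) (*-cong
        (solve 1 (λ x → con 0ℙ :+ x :* (con 1ℙ :+ x :* con 0ℙ) := x) refl x) (eval-X^ m))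

      eval-toList : ∀ {n} (v : Vector 𝔽₂ n) (r : ℕ → 𝔽₂) →
          (∀ i → v i ≡ r (toℕ i)) → eval (toList v) ≈ Σ[ k < n ] (bit (r k) * x ↑ k)
      eval-toList {zero}  v r eq = refl
      eval-toList {suc n} v r eq = +-cong
        (trans (reflexive (≡.cong bit (eq zero))) (sym (*-identityʳ _)))
        (trans (*-congˡ (eval-toList (v ∘ suc) (r ∘ suc) (eq ∘ suc)))
            (trans (*-distribˡ-Σ n x (λ k → bit (r (suc k)) * x ↑ k))
          (Σ-cong n (λ k → solve 3 (λ x b p → x :* (b :* p) := b :* (x :* p)) refl x
              (bit (r (suc k))) (x ↑ k)))))

      module _ (y : Carrier) where
        -- The ideal of polynomials whose value at x lies in (y). The Euclidean algorithm stays
        -- inside it, so a Bézout coefficient is obtained directly as an element of R.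
        Multiple : Poly → Set _
        Multiple p = ∃[ w ] eval p ≈ w * y

        -- x is invertible modulo a polynomial 1 + x g with constant term 1.
        Multiple-tail : ∀ f g → Multiple (0ℙ ∷ f) → Multiple (1ℙ ∷ g) → Multiple f
        Multiple-tail f g (w , f≈) (w′ , g≈) = (eval f * w′ + eval g * w) , (begin
          eval f
            ≈⟨ solve 3 (λ f g x → f := f :* (con 1ℙ :+ x :* g) :+ g :* (con 0ℙ :+ x :* f)) refl
                 (eval f) (eval g) x ⟩
          eval f * (1# + x * eval g) + eval g * (0# + x * eval f)
            ≈⟨ +-cong (*-congˡ g≈) (*-congˡ f≈) ⟩
          eval f * (w′ * y) + eval g * (w * y)
            ≈⟨ solve 5 (λ f g v w y → f :* (v :* y) :+ g :* (w :* y) := (f :* v :+ g :* w) :* y)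
                 refl (eval f) (eval g) w′ w y ⟩
          (eval f * w′ + eval g * w) * y ∎)

        Multiple-+ : ∀ f g → Multiple f → Multiple g → Multiple (f +ₚ g)
        Multiple-+ f g (w , f≈) (w′ , g≈) =
            w + w′ , trans (eval-+ₚ f g) (trans (+-cong f≈ g≈) (sym (distribʳ y w w′)))

        -- Binary Euclidean algorithm, which never divides by a leading coefficient.
        gcd : ∀ k f g → length f ℕ.+ length g ℕ.≤ k → Multiple f → Multiple (1ℙ ∷ g) →
          ∃[ d ] d ∣ f × d ∣ (1ℙ ∷ g) × Multiple d
        gcd k []        g len mf mg = (1ℙ ∷ g) , ([] , λ _ → ≡.refl) , ∣-refl (1ℙ ∷ g) , mg
        gcd (suc k) (0ℙ ∷ f) g (s≤s len) mf mg =
          let d , d∣f , d∣g , md = gcd k f g len (Multiple-tail f g mf mg) mg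
          in d , ∣-0∷ d∣f , d∣g , md
        gcd (suc k) (1ℙ ∷ f) g (s≤s len) mf mg with ℕ.≤-total (length g) (length f)
        ... | inj₁ g≤f =
          -- Both constant terms are 1 and cancel, so the sum is X (g + f). Removing X leaves a
          -- polynomial no longer than f, and the total length drops by one.
          let m+               = Multiple-tail (g +ₚ f) g (Multiple-+ (1ℙ ∷ g) (1ℙ ∷ f) mg mf) mg
              d , d∣h , d∣g , md =
                  gcd k (g +ₚ f) g
                  (≡.subst (λ l → l ℕ.+ length g ℕ.≤ k) (≡.sym (length-+ₚ g f g≤f)) len) m+ mg
          in d , ∣-+ₚ (∣-0∷ d∣h) d∣g (+ₚ-cancel f g) , d∣g , md
        ... | inj₂ f≤g =
          let m+               = Multiple-tail (f +ₚ g) f (Multiple-+ (1ℙ ∷ f) (1ℙ ∷ g) mf mg) mf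
              d , d∣h , d∣f , md =
                  gcd k (f +ₚ g) f
                  (≡.subst (λ l → l ℕ.+ length f ℕ.≤ k) (≡.sym (length-+ₚ f g f≤g))
                  (≡.subst (ℕ._≤ k) (ℕ.+-comm (length f) (length g)) len)) m+ mf
          in d , d∣f , ∣-+ₚ (∣-0∷ d∣h) d∣f (+ₚ-cancel g f) , md

        gcd-with-constant-1 : ∀ f g → coeff g 0 ≡ 1ℙ → Multiple f → Multiple g →
          ∃[ d ] d ∣ f × d ∣ g × Multiple d
        gcd-with-constant-1 f (1ℙ ∷ g) _ mf mg = gcd (length f ℕ.+ length g) f g ℕ.≤-refl mf mg

      -- Modulo the value of f both f and X ^ m - 1 vanish at x, the latter because x ^ m = 1. Hence
      -- the value of their computed common divisor d is w times that of f, and d divides 1 by the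
      -- gcd hypothesis.
      coprime⇒invertible : ∀ m .{{_ : NonZero m}} f → x ↑ m ≈ 1# →
        𝔽₂[x].IsGCD f (𝔽₂[x].X^[ m ]-1) 𝔽₂[x].1# → ∃[ w ] w * eval f ≈ 1#
      coprime⇒invertible m f x^m≈1 (_ , _ , greatest) =
        let d , d∣f , d∣g , w , d≈ = gcd-with-constant-1 (eval f) f (𝔽₂[x].X^[ m ]-1) constant
                (1# , sym (*-identityˡ _)) (0# , trans vanishes (sym (zeroˡ _)))
            r , rd≈1 = greatest d∣f d∣g
        in eval r * w , (begin
          (eval r * w) * eval f   ≈⟨ *-assoc _ _ _ ⟩
          eval r * (w * eval f)   ≈⟨ *-congˡ d≈ ⟨
          eval r * eval d         ≈⟨ eval-*ₚ r d ⟨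
          eval (r *ₚ d)           ≈⟨ eval-≈ₚ (r *ₚ d) (1ℙ ∷ []) rd≈1 ⟩
          1# + x * 0#             ≈⟨ trans (+-congˡ (zeroʳ x)) (+-identityʳ 1#) ⟩
          1#                      ∎)
        where
        constant : coeff (𝔽₂[x].X^[ m ]-1) 0 ≡ 1ℙ
        constant = ≡.trans (coeff-+ₚ (X ^ m) (1ℙ ∷ []) 0) (≡.cong (ℙ._+ 1ℙ) (X^-constant m))
        vanishes : eval (𝔽₂[x].X^[ m ]-1) ≈ 0#
        vanishes = trans (eval-+ₚ (X ^ m) (1ℙ ∷ [])) (x≈y⇒x+y≈0 (trans (eval-X^ m) (trans x^m≈1
          (sym (trans (+-congˡ (zeroʳ x)) (+-identityʳ 1#))))))

-- The product of the two parts

odd⇒l+1+l : ∀ m → ℕ.parity m ≡ 1ℙ → ∃[ l ] m ≡ l ℕ.+ suc l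
odd⇒l+1+l (suc zero)    _   = 0 , ≡.refl
odd⇒l+1+l (suc (suc m)) odd = let l , eq = odd⇒l+1+l m odd in
  suc l , ≡.cong suc (≡.trans (≡.cong suc eq) (≡.sym (ℕ.+-suc l (suc l))))

vec-symmetric : ∀ {n} .{{_ : NonZero n}} (v : Vector 𝔽₂ n) → Symmetric v → ∀ i j → i ℕ.+ j ≡ n →
    v ⟨ i ⟩ ≡ v ⟨ j ⟩
vec-symmetric {n} v symm zero      j         ≡.refl =
    ≡.sym (≡.trans (≡.cong (v ⟨_⟩) (≡.sym (ℕ.+-identityʳ n))) (⟨⟩-periodic v 0))
vec-symmetric {n} v symm i@(suc _) zero      eq =
    ≡.trans (≡.cong (v ⟨_⟩)
    (≡.trans (≡.sym (ℕ.+-identityʳ i)) (≡.trans eq (≡.sym (ℕ.+-identityʳ n))))) (⟨⟩-periodic v 0)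
vec-symmetric {n} v symm i@(suc a) j@(suc b) eq = symm _ _ (≡.trans (≡.cong₂ ℕ._+_
  (≡.trans (Fin.toℕ-fromℕ< _) (ℕ.m<n⇒m%n≡m (≡.subst (i ℕ.<_) eq (ℕ.m<m+n i (s≤s z≤n)))))
  (≡.trans (Fin.toℕ-fromℕ< _) (ℕ.m<n⇒m%n≡m (≡.subst (j ℕ.<_) eq (ℕ.m<n+m j (s≤s z≤n)))))) eq)

module Product {c ℓ₁ ℓ₂} (F : HeytingField c ℓ₁ ℓ₂) (t l : ℕ)
  (order : Extension.HasOrder F (2 ℕ.^ (2 ℕ.^ suc (suc t) ℕ.* (l ℕ.+ suc l)))) where

  s m N : ℕ
  s = suc (suc t)
  m = l ℕ.+ suc l
  N = 2 ℕ.^ s ℕ.* m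

  private instance
    m≢0 : NonZero m
    m≢0 = ≡.subst NonZero (≡.sym (ℕ.+-suc l l)) _
    2^s≢0 : NonZero (2 ℕ.^ s)
    2^s≢0 = ℕ.m^n≢0 2 s
    N≢0 : NonZero N
    N≢0 = ℕ.m*n≢0 (2 ℕ.^ s) m

  open SequenceRing F N order N
  open A using () renaming (_^_ to _^ₒ_)
  open CommutativeRing F-ring hiding (zero) 
  open Extension F

  -- The conjugates of the two factors have coprime periods 2 ^ s and m, so the sum over all
  -- conjugates of the product separates into two traces.
  correlation-product : ∀ {x y} → Fixed (2 ℕ.^ s) x → Fixed m y → ∀ k →
    tr N ((x * y) * frob k (x * y)) ≈ tr (2 ℕ.^ s) (x * frob k x) * tr m (y * frob k y)
  correlation-product {x} {y} fx fy k = trans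
    (Σ-cong N (λ j → trans
      (frob-cong j (trans (*-congˡ (frob-* k x y))
        (solve 4 (λ x y p q → (x :* y) :* (p :* q) := (x :* p) :* (y :* q)) refl x y (frob k x)
            (frob k y))))
      (frob-* j (x * frob k x) (y * frob k y))))
    (Σ-CRT s l {λ j → frob j (x * frob k x)} {λ j → frob j (y * frob k y)}
      (frob-periodic (2 ℕ.^ s) _ (Fixed-* (2 ℕ.^ s) fx (Fixed-frob (2 ℕ.^ s) k fx)))
      (frob-periodic m _ (Fixed-* m fy (Fixed-frob m k fy))))

  -- Mirror indices cancel in pairs in characteristic two; only 0 and h have no partner.
  Σ-symmetric : ∀ h (p : ℕ → Op) →
      (∀ i j → i ℕ.+ j ≡ h ℕ.+ h → p i ≈ₒ p j) → A.Σ< (h ℕ.+ h) p ≈ₒ p 0 A.+ p h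
  Σ-symmetric h p symm = begin
    A.Σ< (h ℕ.+ h) p
      ≈⟨ A.Σ-split h h p ⟩
    A.Σ< h p A.+ A.Σ< h (λ k → p (h ℕ.+ k))
      ≈⟨ A.+-congˡ (A.Σ-reverse h (λ k → p (h ℕ.+ k))) ⟩
    A.Σ< h p A.+ A.Σ< h (λ k → p (h ℕ.+ (h ℕ.∸ suc k)))
      ≈⟨ A.+-congˡ
           (A.Σ-cong-< h
           (λ k k<h → symm _ (suc k)
           (≡.trans (ℕ.+-assoc h _ (suc k)) (≡.cong (h ℕ.+_) (ℕ.m∸n+n≡m k<h))))) ⟩
    A.Σ< h p A.+ A.Σ< h (λ k → p (suc k))
      ≈⟨ A.solve 3 (λ a P S → P A.:+ S A.:= a A.:+ (P A.:+ (a A.:+ S))) A.refl (p 0) (A.Σ< h p)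
           (A.Σ< h (λ k → p (suc k))) ⟩
    p 0 A.+ (A.Σ< h p A.+ A.Σ< (suc h) p)
      ≈⟨ A.+-congˡ (A.+-congˡ (A.Σ-last h p)) ⟩
    p 0 A.+ (A.Σ< h p A.+ (A.Σ< h p A.+ p h))
      ≈⟨ A.solve 3 (λ a P b → a A.:+ (P A.:+ (P A.:+ b)) A.:= a A.:+ b) A.refl (p 0) (A.Σ< h p) (p h) ⟩
    p 0 A.+ p h ∎
    where open import Relation.Binary.Reasoning.Setoid A.setoid

  module _ (a : Vector 𝔽₂ (2 ℕ.^ s)) (a-sym : Symmetric a) (a0 : a ⟨ 0 ⟩ ≡ 1ℙ)
      (ah : a ⟨ 2 ℕ.^ suc t ⟩ ≡ 0ℙ)
    (b : Vector 𝔽₂ m) (b-coprime : 𝔽₂[x].IsGCD (toList b) (𝔽₂[x].X^[ m ]-1) 𝔽₂[x].1#) where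

    private
      r : ℕ → 𝔽₂
      r k = (a ⟨ k ⟩) ℙ.* (b ⟨ k ⟩)

      -- A power of σ with τ ^ m = 1, so that b can be evaluated at it and the coprimality with X ^
      -- m - 1 applies.
      τ : Op
      τ = σ ^ₒ (2 ℕ.^ s)

      τ^m≈1 : τ ^ₒ m ≈ₒ 1ₒ
      τ^m≈1 = A.trans (A.^-assocʳ σ (2 ℕ.^ s) m) σ^n≈1

      B : Op
      B = A.Σ< m (λ k → A.bit (b ⟨ k ⟩) A.* τ ^ₒ k)

      open Evaluation (Op-ring N) (equal λ x _ → x+x≈0 x) τ

      B-inverse : ∃[ w ] w A.* B ≈ₒ 1ₒ
      B-inverse = let w , w*b≈1 = coprime⇒invertible m (toList b) τ^m≈1 b-coprime in
        w , A.trans (A.*-congˡ {w} (A.sym (eval-toList b (vec b) (λ i → ≡.sym (⟨⟩-toℕ b i))))) w*b≈1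

      Σa≈1 : A.Σ< (2 ℕ.^ s) (λ k → A.bit (a ⟨ k ⟩)) ≈ₒ 1ₒ
      Σa≈1 = A.trans
          (A.reflexive (≡.cong (λ n → A.Σ< n (λ k → A.bit (a ⟨ k ⟩))) (≡.sym (2^suc (suc t)))))
        (A.trans (Σ-symmetric (2 ℕ.^ suc t) (λ k → A.bit (a ⟨ k ⟩))
          (λ i j eq → A.reflexive
              (≡.cong A.bit (vec-symmetric a a-sym i j (≡.trans eq (2^suc (suc t)))))))
        (A.trans (A.+-cong (A.reflexive (≡.cong A.bit a0)) (A.reflexive (≡.cong A.bit ah)))
            (A.+-identityʳ 1ₒ)))

    -- Raising to the power 2 ^ s replaces σ ^ k by τ ^ k, which depends on k modulo m only. What
    -- then depends on k modulo 2 ^ s is the bit of a alone, so the sum factors.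
    frob-product : A.frob s (fromSeq r) ≈ₒ B
    frob-product = begin
      A.frob s (fromSeq r)
        ≈⟨ frob-fromSeq s r ⟩
      A.Σ< N (λ k → A.bit (r k) A.* σ ^ₒ (k ℕ.* 2 ℕ.^ s))
        ≈⟨ A.Σ-cong N (λ k → A.trans (A.*-cong (A.bit-* (a ⟨ k ⟩) (b ⟨ k ⟩))
             (A.trans (A.reflexive (≡.cong (σ ^ₒ_) (ℕ.*-comm k (2 ℕ.^ s))))
                 (A.sym (A.^-assocʳ σ (2 ℕ.^ s) k))))
             (A.*-assoc (A.bit (a ⟨ k ⟩)) (A.bit (b ⟨ k ⟩)) (τ ^ₒ k))) ⟩
      A.Σ< N (λ k → A.bit (a ⟨ k ⟩) A.* (A.bit (b ⟨ k ⟩) A.* τ ^ₒ k))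
        ≈⟨ A.Σ-CRT s l {λ k → A.bit (a ⟨ k ⟩)} {λ k → A.bit (b ⟨ k ⟩) A.* τ ^ₒ k}
             (λ k → A.reflexive (≡.cong A.bit (⟨⟩-periodic a k)))
             (λ k → A.*-cong (A.reflexive (≡.cong A.bit (⟨⟩-periodic b k)))
               (A.trans (A.^-homo-* τ m k)
                   (A.trans (A.*-congʳ {τ ^ₒ k} τ^m≈1) (A.*-identityˡ (τ ^ₒ k))))) ⟩
      A.Σ< (2 ℕ.^ s) (λ k → A.bit (a ⟨ k ⟩)) A.* B
        ≈⟨ A.*-congʳ {B} Σa≈1 ⟩
      1ₒ A.* B
        ≈⟨ A.*-identityˡ B ⟩
      B ∎
      where open import Relation.Binary.Reasoning.Setoid A.setoid

    -- A relation ρ x = 0 gives ρ C = θ (ρ x) x = 0, where C = θ x x is a divisor of the unit B. So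
    -- ρ is the zero operator, and its coefficients vanish by faithfulness.
    independent : ∀ {x} → (∀ k → correlation x x k ≈ bit (r k)) →
      ∀ (v : Vector 𝔽₂ N) → linearized N (vec v) x ≈ 0# → ∀ i → v i ≡ 0ℙ
    independent {x} corr v lin≈0 i = ≡.trans (≡.sym (⟨⟩-toℕ v i))
      (linearized-independent N ℕ.≤-refl (vec v)
          (λ y → trans (sym (⟦fromSeq⟧ (vec v) y)) (at ρ≈0 y (Fixed-N y))) (toℕ i) (Fin.toℕ<n i))
      where
      open import Relation.Binary.Reasoning.Setoid A.setoid
      ρ = fromSeq (vec v)
      C = fromSeq r
      u = ℕ.pred (2 ℕ.^ s)
      w = proj₁ B-inverse

      ρ*C≈0 : ρ A.* C ≈ₒ 0ₒ
      ρ*C≈0 = begin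
        ρ A.* C
          ≈⟨ A.*-congˡ {ρ} (A.Σ-cong N (λ k → A.*-congʳ {σ ^ₒ k} (A.reflexive (≡.cong A.bit
                                  (bit-injective {r k} {unbit (correlation x x k)}
                                      (trans (sym (corr k))
                                      (sym (bit-unbit
                                      (correlation-01 (Fixed-N x) (Fixed-N x) k))))))))) ⟩
        ρ A.* θ x x          ≈⟨ θ-⟦⟧ˡ ρ (Fixed-N x) (Fixed-N x) ⟨
        θ (⟦ ρ ⟧ x) x        ≈⟨ A.Σ-cong N (λ k → A.*-congʳ {σ ^ₒ k} (A.reflexive (≡.cong A.bit
                                  (unbit-cong {correlation (⟦ ρ ⟧ x) x k} {correlation 0# x k}
                                      (tr-cong N (*-congʳ {frob k x}
                                      (trans (⟦fromSeq⟧ (vec v) x) lin≈0))))))) ⟩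
        θ 0# x               ≈⟨ θ-⟦⟧ˡ 0ₒ (Fixed-N x) (Fixed-N x) ⟩
        0ₒ A.* θ x x         ≈⟨ A.zeroˡ (θ x x) ⟩
        0ₒ                   ∎

      ρ≈0 : ρ ≈ₒ 0ₒ
      ρ≈0 = begin
        ρ                            ≈⟨ A.*-identityʳ ρ ⟨
        ρ A.* 1ₒ                     ≈⟨ A.*-congˡ {ρ} (proj₂ B-inverse) ⟨
        ρ A.* (w A.* B)              ≈⟨ A.*-congˡ {ρ} (A.*-congˡ {w} frob-product) ⟨
        ρ A.* (w A.* C ^ₒ (2 ℕ.^ s))   ≡⟨ ≡.cong (λ k → ρ A.* (w A.* C ^ₒ k)) (ℕ.suc-pred (2 ℕ.^ s)) ⟨
        ρ A.* (w A.* (C A.* C ^ₒ u))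
          ≈⟨ A.solve 4 (λ ρ w C D → ρ A.:* (w A.:* (C A.:* D)) A.:= (ρ A.:* C) A.:* (w A.:* D))
               A.refl ρ w C (C ^ₒ u) ⟩
        (ρ A.* C) A.* (w A.* C ^ₒ u) ≈⟨ A.*-congʳ {w A.* C ^ₒ u} ρ*C≈0 ⟩
        0ₒ A.* (w A.* C ^ₒ u)        ≈⟨ A.zeroˡ (w A.* C ^ₒ u) ⟩
        0ₒ                           ∎

  ι≡bit : ∀ x → ι x ≡ bit x
  ι≡bit 0ℙ = ≡.refl
  ι≡bit 1ℙ = ≡.refl

  combination≈linearized : ∀ x (v : Vector 𝔽₂ N) →
      combination v (conjugates N x) ≈ linearized N (vec v) x
  combination≈linearized x v = sum-cong-≋ {N} (λ i →
    *-congʳ (reflexive (≡.trans (ι≡bit (v i)) (≡.cong bit (≡.sym (⟨⟩-toℕ v i))))))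
    where open import Algebra.Properties.Semiring.Sum semiring using (sum-cong-≋)

  IsNormal-from-independent : ∀ {x} →
      (∀ (v : Vector 𝔽₂ N) → linearized N (vec v) x ≈ 0# → ∀ i → v i ≡ 0ℙ) → IsNormal N x
  IsNormal-from-independent {x} indep =
    (λ v eq → indep v (trans (sym (combination≈linearized x v)) eq)) ,
    (λ y → let v , eq = Span.spanning (Fixed-N x) indep y (Fixed-N y)
           in v , trans (combination≈linearized x v) eq)

  normal-with-corresponding-vector :
    (a : Vector 𝔽₂ (2 ℕ.^ s)) → Symmetric a → a ⟨ 0 ⟩ ≡ 1ℙ → a ⟨ 2 ℕ.^ suc t ⟩ ≡ 0ℙ →
    𝔽₂.sum (λ (i : Fin (2 ℕ.^ suc t)) → if does (ℕ.parity (toℕ i) ℙ.≟ 1ℙ) then a ⟨ toℕ i ⟩ else 0ℙ)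
        ≡ 1ℙ →
    (b : Vector 𝔽₂ m) → Symmetric b → 𝔽₂[x].IsGCD (toList b) (𝔽₂[x].X^[ m ]-1) 𝔽₂[x].1# →
    ∃[ α ] IsNormal N α ×
      ∃[ v ] IsCorrespondingVector N α v × (∀ (k : Fin N) → v k ≡ a ⟨ toℕ k ⟩ 𝔽₂.* b ⟨ toℕ k ⟩)
  normal-with-corresponding-vector a a-sym a0 ah a-odd b b-sym b-coprime =
    let β , fβ , corr-β = BinaryPart.autocorrelation-realizable F N order t m
                            (ℕ.*-comm m (2 ℕ.^ s)) (vec a)
                            (vec-symmetric a a-sym) (⟨⟩-periodic a) a0 ah odd-sum
        γ , fγ , corr-γ = OddPart.autocorrelation-realizable F N order l (2 ℕ.^ s) ≡.refl (vec b)
                            (vec-symmetric b b-sym) (⟨⟩-periodic b)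
        corr k = trans (correlation-product fβ fγ k)
                   (trans (*-cong (corr-β k) (corr-γ k)) (sym (bit-* (a ⟨ k ⟩) (b ⟨ k ⟩))))
    in (β * γ) , IsNormal-from-independent (independent a a-sym a0 ah b b-coprime corr) ,
       (λ k → a ⟨ toℕ k ⟩ 𝔽₂.* b ⟨ toℕ k ⟩) ,
       (λ k → trans (reflexive (ι≡bit (a ⟨ toℕ k ⟩ 𝔽₂.* b ⟨ toℕ k ⟩))) (sym (corr (toℕ k)))) ,
       (λ k → ≡.refl)
    where
    odd-sum : Σ[ k < 2 ℕ.^ suc t ] (bit (a ⟨ k ⟩) * bit (ℕ.parity k)) ≈ 1#
    odd-sum = trans (Σ-cong (2 ℕ.^ suc t) term)
      (trans (sym (bit-sum (2 ℕ.^ suc t) f)) (reflexive (≡.cong bit a-odd)))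
      where
      f : ℕ → 𝔽₂
      f k = if does (ℕ.parity k ℙ.≟ 1ℙ) then a ⟨ k ⟩ else 0ℙ
      term : ∀ k → bit (a ⟨ k ⟩) * bit (ℕ.parity k) ≈ bit (f k)
      term k with ℕ.parity k
      ... | 0ℙ = zeroʳ _
      ... | 1ℙ = *-identityʳ _

open import Data.Nat.Base using (_*_; _^_; _∸_; _≤_; parity)
open import Data.Nat.Properties using (m^n≢0)
open import Data.Parity.Properties using (_≟_)

proposition5p4 :
  ∀ {c ℓ₁ ℓ₂} (s m : ℕ) .{{_ : NonZero m}} →
  parity m ≡ 1ℙ → 4 ≤ 2 ^ s →
  (F : HeytingField c ℓ₁ ℓ₂) → let open Extension F in let N = 2 ^ s * m in
  let instance _ = m^n≢0 2 s in
  HasOrder (2 ^ N) →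
  (a : Vector 𝔽₂ (2 ^ s)) → Symmetric a →
  a ⟨ 0 ⟩ ≡ 1ℙ →
  a ⟨ 2 ^ (s ∸ 1) ⟩ ≡ 0ℙ →
  𝔽₂.sum (λ (i : Fin (2 ^ (s ∸ 1))) →
    if does (parity (toℕ i) ≟ 1ℙ) then a ⟨ toℕ i ⟩ else 0ℙ) ≡ 1ℙ →
  (b : Vector 𝔽₂ m) → Symmetric b →
  𝔽₂[x].IsGCD (toList b) (𝔽₂[x].X^[ m ]-1) 𝔽₂[x].1# →
  ∃[ α ] IsNormal N α ×
    ∃[ v ] IsCorrespondingVector N α v ×
      (∀ (k : Fin N) → v k ≡ a ⟨ toℕ k ⟩ 𝔽₂.* b ⟨ toℕ k ⟩)
proposition5p4 (suc zero)    m odd (s≤s (s≤s ()))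
proposition5p4 (suc (suc t)) m odd _ F order a a-sym a0 ah a-odd b b-sym b-coprime
  with odd⇒l+1+l m odd
... | l , ≡.refl =
    Product.normal-with-corresponding-vector F t l order a a-sym a0 ah a-odd b b-sym b-coprime
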